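{- Let $$F_{1,- }(x)=\frac{ -1-x-2x^2-2x^3-2x^4-2x^5-x^6+x^7+x^8+2x^9+x^{10}+x^{11}-x^{14}}{ -1+x+x^3+x^4-2x^8-x^9-2x^{10}+x^{13}+x^{15}},$$ $$F_{1,+}(x)=\frac{ -1-x^2+x^6+2x^7+x^8+2x^9+x^{10}+x^{11}-x^{14}}{ -1+2x-x^2+x^3-x^5-x^8-x^{10}+x^{11}-x^{12}+x^{13}+x^{15}},$$ $$F_{2,- }(x)=\frac{1+x+x^2+2x^3+2x^4+2x^5+2x^6+x^7-x^{10}-x^{11}-x^{12}}{1-x-x^2-x^4-x^5+x^8+2x^9+x^{10}+x^{11}+x^{12}+x^{13}-x^{14}},$$ $$F_{2,+}(x)=\frac{1+x^3-x^7-x^8-x^9-2x^{10}-x^{11}-x^{12}}{1-2x+x^3-x^4+x^6+x^8+x^{11}+x^{13}-x^{14}}$$ be the generating functions obtained from the truncated transfer matrices described in the context, and let $f_{1,- },f_{1,+},f_{2,- },f_{2,+}$ be the corresponding counting sequences. The denominators of $F_{1,- },F_{1,+},F_{2,- },F_{2,+}$ have unique minimal roots, respectively $$r=0.65149869151455837735\ldots,\quad s=0.65145978572056851317\ldots,\quad t=0.55979335021175578170\ldots,\quad u=0.55977426822528580510\ldots.$$ This gives the asymptotic lower bounds $$f_1(n)>f_{1,- }(n)=\Theta\big((1/r)^n\big)=\Theta(1.5349224995\ldots^n),\qquad f_2(n)>f_{2,- }(n)=\Theta\big((1/t)^n\big)=\Theta(1.786373489\ldots^n),$$ and the asymptotic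 upper bounds $$f_1(n)<f_{1,+}(n)=\Theta\big((1/s)^n\big)=\Theta(1.535014167\ldots^n),\qquad f_2(n)<f_{2,+}(n)=\Theta\big((1/u)^n\big)=\Theta(1.786434384\ldots^n).$$
   Context: A permutation $\pi:[n]\to[n]$, where $[n]=\{1,\ldots,n\}$, is $k$-convex (for an integer $k\ge 0$) if $\pi(i-1)+\pi(i+1)-2\pi(i)\le k$ for all $i\in\{2,\ldots,n-1\}$; $f_k(n)$ denotes the number of $k$-convex permutations of length $n$. The left and right descendants of $\pi$ are $L(\pi)=1(\pi(1)+1)\cdots(\pi(n)+1)$ and $R(\pi)=(\pi(1)+1)\cdots(\pi(n)+1)1$. For $k\in\{1,2\}$, the $k$-convex transition digraph has as vertices $k$-convex permutations up to having the same number of $k$-convex descendants in every generation (a permutation and its reverse are identified), with edges from a vertex to the vertices of its $k$-convex left and right descendants; a vertex is abbreviated by the first two and last two entries of a representative, and the starting vertex is the permutation 12. Half of the $k$-convex permutations are counted by walks in this infinite digraph starting at 12. For a finite truncation with adjacency matrix $M$ (12 being the first vertex), the generating function for walks by length is the sum of the first-row entries of $(I-xM)^{ -1}$. The functions $F_{1,- }$ and $F_{2,- }$ come from truncating the digraph at the edge from 1267 to 1278 (for $k=1$) and at the edge from 1278 to 1289 (for $k=2$), leaving 22 and 24 vertices respectively; $F_{1,+}$ and $F_{2,+}$ come from these truncations with a loop inserted (described as a loop at 1267 for $k=1$, entered as a 1 in the 22nd row and column of the matrix, and as a loop at 1278 for $k=2$). The corresponding sequences are $f_{k,\pm}(n)=2[x^{n-2}]F_{k,\pm}(x)$,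 where $[x^m]$ denotes the coefficient of $x^m$.
   Formalization: The printed F_{1,+}, F_{2,+} do not arise from a loop at 1267/1278; the loop is instead a 1 in the last row and column for some vertex order starting at 12. The vertex counts 22, 24 (truly 21, 22) are not asserted; decimals are read as rounded; bounds hold for all large n. -}

module Defs where

open import Data.Bool.Base using (if_then_else_)
open import Data.Fin.Base using (Fin; zero; suc; fromℕ)
import Data.Fin.Properties as Fin
open import Data.Integer.Base as ℤ using (ℤ; +_; -_; 0ℤ)
import Data.Integer.Properties as ℤ
open import Data.List.Base using (List; []; _∷_; _∷ʳ_; _++_; [_]; map; length; filter; applyUpTo; cartesianProductWith)
open import Data.List.Relation.Unary.All using (All; all?)
open import Data.List.Relation.Unary.Unique.Propositional using (Unique)
open import Data.List.Relation.Unary.Unique.DecPropositional using (unique?)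
open import Data.Maybe.Base using (Maybe; just; nothing)
open import Data.Nat.Base as ℕ using (ℕ; zero; suc; _⊔_)
import Data.Nat.Properties as ℕ
open import Data.Product.Base using (Σ-syntax; ∃-syntax; _×_; _,_; proj₁; proj₂)
open import Data.Rational.Unnormalised.Base as ℚ using (ℚᵘ; 0ℚᵘ; 1ℚᵘ; ½; ∣_∣)
import Data.Rational.Unnormalised.Properties as ℚ
open import Data.Rational.Unnormalised.Solver using (module +-*-Solver)
open import Data.Sum.Base using (_⊎_)
open import Data.Unit.Base using (⊤; tt)
import Data.Vec.Functional as Vector
open import Relation.Binary.Construct.Closure.ReflexiveTransitive using (Star)
open import Relation.Binary.PropositionalEquality.Core using (_≡_; refl)
open import Relation.Nullary using (¬_; Dec; yes; does)
open import Relation.Nullary.Decidable using (_×-dec_)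
open import Relation.Unary using (Decidable)
open +-*-Solver using (solve; _:=_; _:+_; _:*_; _:-_; :-_)

------------------------------------------------------------------------
-- k-convex permutations

-- Permutations are written in one-line notation, with letters 1, …, n.

IsPermutation : List ℕ → Set
IsPermutation π = Unique π × All (λ a → 1 ℕ.≤ a × a ℕ.≤ length π) π

KConvex : ℕ → List ℕ → Set
KConvex k (a ∷ b ∷ c ∷ π) = (+ a ℤ.+ + c ℤ.- + 2 ℤ.* + b ℤ.≤ + k) × KConvex k (b ∷ c ∷ π)
KConvex k _               = ⊤

isPermutation? : Decidable IsPermutation
isPermutation? π = unique? ℕ._≟_ π ×-dec all? (λ a → (1 ℕ.≤? a) ×-dec (a ℕ.≤? length π)) π

kConvex? : ∀ k → Decidable (KConvex k)
kConvex? k []              = yes tt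
kConvex? k (a ∷ [])        = yes tt
kConvex? k (a ∷ b ∷ [])    = yes tt
kConvex? k (a ∷ b ∷ c ∷ π) =
  ((+ a ℤ.+ + c ℤ.- + 2 ℤ.* + b) ℤ.≤? + k) ×-dec kConvex? k (b ∷ c ∷ π)

words : List ℕ → ℕ → List (List ℕ)
words A zero    = [ [] ]
words A (suc n) = cartesianProductWith _∷_ A (words A n)

identity : ℕ → List ℕ
identity n = applyUpTo suc n

f : ℕ → ℕ → ℕ
f k n = length (filter (λ π → isPermutation? π ×-dec kConvex? k π) (words (identity n) n))

------------------------------------------------------------------------
-- The truncated k-convex transition digraphs

data Side : Set where
  left right : Side

descendant : Side → List ℕ → List ℕ
descendant left  π = 1 ∷ map suc π
descendant right π = map suc π ∷ʳ 1

-- For nonempty π, the 2 ^ g descendants in generation g are pairwise distinct.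
generation : ℕ → List ℕ → List (List ℕ)
generation zero    π = [ π ]
generation (suc g) π = generation g (descendant left π) ++ generation g (descendant right π)

convexDescendants : ℕ → ℕ → List ℕ → ℕ
convexDescendants k g π = length (filter (kConvex? k) (generation g π))

-- Reversal exchanges left and right descendants, so it never changes the class of a permutation.
SameVertex : ℕ → List ℕ → List ℕ → Set
SameVertex k π σ = ∀ g → convexDescendants k g π ≡ convexDescendants k g σ

-- The part of the k-convex transition digraph that can be reached from 12 once the edge from
-- the vertex of υ to the vertex of ω has been deleted.  The edges leaving a vertex are indexed
-- by the side of the descendant, so that parallel edges are counted separately.
record Truncation (k : ℕ) (υ ω : List ℕ) : Set where
  field
    last : ℕ  -- the index of the last vertex

  Vertex : Set
  Vertex = Fin (suc last)

  field
    rep  : Vertex → List ℕ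
    edge : Vertex → Side → Maybe Vertex

  Deleted : Vertex → Side → Set
  Deleted i s = SameVertex k (rep i) υ × SameVertex k (descendant s (rep i)) ω

  field
    rep-start       : rep zero ≡ 1 ∷ 2 ∷ []
    rep-permutation : ∀ i → IsPermutation (rep i)
    rep-convex      : ∀ i → KConvex k (rep i)
    rep-distinct    : ∀ i j → SameVertex k (rep i) (rep j) → i ≡ j
    edge-present    : ∀ i s j → edge i s ≡ just j →
                      KConvex k (descendant s (rep i)) ×
                      SameVertex k (descendant s (rep i)) (rep j) ×
                      ¬ Deleted i s
    edge-absent     : ∀ i s → edge i s ≡ nothing →
                      ¬ KConvex k (descendant s (rep i)) ⊎ Deleted i s
    reachable       : ∀ i → Star (λ a b → ∃[ s ] edge a s ≡ just b) zero i

Matrix : ℕ → Set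
Matrix n = Fin n → Fin n → ℕ

∑ : ∀ {n} → (Fin n → ℕ) → ℕ
∑ = Vector.foldr ℕ._+_ 0

𝟙 : ∀ {n} → Matrix n
𝟙 i j = if does (i Fin.≟ j) then 1 else 0

power : ∀ {n} → Matrix n → ℕ → Matrix n
power M zero    = 𝟙
power M (suc m) = λ i j → ∑ (λ l → M i l ℕ.* power M m l j)

adjacency : ∀ {k υ ω} (T : Truncation k υ ω) → Matrix (suc (Truncation.last T))
adjacency T i j = hits (edge i left) ℕ.+ hits (edge i right)
  where
  open Truncation T
  hits : Maybe Vertex → ℕ
  hits (just l) = 𝟙 l j
  hits nothing  = 0

-- The matrix with a 1 put in the last row and last column.  The printed F_{k,+} arise when the
-- vertex listed last is the one of the permutations 12 … (12)5 (k = 1) or 12 … (13)5 (k = 2);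
-- a loop at 1267 or 1278 would give a different function.
withLoopAtLast : ∀ {m} → Matrix (suc m) → Matrix (suc m)
withLoopAtLast {m} M i j = M i j ℕ.+ 𝟙 i (fromℕ m) ℕ.* 𝟙 j (fromℕ m)

-- The coefficient of x ^ m in the sum of the first row of (I - x M)⁻¹ = Σₘ M ^ m x ^ m,
-- that is, the number of walks of length m from the first vertex.
walks : ∀ {m} → Matrix (suc m) → ℕ → ℕ
walks M m = ∑ (power M m zero)

------------------------------------------------------------------------
-- Rational generating functions

-- Coefficients in order of increasing degree.
Polynomial : Set
Polynomial = List ℤ

record RationalFunction : Set where
  constructor _∕_
  field
    num den : Polynomial
open RationalFunction public

constantTerm : Polynomial → ℤ
constantTerm []      = 0ℤ
constantTerm (c ∷ _) = c

subtractMultiple : Polynomial → ℤ → Polynomial → Polynomial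
subtractMultiple P       c []      = P
subtractMultiple []      c (b ∷ Q) = - (c ℤ.* b) ∷ subtractMultiple [] c Q
subtractMultiple (a ∷ P) c (b ∷ Q) = a ℤ.- c ℤ.* b ∷ subtractMultiple P c Q

divideByX : Polynomial → Polynomial
divideByX []      = []
divideByX (_ ∷ P) = P

-- Coefficients of the power series expansion P / Q = c + x (P - c Q) / (x Q), where
-- c = P(0) / Q(0).  All denominators below have Q(0) = 1 or Q(0) = -1, so c = P(0) Q(0).
coefficient : ℕ → RationalFunction → ℤ
coefficient zero    (P ∕ Q) = constantTerm P ℤ.* constantTerm Q
coefficient (suc n) (P ∕ Q) =
  coefficient n (divideByX (subtractMultiple P (constantTerm P ℤ.* constantTerm Q) Q) ∕ Q)

-- f_{k,±} (n) = 2 [x ^ (n - 2)] F_{k,±}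
sequence : RationalFunction → ℕ → ℤ
sequence F (suc (suc m)) = + 2 ℤ.* coefficient m F
sequence F _             = 0ℤ

F₁₋ : RationalFunction
F₁₋ =
  (- + 1 ∷ - + 1 ∷ - + 2 ∷ - + 2 ∷ - + 2 ∷ - + 2 ∷ - + 1 ∷ + 1 ∷ + 1 ∷ + 2 ∷ + 1 ∷ + 1 ∷ + 0 ∷ + 0 ∷ - + 1 ∷ [])
  ∕
  (- + 1 ∷ + 1 ∷ + 0 ∷ + 1 ∷ + 1 ∷ + 0 ∷ + 0 ∷ + 0 ∷ - + 2 ∷ - + 1 ∷ - + 2 ∷ + 0 ∷ + 0 ∷ + 1 ∷ + 0 ∷ + 1 ∷ [])

F₁₊ : RationalFunction
F₁₊ =
  (- + 1 ∷ + 0 ∷ - + 1 ∷ + 0 ∷ + 0 ∷ + 0 ∷ + 1 ∷ + 2 ∷ + 1 ∷ + 2 ∷ + 1 ∷ + 1 ∷ + 0 ∷ + 0 ∷ - + 1 ∷ [])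
  ∕
  (- + 1 ∷ + 2 ∷ - + 1 ∷ + 1 ∷ + 0 ∷ - + 1 ∷ + 0 ∷ + 0 ∷ - + 1 ∷ + 0 ∷ - + 1 ∷ + 1 ∷ - + 1 ∷ + 1 ∷ + 0 ∷ + 1 ∷ [])

F₂₋ : RationalFunction
F₂₋ =
  (+ 1 ∷ + 1 ∷ + 1 ∷ + 2 ∷ + 2 ∷ + 2 ∷ + 2 ∷ + 1 ∷ + 0 ∷ + 0 ∷ - + 1 ∷ - + 1 ∷ - + 1 ∷ [])
  ∕
  (+ 1 ∷ - + 1 ∷ - + 1 ∷ + 0 ∷ - + 1 ∷ - + 1 ∷ + 0 ∷ + 0 ∷ + 1 ∷ + 2 ∷ + 1 ∷ + 1 ∷ + 1 ∷ + 1 ∷ - + 1 ∷ [])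

F₂₊ : RationalFunction
F₂₊ =
  (+ 1 ∷ + 0 ∷ + 0 ∷ + 1 ∷ + 0 ∷ + 0 ∷ + 0 ∷ - + 1 ∷ - + 1 ∷ - + 1 ∷ - + 2 ∷ - + 1 ∷ - + 1 ∷ [])
  ∕
  (+ 1 ∷ - + 2 ∷ + 0 ∷ + 1 ∷ - + 1 ∷ + 0 ∷ + 1 ∷ + 0 ∷ + 1 ∷ + 0 ∷ + 0 ∷ + 1 ∷ + 0 ∷ + 1 ∷ - + 1 ∷ [])

------------------------------------------------------------------------
-- Real numbers, as Cauchy sequences of rationals

Cauchy : (ℕ → ℚᵘ) → Set
Cauchy x = ∀ ε → 0ℚᵘ ℚ.< ε →
  Σ[ N ∈ ℕ ] (∀ m n → N ℕ.≤ m → N ℕ.≤ n → ∣ x m ℚ.- x n ∣ ℚ.≤ ε)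

record ℝ : Set where
  constructor mkℝ
  field
    seq    : ℕ → ℚᵘ
    cauchy : Cauchy seq
open ℝ public

ι : ℚᵘ → ℝ
ι q = mkℝ (λ _ → q) λ ε 0<ε → 0 , λ _ _ _ _ →
  ℚ.≤-respˡ-≃ (ℚ.≃-sym (ℚ.∣-∣-cong (ℚ.+-inverseʳ q))) (ℚ.<⇒≤ 0<ε)

half+half : ∀ ε → ½ ℚ.* ε ℚ.+ ½ ℚ.* ε ℚ.≃ ε
half+half ε = ℚ.≃-trans (ℚ.≃-sym (ℚ.*-distribʳ-+ ε ½ ½)) (ℚ.≃-trans (ℚ.*-congʳ {ε} {½ ℚ.+ ½} {1ℚᵘ} (ℚ.*≡* refl)) (ℚ.*-identityˡ ε))

0<half : ∀ {ε} → 0ℚᵘ ℚ.< ε → 0ℚᵘ ℚ.< ½ ℚ.* ε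
0<half {ε} 0<ε = ℚ.<-respˡ-≃ (ℚ.*-zeroʳ ½) (ℚ.*-monoʳ-<-pos ½ 0<ε)

-‿cauchy : ∀ {x} → Cauchy x → Cauchy (λ n → ℚ.- x n)
-‿cauchy {x} cx ε 0<ε with N , p ← cx ε 0<ε = N , λ m n N≤m N≤n →
  ℚ.≤-respˡ-≃ (ℚ.≃-sym (ℚ.∣-∣-cong (eq (x m) (x n)))) (p n m N≤n N≤m)
  where
  eq : ∀ a b → (ℚ.- a) ℚ.- (ℚ.- b) ℚ.≃ b ℚ.- a
  eq = solve 2 (λ a b → (:- a) :- (:- b) := b :- a) ℚ.≃-refl

+-cauchy : ∀ {x y} → Cauchy x → Cauchy y → Cauchy (λ n → x n ℚ.+ y n)
+-cauchy {x} {y} cx cy ε 0<ε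
  with M , p ← cx (½ ℚ.* ε) (0<half 0<ε) | N , q ← cy (½ ℚ.* ε) (0<half 0<ε) =
  M ⊔ N , λ m n h h′ → begin
    ∣ (x m ℚ.+ y m) ℚ.- (x n ℚ.+ y n) ∣      ≃⟨ ℚ.∣-∣-cong (eq (x m) (y m) (x n) (y n)) ⟩
    ∣ (x m ℚ.- x n) ℚ.+ (y m ℚ.- y n) ∣      ≤⟨ ℚ.∣p+q∣≤∣p∣+∣q∣ (x m ℚ.- x n) (y m ℚ.- y n) ⟩
    ∣ x m ℚ.- x n ∣ ℚ.+ ∣ y m ℚ.- y n ∣      ≤⟨ ℚ.+-mono-≤
      (p m n (ℕ.m⊔n≤o⇒m≤o M N h) (ℕ.m⊔n≤o⇒m≤o M N h′))
      (q m n (ℕ.m⊔n≤o⇒n≤o M N h) (ℕ.m⊔n≤o⇒n≤o M N h′)) ⟩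
    ½ ℚ.* ε ℚ.+ ½ ℚ.* ε                      ≃⟨ half+half ε ⟩
    ε                                        ∎
  where
  open ℚ.≤-Reasoning
  eq : ∀ a b c d → (a ℚ.+ b) ℚ.- (c ℚ.+ d) ℚ.≃ (a ℚ.- c) ℚ.+ (b ℚ.- d)
  eq = solve 4 (λ a b c d → (a :+ b) :- (c :+ d) := (a :- c) :+ (b :- d)) ℚ.≃-refl

bounded : ∀ {x} → Cauchy x →
  Σ[ N ∈ ℕ ] Σ[ B ∈ ℚᵘ ] (0ℚᵘ ℚ.< B × (∀ m → N ℕ.≤ m → ∣ x m ∣ ℚ.≤ B))
bounded {x} cx with N , p ← cx 1ℚᵘ (ℚ.positive⁻¹ 1ℚᵘ) =
  N , 1ℚᵘ ℚ.+ ∣ x N ∣ ,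
  ℚ.<-respˡ-≃ (ℚ.+-identityˡ 0ℚᵘ) (ℚ.+-mono-<-≤ (ℚ.positive⁻¹ 1ℚᵘ) (ℚ.0≤∣p∣ (x N))) ,
  λ m N≤m → begin
    ∣ x m ∣                          ≃⟨ ℚ.∣-∣-cong (eq (x m) (x N)) ⟩
    ∣ (x m ℚ.- x N) ℚ.+ x N ∣        ≤⟨ ℚ.∣p+q∣≤∣p∣+∣q∣ (x m ℚ.- x N) (x N) ⟩
    ∣ x m ℚ.- x N ∣ ℚ.+ ∣ x N ∣      ≤⟨ ℚ.+-monoˡ-≤ ∣ x N ∣ (p m N N≤m ℕ.≤-refl) ⟩
    1ℚᵘ ℚ.+ ∣ x N ∣                  ∎
  where
  open ℚ.≤-Reasoning
  eq : ∀ a b → a ℚ.≃ (a ℚ.- b) ℚ.+ b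
  eq = solve 2 (λ a b → a := (a :- b) :+ b) ℚ.≃-refl

*-mono : ∀ {a b c d} → 0ℚᵘ ℚ.≤ a → 0ℚᵘ ℚ.≤ c → a ℚ.≤ b → c ℚ.≤ d → a ℚ.* c ℚ.≤ b ℚ.* d
*-mono 0≤a 0≤c = ℚ.*-mono-≤-nonNeg {{ℚ.nonNegative 0≤a}} {{ℚ.nonNegative 0≤c}}

*-cauchy : ∀ {x y} → Cauchy x → Cauchy y → Cauchy (λ n → x n ℚ.* y n)
*-cauchy {x} {y} cx cy ε 0<ε
  with K , B , 0<B , b ← bounded cx | L , C , 0<C , c ← bounded cy
  = go
  where
  open ℚ.≤-Reasoning
  D = B ℚ.+ C
  instance
    D-pos : ℚ.Positive D
    D-pos = ℚ.positive (ℚ.<-respˡ-≃ (ℚ.+-identityˡ 0ℚᵘ) (ℚ.+-mono-< 0<B 0<C))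
    D≢0 : ℚ.NonZero D
    D≢0 = ℚ.pos⇒nonZero D
    1/D-pos : ℚ.Positive (ℚ.1/ D)
    1/D-pos = ℚ.1/pos⇒pos D
  δ = ε ℚ.* ℚ.1/ D
  0<δ : 0ℚᵘ ℚ.< δ
  0<δ = ℚ.<-respˡ-≃ (ℚ.*-zeroˡ (ℚ.1/ D)) (ℚ.*-monoˡ-<-pos (ℚ.1/ D) 0<ε)
  eq : ∀ a b c d → a ℚ.* b ℚ.- c ℚ.* d ℚ.≃ a ℚ.* (b ℚ.- d) ℚ.+ d ℚ.* (a ℚ.- c)
  eq = solve 4 (λ a b c d → a :* b :- c :* d := a :* (b :- d) :+ d :* (a :- c)) ℚ.≃-refl
  eq′ : ∀ a b e i → a ℚ.* (e ℚ.* i) ℚ.+ b ℚ.* (e ℚ.* i) ℚ.≃ e ℚ.* ((a ℚ.+ b) ℚ.* i)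
  eq′ = solve 4 (λ a b e i → a :* (e :* i) :+ b :* (e :* i) := e :* ((a :+ b) :* i)) ℚ.≃-refl
  go : Σ[ N ∈ ℕ ] (∀ m n → N ℕ.≤ m → N ℕ.≤ n → ∣ x m ℚ.* y m ℚ.- x n ℚ.* y n ∣ ℚ.≤ ε)
  go with M , p ← cx δ 0<δ | N , q ← cy δ 0<δ = (K ⊔ L) ⊔ (M ⊔ N) , λ m n h h′ →
    let K≤m = ℕ.m⊔n≤o⇒m≤o K L (ℕ.m⊔n≤o⇒m≤o (K ⊔ L) (M ⊔ N) h)
        L≤n = ℕ.m⊔n≤o⇒n≤o K L (ℕ.m⊔n≤o⇒m≤o (K ⊔ L) (M ⊔ N) h′)
        M⊔N≤m = ℕ.m⊔n≤o⇒n≤o (K ⊔ L) (M ⊔ N) h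
        M⊔N≤n = ℕ.m⊔n≤o⇒n≤o (K ⊔ L) (M ⊔ N) h′
        ∣Δx∣≤δ = p m n (ℕ.m⊔n≤o⇒m≤o M N M⊔N≤m) (ℕ.m⊔n≤o⇒m≤o M N M⊔N≤n)
        ∣Δy∣≤δ = q m n (ℕ.m⊔n≤o⇒n≤o M N M⊔N≤m) (ℕ.m⊔n≤o⇒n≤o M N M⊔N≤n)
    in begin
    ∣ x m ℚ.* y m ℚ.- x n ℚ.* y n ∣
      ≃⟨ ℚ.∣-∣-cong (eq (x m) (y m) (x n) (y n)) ⟩
    ∣ x m ℚ.* (y m ℚ.- y n) ℚ.+ y n ℚ.* (x m ℚ.- x n) ∣
      ≤⟨ ℚ.∣p+q∣≤∣p∣+∣q∣ (x m ℚ.* (y m ℚ.- y n)) (y n ℚ.* (x m ℚ.- x n)) ⟩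
    ∣ x m ℚ.* (y m ℚ.- y n) ∣ ℚ.+ ∣ y n ℚ.* (x m ℚ.- x n) ∣
      ≃⟨ ℚ.+-cong (ℚ.∣p*q∣≃∣p∣*∣q∣ (x m) (y m ℚ.- y n)) (ℚ.∣p*q∣≃∣p∣*∣q∣ (y n) (x m ℚ.- x n)) ⟩
    ∣ x m ∣ ℚ.* ∣ y m ℚ.- y n ∣ ℚ.+ ∣ y n ∣ ℚ.* ∣ x m ℚ.- x n ∣
      ≤⟨ ℚ.+-mono-≤
           (*-mono (ℚ.0≤∣p∣ (x m)) (ℚ.0≤∣p∣ (y m ℚ.- y n)) (b m K≤m) ∣Δy∣≤δ)
           (*-mono (ℚ.0≤∣p∣ (y n)) (ℚ.0≤∣p∣ (x m ℚ.- x n)) (c n L≤n) ∣Δx∣≤δ) ⟩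
    B ℚ.* δ ℚ.+ C ℚ.* δ         ≃⟨ eq′ B C ε (ℚ.1/ D) ⟩
    ε ℚ.* (D ℚ.* ℚ.1/ D)        ≃⟨ ℚ.*-congˡ {ε} (ℚ.*-inverseʳ D) ⟩
    ε ℚ.* 1ℚᵘ                   ≃⟨ ℚ.*-identityʳ ε ⟩
    ε                           ∎

infixl 6 _+ᵣ_
infixl 7 _*ᵣ_
infix  8 -ᵣ_
infix  4 _≈ᵣ_ _<ᵣ_ _≤ᵣ_

_+ᵣ_ _*ᵣ_ : ℝ → ℝ → ℝ
x +ᵣ y = mkℝ (λ n → seq x n ℚ.+ seq y n) (+-cauchy {seq x} {seq y} (cauchy x) (cauchy y))
x *ᵣ y = mkℝ (λ n → seq x n ℚ.* seq y n) (*-cauchy {seq x} {seq y} (cauchy x) (cauchy y))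

-ᵣ_ : ℝ → ℝ
-ᵣ x = mkℝ (λ n → ℚ.- seq x n) (-‿cauchy {seq x} (cauchy x))

0ᵣ 1ᵣ : ℝ
0ᵣ = ι 0ℚᵘ
1ᵣ = ι 1ℚᵘ

_^ᵣ_ : ℝ → ℕ → ℝ
x ^ᵣ zero  = 1ᵣ
x ^ᵣ suc n = x *ᵣ (x ^ᵣ n)

fromℤ : ℤ → ℝ
fromℤ a = ι (a ℚ./ 1)

Eventually : (ℕ → Set) → Set
Eventually P = ∃[ N ] (∀ n → N ℕ.≤ n → P n)

_≈ᵣ_ _<ᵣ_ _≤ᵣ_ : ℝ → ℝ → Set
x ≈ᵣ y = ∀ ε → 0ℚᵘ ℚ.< ε → Eventually (λ n → ∣ seq x n ℚ.- seq y n ∣ ℚ.≤ ε)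
x <ᵣ y = ∃[ ε ] (0ℚᵘ ℚ.< ε × Eventually (λ n → seq x n ℚ.+ ε ℚ.≤ seq y n))
x ≤ᵣ y = ∀ ε → 0ℚᵘ ℚ.< ε → Eventually (λ n → seq x n ℚ.≤ seq y n ℚ.+ ε)

-- The decimal a · 10 ^ (- d).
decimal : ℕ → ℕ → ℚᵘ
decimal a d = ((+ a) ℚ./ (10 ℕ.^ d)) {{ℕ.m^n≢0 10 d}}

-- x is a · 10 ^ (- d) up to rounding in the last of the d decimal places.
_≐_·10⁻_ : ℝ → ℕ → ℕ → Set
x ≐ a ·10⁻ d =
  (ι (decimal a d ℚ.- decimal 5 (suc d)) ≤ᵣ x) × (x ≤ᵣ ι (decimal a d ℚ.+ decimal 5 (suc d)))

------------------------------------------------------------------------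
-- Complex roots

record ℂ : Set where
  constructor _+i_
  field
    re im : ℝ
open ℂ public

infix 4 _≈_ _<∣∣_

_≈_ : ℂ → ℂ → Set
w ≈ z = (re w ≈ᵣ re z) × (im w ≈ᵣ im z)

fromℝ : ℝ → ℂ
fromℝ x = x +i 0ᵣ

_+ᶜ_ _*ᶜ_ : ℂ → ℂ → ℂ
w +ᶜ z = (re w +ᵣ re z) +i (im w +ᵣ im z)
w *ᶜ z = (re w *ᵣ re z +ᵣ -ᵣ (im w *ᵣ im z)) +i (re w *ᵣ im z +ᵣ im w *ᵣ re z)

∣_∣² : ℂ → ℝ
∣ z ∣² = re z *ᵣ re z +ᵣ im z *ᵣ im z

-- |w| < |z|, by comparing squares.
_<∣∣_ : ℂ → ℂ → Set
w <∣∣ z = ∣ w ∣² <ᵣ ∣ z ∣²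

evaluate : Polynomial → ℂ → ℂ
evaluate []      z = fromℝ 0ᵣ
evaluate (c ∷ P) z = fromℝ (fromℤ c) +ᶜ (z *ᶜ evaluate P z)

IsRoot : Polynomial → ℂ → Set
IsRoot P z = evaluate P z ≈ fromℝ 0ᵣ

IsUniqueMinimalRoot : Polynomial → ℂ → Set
IsUniqueMinimalRoot P z = IsRoot P z × (∀ w → IsRoot P w → ¬ (w ≈ z) → z <∣∣ w)

------------------------------------------------------------------------
-- Growth

_∈Θ_ : (ℕ → ℝ) → (ℕ → ℝ) → Set
g ∈Θ h = ∃[ c ] ∃[ C ] (0ᵣ <ᵣ c × 0ᵣ <ᵣ C × Eventually (λ n → (c *ᵣ h n ≤ᵣ g n) × (g n ≤ᵣ C *ᵣ h n)))

-- The second real number is the inverse of the first.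
HasGrowth : RationalFunction → (root base places : ℕ) → Set
HasGrowth F root base places =
  ∃[ r ] ∃[ 1/r ]
    ( IsUniqueMinimalRoot (den F) (fromℝ r)
    × r ≐ root ·10⁻ 20
    × 1/r *ᵣ r ≈ᵣ 1ᵣ
    × 1/r ≐ base ·10⁻ places
    × (λ n → fromℤ (sequence F n)) ∈Θ (λ n → 1/r ^ᵣ n) )

{-# OPTIONS --safe #-}

-- A letter 1 can be put next to an end (a, b, …) of a k-convex permutation iff b ≤ 2a + k, so the
-- numbers of convex descendants depend on two integers per end only.  For k ≤ 2 the letter 1 of a
-- k-convex permutation is at an end, whence f k (m + 2) is twice the number of descendants of 12 in
-- generation m.
--
-- For a finite digraph let P i / Q be the generating function for the walks from i, so that
-- P = Q + x M P.  If Q(r) = 0 then P(r) is a positive eigenvector of M for the eigenvalue 1 / r, which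
-- gives the growth Θ(r⁻ⁿ).  The root r is found by bisection; it is the only root in a slightly larger
-- disc because some multiple A Q is there a small perturbation of a linear polynomial.
--
-- The lower bound f k > f_{k,-} is strict because a walk can reach the deleted edge.  For the upper
-- bound, a supersolution on the infinite digraph (constant on the identity permutations of large
-- length) shows that f k grows at a strictly smaller rate than f_{k,+}.

module Submission where

open import Defs
import Algebra.Properties.CommutativeMonoid.Sum as CMSum
import Algebra.Properties.Semiring.Sum as SRSum
open import Data.Bool.Base using (if_then_else_; true; false)
open import Data.Fin using (#_)
open import Data.Fin.Base using (Fin; zero; suc; fromℕ)
import Data.Fin.Properties as Fin
open import Data.Integer.Base as ℤ using (ℤ; +_; -_; _<_; 0ℤ; 1ℤ)
import Data.Integer.Properties as ℤ
import Data.Integer.Solver as ℤ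
open import Data.List.Base using (List; []; _∷_; _∷ʳ_; _++_; map; length; filter; foldr; replicate; applyUpTo; take; iterate)
open import Data.List.Membership.Propositional using (_∈_)
open import Data.List.Membership.Propositional.Properties using (∈-++⁺ˡ; ∈-++⁺ʳ; ∈-++⁻; ∈-filter⁺; ∈-filter⁻; ∈-cartesianProductWith⁺; ∈-cartesianProductWith⁻; ∈-applyUpTo⁺; ∈-∃++)
open import Data.List.Membership.Propositional.Properties.WithK using (unique∧set⇒bag)
open import Data.List.Properties using (filter-++; length-++; length-map; length-applyUpTo; map-injective; map-∘; map-id-local; ∷-injective; ∷ʳ-injective) renaming (≡-dec to list-≡-dec)
open import Data.List.Relation.Binary.BagAndSetEquality using (∼bag⇒↭)
open import Data.List.Relation.Binary.Disjoint.Propositional using (Disjoint)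
open import Data.List.Relation.Binary.Permutation.Propositional.Properties using (↭-length)
open import Data.List.Relation.Unary.All as All using (All; []; _∷_)
import Data.List.Relation.Unary.All.Properties as All
open import Data.List.Relation.Unary.AllPairs using ([]; _∷_)
open import Data.List.Relation.Unary.Any using (here; there)
open import Data.List.Relation.Unary.Unique.Propositional using (Unique)
import Data.List.Relation.Unary.Unique.Propositional.Properties as Unique
open import Data.Maybe.Base using (Maybe; just; nothing; maybe)
open import Data.Maybe.Properties using () renaming (≡-dec to maybe-≡-dec)
open import Data.Nat.Base as ℕ using (ℕ; zero; suc; _∸_; _⊔_; pred)
open import Data.Nat.ListAction using (sum)
import Data.Nat.Properties as ℕ
import Data.Nat.Solver as ℕ
open import Data.Product.Base using (Σ-syntax; ∃-syntax; _×_; _,_; proj₁; proj₂; swap)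
open import Data.Product.Properties using () renaming (≡-dec to ×-≡-dec)
open import Data.Rational.Unnormalised.Base as ℚ using (ℚᵘ; 0ℚᵘ; 1ℚᵘ; ½; ∣_∣; mkℚᵘ)
import Data.Rational.Unnormalised.Properties as ℚ
open import Data.Rational.Unnormalised.Solver using (module +-*-Solver)
open import Data.Sum.Base using (_⊎_; inj₁; inj₂; [_,_]′)
import Data.Vec.Base as Vec
open import Function.Base using (_∘_; case_of_)
open import Function.Bundles using (mk⇔)
import Relation.Binary.Reasoning.Setoid as SetoidReasoning
open import Relation.Binary.Construct.Closure.ReflexiveTransitive using (Star; _◅_; _◅◅_) renaming (ε to stop)
open import Relation.Binary.PropositionalEquality using (_≡_; _≢_; refl; sym; trans; cong; cong₂; subst; subst₂; module ≡-Reasoning)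
open import Relation.Nullary using (¬_; Dec; yes; no; contradiction; does)
open import Relation.Nullary.Decidable using (_×-dec_; _⊎-dec_; _→-dec_; ¬?; from-yes; toWitness; True; map′)
open import Data.List.Membership.DecPropositional ℕ._≟_ using (_∈?_)

open Vec using (Vec; []; _∷_)
open CMSum ℕ.+-0-commutativeMonoid using (sum-cong-≗; ∑-distrib-+; ∑-comm)
open SRSum ℕ.+-*-semiring using (*-distribˡ-sum)

-- Convexity of descendants is decided at the two ends

-- Vertex identity quantifies over all generations. It is replaced by finite data in both
-- directions: equal states, up to exchanging the ends, prove it, and one generation with different
-- counts refutes it.
--
-- The reals are Cauchy sequences, and their order is not decidable. Hence no estimate is made at
-- the root `r` itself. For each index `j` there are rationals `lower j` and `upper j` with Q ≥ 0 at
-- the first and Q ≤ 0 at the second. The eigenvector equation becomes a useful inequality at each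
-- of them, and the errors vanish as `j` grows while the length of the walks is fixed. All numerical
-- hypotheses thus become decidable statements about explicit rationals.
--
-- The loop of `withLoopAtLast` is at the last vertex and not where the edge was deleted, so walks
-- of the infinite digraph are not mapped into walks of the looped one. The upper bound compares
-- growth rates instead: it uses a rational x above the root of the denominator of `F₁₊` or `F₂₊`
-- for which xᵐ times the number of descendants in generation m stays bounded.

front back : List ℕ → ℕ × ℕ
front (a ∷ b ∷ _) = a , b
front _           = 0 , 0
back (a ∷ b ∷ c ∷ π) = back (b ∷ c ∷ π)
back (a ∷ b ∷ [])    = b , a
back _               = 0 , 0

-- An end a, b, … of a permutation is recorded as (b ∸ (2a + k), a): the first component is the
-- number of descents at the other end before a new letter 1 can be put next to a.
End State : Set
End   = ℕ × ℕ
State = End × End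

end : ℕ → ℕ × ℕ → End
end k (a , b) = b ∸ (2 ℕ.* a ℕ.+ k) , a

state : ℕ → List ℕ → State
state k π = end k (front π) , end k (back π)

-- A new 1 beside a gives the end 1, a + 1, and (a + 1) ∸ (2 + k) is a ∸ (k + 1). At the opposite
-- end every letter grows by one, which raises b by 1 and 2a by 2, so the obstruction drops by one.
extend recede : ℕ → End → End
extend k (_ , a) = a ∸ suc k , 1
recede k (s , a) = s ∸ 1 , suc a

ifZero : ℕ → ℕ → ℕ
ifZero zero    n = n
ifZero (suc _) n = 0

count : ℕ → ℕ → State → ℕ
count k zero    (p , q) = 1
count k (suc g) (p , q) =
  ifZero (proj₁ p) (count k g (extend k p , recede k q)) ℕ.+
  ifZero (proj₁ q) (count k g (recede k p , extend k q))

count-swap : ∀ k g S → count k g (swap S) ≡ count k g S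
count-swap k zero    S       = refl
count-swap k (suc g) (p , q) = trans
  (ℕ.+-comm (ifZero (proj₁ q) _) (ifZero (proj₁ p) _))
  (cong₂ ℕ._+_ (cong (ifZero (proj₁ p)) (count-swap k g (extend k p , recede k q)))
               (cong (ifZero (proj₁ q)) (count-swap k g (recede k p , extend k q))))

recede-end : ∀ k a b → end k (suc a , suc b) ≡ recede k (end k (a , b))
recede-end k a b = cong (_, suc a) (begin
  suc b ∸ (2 ℕ.* suc a ℕ.+ k)          ≡⟨ cong (suc b ∸_) (eq a k) ⟩
  b ∸ (2 ℕ.* a ℕ.+ k ℕ.+ 1)            ≡⟨ ℕ.∸-+-assoc b (2 ℕ.* a ℕ.+ k) 1 ⟨
  b ∸ (2 ℕ.* a ℕ.+ k) ∸ 1              ∎)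
  where
  open ≡-Reasoning
  open ℕ.+-*-Solver
  eq : ∀ a k → 2 ℕ.* suc a ℕ.+ k ≡ suc (2 ℕ.* a ℕ.+ k ℕ.+ 1)
  eq = solve 2 (λ a k → con 2 :* (con 1 :+ a) :+ k := con 1 :+ (con 2 :* a :+ k :+ con 1)) refl

back-map-suc : ∀ k a b π → end k (back (map suc (a ∷ b ∷ π))) ≡ recede k (end k (back (a ∷ b ∷ π)))
back-map-suc k a b []      = recede-end k b a
back-map-suc k a b (c ∷ π) = back-map-suc k b c π

back-∷ʳ : ∀ a b π x → back ((a ∷ b ∷ π) ∷ʳ x) ≡ (x , proj₁ (back (a ∷ b ∷ π)))
back-∷ʳ a b []      x = refl
back-∷ʳ a b (c ∷ π) x = back-∷ʳ b c π x

back-map-suc₁ : ∀ a b π → proj₁ (back (map suc (a ∷ b ∷ π))) ≡ suc (proj₁ (back (a ∷ b ∷ π)))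
back-map-suc₁ a b []      = refl
back-map-suc₁ a b (c ∷ π) = back-map-suc₁ b c π

state-left : ∀ k a b π → let p , q = state k (a ∷ b ∷ π) in
  state k (descendant left (a ∷ b ∷ π)) ≡ (extend k p , recede k q)
state-left k a b π = cong ((a ∸ suc k , 1) ,_) (back-map-suc k a b π)

state-right : ∀ k a b π → let p , q = state k (a ∷ b ∷ π) in
  state k (descendant right (a ∷ b ∷ π)) ≡ (recede k p , extend k q)
state-right k a b π = cong₂ _,_ (recede-end k a b)
  (cong (end k) (trans (back-∷ʳ (suc a) (suc b) (map suc π) 1) (cong (1 ,_) (back-map-suc₁ a b π))))

kConvex-suc : ∀ a b c →
  + suc a ℤ.+ + suc c ℤ.- + 2 ℤ.* + suc b ≡ + a ℤ.+ + c ℤ.- + 2 ℤ.* + b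
kConvex-suc a b c = eq (+ a) (+ b) (+ c)
  where
  open ℤ.+-*-Solver
  eq : ∀ a b c → (+ 1 ℤ.+ a) ℤ.+ (+ 1 ℤ.+ c) ℤ.- + 2 ℤ.* (+ 1 ℤ.+ b) ≡ a ℤ.+ c ℤ.- + 2 ℤ.* b
  eq = solve 3 (λ a b c → (con (+ 1) :+ a) :+ (con (+ 1) :+ c) :- con (+ 2) :* (con (+ 1) :+ b)
                          := a :+ c :- con (+ 2) :* b) refl

kConvex-map-suc⁺ : ∀ {k} π → KConvex k π → KConvex k (map suc π)
kConvex-map-suc⁺ []              _       = _
kConvex-map-suc⁺ (a ∷ [])        _       = _
kConvex-map-suc⁺ (a ∷ b ∷ [])    _       = _
kConvex-map-suc⁺ (a ∷ b ∷ c ∷ π) (h , r) =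
  subst (ℤ._≤ _) (sym (kConvex-suc a b c)) h , kConvex-map-suc⁺ (b ∷ c ∷ π) r

kConvex-map-suc⁻ : ∀ {k} π → KConvex k (map suc π) → KConvex k π
kConvex-map-suc⁻ []              _       = _
kConvex-map-suc⁻ (a ∷ [])        _       = _
kConvex-map-suc⁻ (a ∷ b ∷ [])    _       = _
kConvex-map-suc⁻ (a ∷ b ∷ c ∷ π) (h , r) =
  subst (ℤ._≤ _) (kConvex-suc a b c) h , kConvex-map-suc⁻ (b ∷ c ∷ π) r

kConvex-tail : ∀ {k} a π → KConvex k (a ∷ π) → KConvex k π
kConvex-tail a []          _ = _
kConvex-tail a (b ∷ [])    _ = _
kConvex-tail a (b ∷ c ∷ π) h = proj₂ h

kConvex-init : ∀ {k} π x → KConvex k (π ∷ʳ x) → KConvex k π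
kConvex-init []              x _       = _
kConvex-init (a ∷ [])        x _       = _
kConvex-init (a ∷ b ∷ [])    x _       = _
kConvex-init (a ∷ b ∷ c ∷ π) x (h , r) = h , kConvex-init (b ∷ c ∷ π) x r

-- The letters are those after the shift by one: 1 + (b + 1) - 2(a + 1) equals b - 2a, so convexity
-- of the new triple is b ≤ 2a + k.
slack⁺ : ∀ k a b → + 1 ℤ.+ + suc b ℤ.- + 2 ℤ.* + suc a ℤ.≤ + k → b ∸ (2 ℕ.* a ℕ.+ k) ≡ 0
slack⁺ k a b h = ℕ.m≤n⇒m∸n≡0 (ℤ.drop‿+≤+ (begin
  + b                                                       ≡⟨ eq (+ a) (+ b) ⟩
  (+ 1 ℤ.+ + suc b ℤ.- + 2 ℤ.* + suc a) ℤ.+ + 2 ℤ.* + a     ≤⟨ ℤ.+-monoˡ-≤ (+ 2 ℤ.* + a) h ⟩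
  + k ℤ.+ + 2 ℤ.* + a                                       ≡⟨ ℤ.+-comm (+ k) (+ 2 ℤ.* + a) ⟩
  + 2 ℤ.* + a ℤ.+ + k                                       ≡⟨ cong (ℤ._+ + k) (ℤ.pos-* 2 a) ⟨
  + (2 ℕ.* a ℕ.+ k)                                         ∎))
  where
  open ℤ.≤-Reasoning
  open ℤ.+-*-Solver
  eq : ∀ a b → b ≡ (+ 1 ℤ.+ (+ 1 ℤ.+ b) ℤ.- + 2 ℤ.* (+ 1 ℤ.+ a)) ℤ.+ + 2 ℤ.* a
  eq = solve 2 (λ a b → b := (con (+ 1) :+ (con (+ 1) :+ b) :- con (+ 2) :* (con (+ 1) :+ a))
                             :+ con (+ 2) :* a) refl

slack⁻ : ∀ k a b → b ∸ (2 ℕ.* a ℕ.+ k) ≡ 0 → + 1 ℤ.+ + suc b ℤ.- + 2 ℤ.* + suc a ℤ.≤ + k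
slack⁻ k a b h = begin
  + 1 ℤ.+ + suc b ℤ.- + 2 ℤ.* + suc a       ≡⟨ eq (+ a) (+ b) ⟩
  + b ℤ.- + 2 ℤ.* + a                       ≤⟨ ℤ.+-monoˡ-≤ (- (+ 2 ℤ.* + a)) (ℤ.+≤+ (ℕ.m∸n≡0⇒m≤n h)) ⟩
  + (2 ℕ.* a ℕ.+ k) ℤ.- + 2 ℤ.* + a         ≡⟨ cong (λ x → x ℤ.+ + k ℤ.- + 2 ℤ.* + a) (ℤ.pos-* 2 a) ⟩
  + 2 ℤ.* + a ℤ.+ + k ℤ.- + 2 ℤ.* + a       ≡⟨ eq′ (+ a) (+ k) ⟩
  + k                                       ∎
  where
  open ℤ.≤-Reasoning
  open ℤ.+-*-Solver
  eq : ∀ a b → + 1 ℤ.+ (+ 1 ℤ.+ b) ℤ.- + 2 ℤ.* (+ 1 ℤ.+ a) ≡ b ℤ.- + 2 ℤ.* a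
  eq = solve 2 (λ a b → con (+ 1) :+ (con (+ 1) :+ b) :- con (+ 2) :* (con (+ 1) :+ a)
                        := b :- con (+ 2) :* a) refl
  eq′ : ∀ a k → + 2 ℤ.* a ℤ.+ k ℤ.- + 2 ℤ.* a ≡ k
  eq′ = solve 2 (λ a k → con (+ 2) :* a :+ k :- con (+ 2) :* a := k) refl

kConvex-∷ʳ⁺ : ∀ {k} a b π x → KConvex k (a ∷ b ∷ π) → let d , c = back (a ∷ b ∷ π) in
  + c ℤ.+ + x ℤ.- + 2 ℤ.* + d ℤ.≤ + k → KConvex k ((a ∷ b ∷ π) ∷ʳ x)
kConvex-∷ʳ⁺ a b []      x _       h′ = h′ , _
kConvex-∷ʳ⁺ a b (c ∷ π) x (h , r) h′ = h , kConvex-∷ʳ⁺ b c π x r h′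

kConvex-∷ʳ⁻ : ∀ {k} a b π x → KConvex k ((a ∷ b ∷ π) ∷ʳ x) → let d , c = back (a ∷ b ∷ π) in
  + c ℤ.+ + x ℤ.- + 2 ℤ.* + d ℤ.≤ + k
kConvex-∷ʳ⁻ a b []      x (h , _) = h
kConvex-∷ʳ⁻ a b (c ∷ π) x (_ , r) = kConvex-∷ʳ⁻ b c π x r

back-map-suc₂ : ∀ a b π → let d , c = back (a ∷ b ∷ π) in back (map suc (a ∷ b ∷ π)) ≡ (suc d , suc c)
back-map-suc₂ a b []      = refl
back-map-suc₂ a b (c ∷ π) = back-map-suc₂ b c π

slackOf : Side → State → ℕ
slackOf left  = proj₁ ∘ proj₁
slackOf right = proj₁ ∘ proj₂

descendant-convex⁺ : ∀ k s a b π → let σ = a ∷ b ∷ π in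
  KConvex k σ → slackOf s (state k σ) ≡ 0 → KConvex k (descendant s σ)
descendant-convex⁺ k left  a b π h e = slack⁻ k a b e , kConvex-map-suc⁺ (a ∷ b ∷ π) h
descendant-convex⁺ k right a b π h e =
  kConvex-∷ʳ⁺ (suc a) (suc b) (map suc π) 1 (kConvex-map-suc⁺ (a ∷ b ∷ π) h)
    (subst (λ (d , c) → + c ℤ.+ + 1 ℤ.- + 2 ℤ.* + d ℤ.≤ + k) (sym (back-map-suc₂ a b π))
      (subst (λ z → z ℤ.- + 2 ℤ.* + suc d ℤ.≤ + k) (ℤ.+-comm (+ 1) (+ suc c)) (slack⁻ k d c e)))
  where
  d = proj₁ (back (a ∷ b ∷ π))
  c = proj₂ (back (a ∷ b ∷ π))

descendant-slack : ∀ k s a b π → let σ = a ∷ b ∷ π in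
  KConvex k (descendant s σ) → slackOf s (state k σ) ≡ 0
descendant-slack k left  a b π (h , _) = slack⁺ k a b h
descendant-slack k right a b π h = slack⁺ k d c
  (subst (λ z → z ℤ.- + 2 ℤ.* + suc d ℤ.≤ + k) (ℤ.+-comm (+ suc c) (+ 1))
    (subst (λ (d , c) → + c ℤ.+ + 1 ℤ.- + 2 ℤ.* + d ℤ.≤ + k) (back-map-suc₂ a b π)
      (kConvex-∷ʳ⁻ (suc a) (suc b) (map suc π) 1 h)))
  where
  d = proj₁ (back (a ∷ b ∷ π))
  c = proj₂ (back (a ∷ b ∷ π))

descendant-convex⁻ : ∀ k s π → KConvex k (descendant s π) → KConvex k π
descendant-convex⁻ k left  π h = kConvex-map-suc⁻ π (kConvex-tail 1 (map suc π) h)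
descendant-convex⁻ k right π h = kConvex-map-suc⁻ π (kConvex-init (map suc π) 1 h)

convexDescendants-suc : ∀ k g π → convexDescendants k (suc g) π ≡
  convexDescendants k g (descendant left π) ℕ.+ convexDescendants k g (descendant right π)
convexDescendants-suc k g π = trans
  (cong length (filter-++ (kConvex? k) (generation g (descendant left π)) _))
  (length-++ (filter (kConvex? k) (generation g (descendant left π))))

convexDescendants-¬convex : ∀ k g π → ¬ KConvex k π → convexDescendants k g π ≡ 0
convexDescendants-¬convex k zero π ¬c with kConvex? k π
... | yes c = contradiction c ¬c
... | no  _ = refl
convexDescendants-¬convex k (suc g) π ¬c = trans (convexDescendants-suc k g π)
  (cong₂ ℕ._+_ (none left) (none right))
  where
  none : ∀ s → convexDescendants k g (descendant s π) ≡ 0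
  none s = convexDescendants-¬convex k g _ (¬c ∘ descendant-convex⁻ k s π)

≥2letters : List ℕ → Set
≥2letters π = 2 ℕ.≤ length π

descendant-≥2 : ∀ s a b π → ≥2letters (descendant s (a ∷ b ∷ π))
descendant-≥2 left  a b π = ℕ.s≤s (ℕ.s≤s ℕ.z≤n)
descendant-≥2 right a b π = ℕ.s≤s (ℕ.s≤s ℕ.z≤n)

-- A positive slack makes the child nonconvex, and nonconvexity passes to all later descendants. So
-- the branch that `count` drops contains no convex permutation.
convexDescendants≡count : ∀ k g π → ≥2letters π → KConvex k π →
  convexDescendants k g π ≡ count k g (state k π)
convexDescendants≡count k zero π _ c with kConvex? k π
... | yes _ = refl
... | no ¬c = contradiction c ¬c
convexDescendants≡count k (suc g) (a ∷ b ∷ π) _ c =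
  trans (convexDescendants-suc k g σ) (cong₂ ℕ._+_ (term left (state-left k a b π)) (term right (state-right k a b π)))
  where
  σ = a ∷ b ∷ π
  term : ∀ s {S} → state k (descendant s σ) ≡ S →
    convexDescendants k g (descendant s σ) ≡ ifZero (slackOf s (state k σ)) (count k g S)
  term s eq with slackOf s (state k σ) in e
  ... | zero  = trans (convexDescendants≡count k g _ (descendant-≥2 s a b π) (descendant-convex⁺ k s a b π c e))
                      (cong (count k g) eq)
  ... | suc _ = convexDescendants-¬convex k g _ λ c′ → ℕ.0≢1+n (trans (sym (descendant-slack k s a b π c′)) e)
convexDescendants≡count k (suc g) (a ∷ []) (ℕ.s≤s ()) c

-- Verification of a truncated digraph from a finite table

_≟ₛ_ : (S S′ : State) → Dec (S ≡ S′)
_≟ₛ_ = ×-≡-dec (×-≡-dec ℕ._≟_ ℕ._≟_) (×-≡-dec ℕ._≟_ ℕ._≟_)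

sameState⇒sameVertex : ∀ {k} π σ → ≥2letters π → ≥2letters σ → KConvex k π → KConvex k σ →
  state k π ≡ state k σ ⊎ state k π ≡ swap (state k σ) → SameVertex k π σ
sameState⇒sameVertex {k} π σ lπ lσ cπ cσ eq g = begin
  convexDescendants k g π  ≡⟨ convexDescendants≡count k g π lπ cπ ⟩
  count k g (state k π)    ≡⟨ same eq ⟩
  count k g (state k σ)    ≡⟨ convexDescendants≡count k g σ lσ cσ ⟨
  convexDescendants k g σ  ∎
  where
  open ≡-Reasoning
  same : state k π ≡ state k σ ⊎ state k π ≡ swap (state k σ) →
    count k g (state k π) ≡ count k g (state k σ)
  same (inj₁ e) = cong (count k g) e
  same (inj₂ e) = trans (cong (count k g) e) (count-swap k g (state k σ))

-- `SameVertex` is not decidable as it stands. In a table it is asserted only through equal or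
-- swapped states, and refuted only through the counts in generation `G`. An edge that is kept must
-- differ from the deleted one, for which a different signature at its source or at its target
-- suffices.
module FromTable (k : ℕ) (υ ω : List ℕ) {n : ℕ}
  (paths : Vec (List Side) (suc n)) (edges : Vec (Maybe (Fin (suc n)) × Maybe (Fin (suc n))) (suc n))
  (G : ℕ) where

  vertexRep : Fin (suc n) → List ℕ
  vertexRep i = foldr descendant (1 ∷ 2 ∷ []) (Vec.lookup paths i)

  vertexEdge : Fin (suc n) → Side → Maybe (Fin (suc n))
  vertexEdge i left  = proj₁ (Vec.lookup edges i)
  vertexEdge i right = proj₂ (Vec.lookup edges i)

  signature : List ℕ → ℕ
  signature π = count k G (state k π)

  EdgeOK : List ℕ → List ℕ → Maybe (Fin (suc n)) → Set
  EdgeOK π σ (just j) =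
    KConvex k σ × ≥2letters σ ×
    (state k σ ≡ state k (vertexRep j) ⊎ state k σ ≡ swap (state k (vertexRep j))) ×
    (¬ signature π ≡ signature υ ⊎ ¬ signature σ ≡ signature ω)
  EdgeOK π σ nothing =
    ¬ KConvex k σ ⊎ (KConvex k σ × ≥2letters σ × state k π ≡ state k υ × state k σ ≡ state k ω)

  edgeOK? : ∀ π σ e → Dec (EdgeOK π σ e)
  edgeOK? π σ (just j) =
    kConvex? k σ ×-dec (2 ℕ.≤? _) ×-dec
    ((state k σ ≟ₛ state k (vertexRep j)) ⊎-dec (state k σ ≟ₛ swap (state k (vertexRep j)))) ×-dec
    (¬? (signature π ℕ.≟ signature υ) ⊎-dec ¬? (signature σ ℕ.≟ signature ω))
  edgeOK? π σ nothing =
    ¬? (kConvex? k σ) ⊎-dec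
    (kConvex? k σ ×-dec (2 ℕ.≤? _) ×-dec (state k π ≟ₛ state k υ) ×-dec (state k σ ≟ₛ state k ω))

  follow : List Side → Maybe (Fin (suc n))
  follow []      = just zero
  follow (s ∷ p) = maybe (λ i → vertexEdge i s) nothing (follow p)

  follow-reaches : ∀ p {i} → follow p ≡ just i → Star (λ a b → ∃[ s ] vertexEdge a s ≡ just b) zero i
  follow-reaches []      refl = stop
  follow-reaches (s ∷ p) eq with follow p in e
  ... | just i = follow-reaches p e ◅◅ ((s , eq) ◅ stop)

  VertexOK : Fin (suc n) → Set
  VertexOK i =
    ≥2letters (vertexRep i) × IsPermutation (vertexRep i) × KConvex k (vertexRep i) ×
    (follow (Vec.lookup paths i) ≡ just i) ×
    EdgeOK (vertexRep i) (descendant left (vertexRep i)) (vertexEdge i left) ×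
    EdgeOK (vertexRep i) (descendant right (vertexRep i)) (vertexEdge i right)

  vertexOK? : ∀ i → Dec (VertexOK i)
  vertexOK? i =
    (2 ℕ.≤? _) ×-dec isPermutation? (vertexRep i) ×-dec kConvex? k (vertexRep i) ×-dec
    (maybe-≡-dec Fin._≟_ (follow (Vec.lookup paths i)) (just i)) ×-dec
    edgeOK? _ _ (vertexEdge i left) ×-dec edgeOK? _ _ (vertexEdge i right)

  Separated : Set
  Separated = ∀ i j → signature (vertexRep i) ≡ signature (vertexRep j) → i ≡ j

  separated? : Dec Separated
  separated? = Fin.all? λ i → Fin.all? λ j →
    (signature (vertexRep i) ℕ.≟ signature (vertexRep j)) →-dec (i Fin.≟ j)

  module _ (start : vertexRep zero ≡ 1 ∷ 2 ∷ []) (ok : ∀ i → VertexOK i) (separated : Separated)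
    (lυ : ≥2letters υ) (cυ : KConvex k υ) (lω : ≥2letters ω) (cω : KConvex k ω) where

    private
      len : ∀ i → ≥2letters (vertexRep i)
      len i = proj₁ (ok i)
      convex : ∀ i → KConvex k (vertexRep i)
      convex i = proj₁ (proj₂ (proj₂ (ok i)))
      edgeOK : ∀ i s → EdgeOK (vertexRep i) (descendant s (vertexRep i)) (vertexEdge i s)
      edgeOK i left  = proj₁ (proj₂ (proj₂ (proj₂ (proj₂ (ok i)))))
      edgeOK i right = proj₂ (proj₂ (proj₂ (proj₂ (proj₂ (ok i)))))
      sameSignature : ∀ π σ → ≥2letters π → ≥2letters σ → KConvex k π → KConvex k σ →
        SameVertex k π σ → signature π ≡ signature σ
      sameSignature π σ lπ lσ cπ cσ same = begin
        signature π              ≡⟨ convexDescendants≡count k G π lπ cπ ⟨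
        convexDescendants k G π  ≡⟨ same G ⟩
        convexDescendants k G σ  ≡⟨ convexDescendants≡count k G σ lσ cσ ⟩
        signature σ              ∎
        where open ≡-Reasoning

    truncation : Truncation k υ ω
    truncation = record
      { last            = n
      ; rep             = vertexRep
      ; edge            = vertexEdge
      ; rep-start       = start
      ; rep-permutation = λ i → proj₁ (proj₂ (ok i))
      ; rep-convex      = convex
      ; rep-distinct    = λ i j same → separated i j
          (sameSignature _ _ (len i) (len j) (convex i) (convex j) same)
      ; edge-present    = present
      ; edge-absent     = absent
      ; reachable       = λ i → follow-reaches (Vec.lookup paths i) (proj₁ (proj₂ (proj₂ (proj₂ (ok i)))))
      }
      where
      present : ∀ i s j → vertexEdge i s ≡ just j → let σ = descendant s (vertexRep i) in
        KConvex k σ × SameVertex k σ (vertexRep j) × ¬ (SameVertex k (vertexRep i) υ × SameVertex k σ ω)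
      present i s j eq with vertexEdge i s | edgeOK i s
      present i s j refl | just .j | cσ , lσ , states , sigs =
        cσ , sameState⇒sameVertex _ _ lσ (len j) cσ (convex j) states , kept sigs
        where
        σ = descendant s (vertexRep i)
        kept : ¬ signature (vertexRep i) ≡ signature υ ⊎ ¬ signature σ ≡ signature ω →
          ¬ (SameVertex k (vertexRep i) υ × SameVertex k σ ω)
        kept (inj₁ ≢) (same , _) = ≢ (sameSignature _ _ (len i) lυ (convex i) cυ same)
        kept (inj₂ ≢) (_ , same) = ≢ (sameSignature _ _ lσ lω cσ cω same)
      absent : ∀ i s → vertexEdge i s ≡ nothing → let σ = descendant s (vertexRep i) in
        ¬ KConvex k σ ⊎ (SameVertex k (vertexRep i) υ × SameVertex k σ ω)
      absent i s eq with vertexEdge i s | edgeOK i s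
      absent i s refl | nothing | inj₁ ¬cσ = inj₁ ¬cσ
      absent i s refl | nothing | inj₂ (cσ , lσ , eυ , eω) = inj₂
        ( sameState⇒sameVertex _ _ (len i) lυ (convex i) cυ (inj₁ eυ)
        , sameState⇒sameVertex _ _ lσ lω cσ cω (inj₁ eω))

-- Paths are read from right to left.
straight : ℕ → List Side
straight a = replicate a left

turn : ℕ → ℕ → List Side
turn a b = replicate b left ++ right ∷ replicate a left

to : ∀ m {n} {m<n : True (m ℕ.<? n)} → Maybe (Fin n)
to m {n} {m<n} = just (#_ m {n} {m<n})

paths₁ : Vec (List Side) 21
paths₁ =
  [] ∷ straight 1 ∷ straight 2 ∷ turn 1 0 ∷ straight 3 ∷
  turn 2 0 ∷ straight 4 ∷ turn 3 0 ∷ turn 2 1 ∷ straight 5 ∷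
  turn 4 0 ∷ turn 3 1 ∷ turn 5 0 ∷ turn 4 1 ∷ turn 3 2 ∷
  turn 5 1 ∷ turn 4 2 ∷ turn 5 2 ∷ turn 4 3 ∷ turn 5 3 ∷
  turn 5 4 ∷ []

edges₁ : Vec (Maybe (Fin 21) × Maybe (Fin 21)) 21
edges₁ =
  (to 1 , to 0) ∷ (to 2 , to 3) ∷ (to 4 , to 5) ∷ (to 0 , nothing) ∷
  (to 6 , to 7) ∷ (to 8 , nothing) ∷ (to 9 , to 10) ∷ (to 11 , nothing) ∷
  (to 1 , nothing) ∷ (nothing , to 12) ∷ (to 13 , nothing) ∷ (to 14 , nothing) ∷
  (to 15 , nothing) ∷ (to 16 , nothing) ∷ (to 2 , nothing) ∷ (to 17 , nothing) ∷
  (to 18 , nothing) ∷ (to 19 , nothing) ∷ (to 4 , nothing) ∷ (to 20 , nothing) ∷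
  (to 6 , nothing) ∷ []

paths₂ : Vec (List Side) 22
paths₂ =
  [] ∷ straight 1 ∷ straight 2 ∷ straight 3 ∷ turn 2 0 ∷
  straight 4 ∷ turn 3 0 ∷ straight 5 ∷ turn 4 0 ∷ turn 3 1 ∷
  straight 6 ∷ turn 5 0 ∷ turn 4 1 ∷ turn 6 0 ∷ turn 5 1 ∷
  turn 4 2 ∷ turn 6 1 ∷ turn 5 2 ∷ turn 6 2 ∷ turn 5 3 ∷
  turn 6 3 ∷ turn 6 4 ∷ []

edges₂ : Vec (Maybe (Fin 22) × Maybe (Fin 22)) 22
edges₂ =
  (to 1 , to 0) ∷ (to 2 , to 0) ∷ (to 3 , to 4) ∷ (to 5 , to 6) ∷
  (to 0 , nothing) ∷ (to 7 , to 8) ∷ (to 9 , nothing) ∷ (to 10 , to 11) ∷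
  (to 12 , nothing) ∷ (to 1 , nothing) ∷ (nothing , to 13) ∷ (to 14 , nothing) ∷
  (to 15 , nothing) ∷ (to 16 , nothing) ∷ (to 17 , nothing) ∷ (to 2 , nothing) ∷
  (to 18 , nothing) ∷ (to 19 , nothing) ∷ (to 20 , nothing) ∷ (to 3 , nothing) ∷
  (to 21 , nothing) ∷ (to 5 , nothing) ∷ []

-- 14 and 10 are the first generations in which the vertices have pairwise distinct counts.
module Table₁ = FromTable 1 (identity 7) (identity 8) paths₁ edges₁ 14
module Table₂ = FromTable 2 (identity 8) (identity 9) paths₂ edges₂ 10

T₁ : Truncation 1 (identity 7) (identity 8)
T₁ = Table₁.truncation refl (from-yes (Fin.all? Table₁.vertexOK?)) (from-yes Table₁.separated?)
  (from-yes (2 ℕ.≤? 7)) (from-yes (kConvex? 1 (identity 7)))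
  (from-yes (2 ℕ.≤? 8)) (from-yes (kConvex? 1 (identity 8)))

T₂ : Truncation 2 (identity 8) (identity 9)
T₂ = Table₂.truncation refl (from-yes (Fin.all? Table₂.vertexOK?)) (from-yes Table₂.separated?)
  (from-yes (2 ℕ.≤? 8)) (from-yes (kConvex? 2 (identity 8)))
  (from-yes (2 ℕ.≤? 9)) (from-yes (kConvex? 2 (identity 9)))

-- Walks in a finite digraph given by lists of successors

Digraph : ℕ → Set
Digraph n = Fin n → List (Fin n)

walkCount : ∀ {n} → Digraph n → ℕ → Fin n → ℕ
walkCount E zero    i = 1
walkCount E (suc m) i = sum (map (walkCount E m) (E i))

𝟙-sym : ∀ {n} (i j : Fin n) → 𝟙 i j ≡ 𝟙 j i
𝟙-sym zero    zero    = refl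
𝟙-sym zero    (suc j) = refl
𝟙-sym (suc i) zero    = refl
𝟙-sym (suc i) (suc j) = 𝟙-sym i j

∑-zero : ∀ n → ∑ {n} (λ _ → 0) ≡ 0
∑-zero zero    = refl
∑-zero (suc n) = ∑-zero n

∑-𝟙 : ∀ {n} (i : Fin n) (w : Fin n → ℕ) → ∑ (λ j → 𝟙 i j ℕ.* w j) ≡ w i
∑-𝟙 {suc n} zero w = trans (cong₂ ℕ._+_ (ℕ.+-identityʳ (w zero)) (∑-zero n)) (ℕ.+-identityʳ (w zero))
∑-𝟙 (suc i) w = ∑-𝟙 i (w ∘ suc)

∑-𝟙₁ : ∀ {n} (i : Fin n) → ∑ (𝟙 i) ≡ 1
∑-𝟙₁ i = trans (sum-cong-≗ (λ j → sym (ℕ.*-identityʳ (𝟙 i j)))) (∑-𝟙 i (λ _ → 1))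

_Represents_ : ∀ {n} → Matrix n → Digraph n → Set
M Represents E = ∀ i (w : _ → ℕ) → ∑ (λ j → M i j ℕ.* w j) ≡ sum (map w (E i))

-- Exchanging the two summations turns the row sums of `power M (suc m)` into `M` applied to the row
-- sums of `power M m`.
∑power≡walkCount : ∀ {n} (M : Matrix n) (E : Digraph n) → M Represents E →
  ∀ m i → ∑ (power M m i) ≡ walkCount E m i
∑power≡walkCount M E rep zero    i = ∑-𝟙₁ i
∑power≡walkCount M E rep (suc m) i = begin
  ∑ (λ j → ∑ (λ l → M i l ℕ.* power M m l j))  ≡⟨ ∑-comm (λ j l → M i l ℕ.* power M m l j) ⟩
  ∑ (λ l → ∑ (λ j → M i l ℕ.* power M m l j))  ≡⟨ sum-cong-≗ (λ l → sym (*-distribˡ-sum (M i l) (power M m l))) ⟩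
  ∑ (λ l → M i l ℕ.* ∑ (power M m l))          ≡⟨ sum-cong-≗ (λ l → cong (M i l ℕ.*_) (∑power≡walkCount M E rep m l)) ⟩
  ∑ (λ l → M i l ℕ.* walkCount E m l)          ≡⟨ rep i (walkCount E m) ⟩
  sum (map (walkCount E m) (E i))              ∎
  where open ≡-Reasoning

singleton? : ∀ {A : Set} → Maybe A → List A
singleton? = maybe (_∷ []) []

module _ {k υ ω} (T : Truncation k υ ω) where
  open Truncation T

  successors : Digraph (suc last)
  successors i = singleton? (edge i left) ++ singleton? (edge i right)

  successors⁺ : Digraph (suc last)
  successors⁺ i = (if does (i Fin.≟ fromℕ last) then fromℕ last ∷ [] else []) ++ successors i

  adjacency-represents : adjacency T Represents successors
  adjacency-represents i w with edge i left | edge i right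
  ... | just a  | just b  = trans
    (trans (sum-cong-≗ (λ j → ℕ.*-distribʳ-+ (w j) (𝟙 a j) (𝟙 b j)))
           (∑-distrib-+ (λ j → 𝟙 a j ℕ.* w j) (λ j → 𝟙 b j ℕ.* w j)))
    (cong₂ ℕ._+_ (∑-𝟙 a w) (trans (∑-𝟙 b w) (sym (ℕ.+-identityʳ (w b)))))
  ... | just a  | nothing = trans
    (trans (sum-cong-≗ (λ j → cong (ℕ._* w j) (ℕ.+-identityʳ (𝟙 a j)))) (∑-𝟙 a w))
    (sym (ℕ.+-identityʳ (w a)))
  ... | nothing | just b  = trans (∑-𝟙 b w) (sym (ℕ.+-identityʳ (w b)))
  ... | nothing | nothing = ∑-zero (suc last)

  withLoop-represents : withLoopAtLast (adjacency T) Represents successors⁺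
  withLoop-represents i w = begin
    ∑ (λ j → (adjacency T i j ℕ.+ 𝟙 i z ℕ.* 𝟙 j z) ℕ.* w j)
      ≡⟨ sum-cong-≗ (λ j → trans (ℕ.*-distribʳ-+ (w j) (adjacency T i j) (𝟙 i z ℕ.* 𝟙 j z))
           (cong (adjacency T i j ℕ.* w j ℕ.+_)
             (trans (ℕ.*-assoc (𝟙 i z) (𝟙 j z) (w j)) (cong (λ x → 𝟙 i z ℕ.* (x ℕ.* w j)) (𝟙-sym j z))))) ⟩
    ∑ (λ j → adjacency T i j ℕ.* w j ℕ.+ 𝟙 i z ℕ.* (𝟙 z j ℕ.* w j))
      ≡⟨ ∑-distrib-+ (λ j → adjacency T i j ℕ.* w j) (λ j → 𝟙 i z ℕ.* (𝟙 z j ℕ.* w j)) ⟩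
    ∑ (λ j → adjacency T i j ℕ.* w j) ℕ.+ ∑ (λ j → 𝟙 i z ℕ.* (𝟙 z j ℕ.* w j))
      ≡⟨ cong₂ ℕ._+_ (adjacency-represents i w)
           (trans (sym (*-distribˡ-sum (𝟙 i z) (λ j → 𝟙 z j ℕ.* w j))) (cong (𝟙 i z ℕ.*_) (∑-𝟙 z w))) ⟩
    sum (map w (successors i)) ℕ.+ 𝟙 i z ℕ.* w z
      ≡⟨ ℕ.+-comm (sum (map w (successors i))) (𝟙 i z ℕ.* w z) ⟩
    𝟙 i z ℕ.* w z ℕ.+ sum (map w (successors i))
      ≡⟨ loop ⟩
    sum (map w (successors⁺ i)) ∎
    where
    open ≡-Reasoning
    z = fromℕ last
    loop : 𝟙 i z ℕ.* w z ℕ.+ sum (map w (successors i)) ≡ sum (map w (successors⁺ i))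
    loop with does (i Fin.≟ z)
    ... | true  = cong (ℕ._+ sum (map w (successors i))) (ℕ.+-identityʳ (w z))
    ... | false = refl

-- Power series coefficients of rational functions

at : Polynomial → ℕ → ℤ
at []      _       = 0ℤ
at (c ∷ P) zero    = c
at (c ∷ P) (suc j) = at P j

infixl 6 _⊕_
_⊕_ : Polynomial → Polynomial → Polynomial
[]      ⊕ Q       = Q
(a ∷ P) ⊕ []      = a ∷ P
(a ∷ P) ⊕ (b ∷ Q) = a ℤ.+ b ∷ P ⊕ Q

infixl 7 _⊙_
_⊙_ : ℤ → Polynomial → Polynomial
c ⊙ P = map (c ℤ.*_) P

⊕-sum : List Polynomial → Polynomial
⊕-sum = foldr _⊕_ []

at-⊕ : ∀ P Q j → at (P ⊕ Q) j ≡ at P j ℤ.+ at Q j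
at-⊕ []      Q       j       = sym (ℤ.+-identityˡ (at Q j))
at-⊕ (a ∷ P) []      j       = sym (ℤ.+-identityʳ (at (a ∷ P) j))
at-⊕ (a ∷ P) (b ∷ Q) zero    = refl
at-⊕ (a ∷ P) (b ∷ Q) (suc j) = at-⊕ P Q j

at-⊙ : ∀ c P j → at (c ⊙ P) j ≡ c ℤ.* at P j
at-⊙ c []      j       = sym (ℤ.*-zeroʳ c)
at-⊙ c (a ∷ P) zero    = refl
at-⊙ c (a ∷ P) (suc j) = at-⊙ c P j

at-subtract : ∀ P c Q j → at (subtractMultiple P c Q) j ≡ at P j ℤ.- c ℤ.* at Q j
at-subtract P       c []      j       = sym (trans (cong (λ x → at P j ℤ.- x) (ℤ.*-zeroʳ c)) (ℤ.+-identityʳ (at P j)))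
at-subtract []      c (b ∷ Q) zero    = sym (ℤ.+-identityˡ _)
at-subtract []      c (b ∷ Q) (suc j) = at-subtract [] c Q j
at-subtract (a ∷ P) c (b ∷ Q) zero    = refl
at-subtract (a ∷ P) c (b ∷ Q) (suc j) = at-subtract P c Q j

at-divideByX : ∀ P j → at (divideByX P) j ≡ at P (suc j)
at-divideByX []      j = refl
at-divideByX (a ∷ P) j = refl

constantTerm≡at : ∀ P → constantTerm P ≡ at P 0
constantTerm≡at []      = refl
constantTerm≡at (_ ∷ _) = refl

infix 4 _≐_
_≐_ : Polynomial → Polynomial → Set
P ≐ Q = ∀ j → at P j ≡ at Q j

remainder : Polynomial → Polynomial → Polynomial
remainder P Q = divideByX (subtractMultiple P (constantTerm P ℤ.* constantTerm Q) Q)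

at-remainder : ∀ P Q j → at (remainder P Q) j ≡ at P (suc j) ℤ.- (at P 0 ℤ.* at Q 0) ℤ.* at Q (suc j)
at-remainder P Q j = trans (at-divideByX (subtractMultiple P _ Q) j) (trans (at-subtract P _ Q (suc j))
  (cong₂ (λ x y → at P (suc j) ℤ.- (x ℤ.* y) ℤ.* at Q (suc j)) (constantTerm≡at P) (constantTerm≡at Q)))

coefficient-cong : ∀ m {P P′} Q → P ≐ P′ → coefficient m (P ∕ Q) ≡ coefficient m (P′ ∕ Q)
coefficient-cong zero {P} {P′} Q eq = cong (ℤ._* constantTerm Q)
  (trans (constantTerm≡at P) (trans (eq 0) (sym (constantTerm≡at P′))))
coefficient-cong (suc m) {P} {P′} Q eq = coefficient-cong m Q λ j → trans (at-remainder P Q j)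
  (trans (cong₂ (λ x y → x ℤ.- (y ℤ.* at Q 0) ℤ.* at Q (suc j)) (eq (suc j)) (eq 0)) (sym (at-remainder P′ Q j)))

coefficient-⊕ : ∀ m P P′ Q →
  coefficient m ((P ⊕ P′) ∕ Q) ≡ coefficient m (P ∕ Q) ℤ.+ coefficient m (P′ ∕ Q)
coefficient-⊕ zero P P′ Q = begin
  constantTerm (P ⊕ P′) ℤ.* q                     ≡⟨ cong (ℤ._* q) (trans (constantTerm≡at (P ⊕ P′)) (at-⊕ P P′ 0)) ⟩
  (at P 0 ℤ.+ at P′ 0) ℤ.* q                      ≡⟨ ℤ.*-distribʳ-+ q (at P 0) (at P′ 0) ⟩
  at P 0 ℤ.* q ℤ.+ at P′ 0 ℤ.* q                  ≡⟨ cong₂ (λ x y → x ℤ.* q ℤ.+ y ℤ.* q) (constantTerm≡at P) (constantTerm≡at P′) ⟨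
  constantTerm P ℤ.* q ℤ.+ constantTerm P′ ℤ.* q  ∎
  where
  open ≡-Reasoning
  q = constantTerm Q
coefficient-⊕ (suc m) P P′ Q = trans (coefficient-cong m Q λ j → begin
  at (remainder (P ⊕ P′) Q) j
    ≡⟨ at-remainder (P ⊕ P′) Q j ⟩
  at (P ⊕ P′) (suc j) ℤ.- (at (P ⊕ P′) 0 ℤ.* at Q 0) ℤ.* at Q (suc j)
    ≡⟨ cong₂ (λ x y → x ℤ.- (y ℤ.* at Q 0) ℤ.* at Q (suc j)) (at-⊕ P P′ (suc j)) (at-⊕ P P′ 0) ⟩
  (at P (suc j) ℤ.+ at P′ (suc j)) ℤ.- ((at P 0 ℤ.+ at P′ 0) ℤ.* at Q 0) ℤ.* at Q (suc j)
    ≡⟨ eq (at P (suc j)) (at P′ (suc j)) (at P 0) (at P′ 0) (at Q 0) (at Q (suc j)) ⟩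
  (at P (suc j) ℤ.- (at P 0 ℤ.* at Q 0) ℤ.* at Q (suc j)) ℤ.+
  (at P′ (suc j) ℤ.- (at P′ 0 ℤ.* at Q 0) ℤ.* at Q (suc j))
    ≡⟨ cong₂ ℤ._+_ (at-remainder P Q j) (at-remainder P′ Q j) ⟨
  at (remainder P Q) j ℤ.+ at (remainder P′ Q) j
    ≡⟨ at-⊕ (remainder P Q) (remainder P′ Q) j ⟨
  at (remainder P Q ⊕ remainder P′ Q) j ∎)
  (coefficient-⊕ m (remainder P Q) (remainder P′ Q) Q)
  where
  open ≡-Reasoning
  open ℤ.+-*-Solver
  eq : ∀ a a′ b b′ c d → (a ℤ.+ a′) ℤ.- ((b ℤ.+ b′) ℤ.* c) ℤ.* d ≡
                         (a ℤ.- (b ℤ.* c) ℤ.* d) ℤ.+ (a′ ℤ.- (b′ ℤ.* c) ℤ.* d)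
  eq = solve 6 (λ a a′ b b′ c d → (a :+ a′) :- ((b :+ b′) :* c) :* d
                 := (a :- (b :* c) :* d) :+ (a′ :- (b′ :* c) :* d)) refl

coefficient-[] : ∀ m Q → coefficient m ([] ∕ Q) ≡ 0ℤ
coefficient-[] zero    Q = refl
coefficient-[] (suc m) Q = trans (coefficient-cong m Q λ j → at-remainder′ j) (coefficient-[] m Q)
  where
  at-remainder′ : remainder [] Q ≐ []
  at-remainder′ j = trans (at-remainder [] Q j) refl

coefficient-⊕-sum : ∀ {n} m (P : Fin n → Polynomial) Q (w : Fin n → ℕ) →
  (∀ j → coefficient m (P j ∕ Q) ≡ + w j) →
  ∀ js → coefficient m (⊕-sum (map P js) ∕ Q) ≡ + sum (map w js)
coefficient-⊕-sum m P Q w h []       = coefficient-[] m Q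
coefficient-⊕-sum m P Q w h (j ∷ js) = trans (coefficient-⊕ m (P j) (⊕-sum (map P js)) Q)
  (cong₂ ℤ._+_ (h j) (coefficient-⊕-sum m P Q w h js))

-- This says that P i / Q is the generating function for the walks from i.
SolvesTransfer : ∀ {n} → Digraph n → Polynomial → (Fin n → Polynomial) → Set
SolvesTransfer E Q P = ∀ i → P i ≐ Q ⊕ (0ℤ ∷ ⊕-sum (map P (E i)))

-- All constant terms are 1, so one step of the expansion leaves (P i - Q) / x, which by the
-- transfer equation is the sum of `P` over the successors of `i`. Additivity of `coefficient` in
-- the numerator then gives the recursion of `walkCount`.
coefficient≡walkCount : ∀ {n} {E : Digraph n} {Q P} → at Q 0 ≡ 1ℤ → SolvesTransfer E Q P →
  ∀ m i → coefficient m (P i ∕ Q) ≡ + walkCount E m i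
coefficient≡walkCount {E = E} {Q} {P} q₀ solves = go
  where
  open ≡-Reasoning
  p₀ : ∀ i → at (P i) 0 ≡ 1ℤ
  p₀ i = trans (solves i 0) (trans (at-⊕ Q _ 0) (trans (ℤ.+-identityʳ (at Q 0)) q₀))
  go : ∀ m i → coefficient m (P i ∕ Q) ≡ + walkCount E m i
  go zero i = cong₂ ℤ._*_ (trans (constantTerm≡at (P i)) (p₀ i)) (trans (constantTerm≡at Q) q₀)
  go (suc m) i = trans (coefficient-cong m Q λ j → begin
    at (remainder (P i) Q) j
      ≡⟨ at-remainder (P i) Q j ⟩
    at (P i) (suc j) ℤ.- (at (P i) 0 ℤ.* at Q 0) ℤ.* at Q (suc j)
      ≡⟨ cong₂ (λ x y → x ℤ.- y ℤ.* at Q (suc j))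
           (trans (solves i (suc j)) (at-⊕ Q _ (suc j))) (cong₂ ℤ._*_ (p₀ i) q₀) ⟩
    (at Q (suc j) ℤ.+ at (⊕-sum (map P (E i))) j) ℤ.- 1ℤ ℤ.* at Q (suc j)
      ≡⟨ eq (at Q (suc j)) (at (⊕-sum (map P (E i))) j) ⟩
    at (⊕-sum (map P (E i))) j ∎)
    (coefficient-⊕-sum m P Q (walkCount E m) (go m) (E i))
    where
    open ℤ.+-*-Solver
    eq : ∀ a b → (a ℤ.+ b) ℤ.- 1ℤ ℤ.* a ≡ b
    eq = solve 2 (λ a b → (a :+ b) :- con 1ℤ :* a := b) refl

-- `coefficient` multiplies by the constant term of the denominator in place of a division, so a
-- common factor enters squared and cancels when its square is 1. This serves the denominators that
-- begin with -1.
coefficient-⊙ : ∀ σ → σ ℤ.* σ ≡ 1ℤ → ∀ m P Q → coefficient m ((σ ⊙ P) ∕ (σ ⊙ Q)) ≡ coefficient m (P ∕ Q)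
coefficient-⊙ σ σσ zero P Q = begin
  constantTerm (σ ⊙ P) ℤ.* constantTerm (σ ⊙ Q)
    ≡⟨ cong₂ ℤ._*_ (trans (constantTerm≡at (σ ⊙ P)) (at-⊙ σ P 0)) (trans (constantTerm≡at (σ ⊙ Q)) (at-⊙ σ Q 0)) ⟩
  (σ ℤ.* at P 0) ℤ.* (σ ℤ.* at Q 0)
    ≡⟨ eq σ (at P 0) (at Q 0) ⟩
  (σ ℤ.* σ) ℤ.* (at P 0 ℤ.* at Q 0)
    ≡⟨ trans (cong (ℤ._* (at P 0 ℤ.* at Q 0)) σσ) (ℤ.*-identityˡ (at P 0 ℤ.* at Q 0)) ⟩
  at P 0 ℤ.* at Q 0
    ≡⟨ cong₂ ℤ._*_ (constantTerm≡at P) (constantTerm≡at Q) ⟨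
  constantTerm P ℤ.* constantTerm Q ∎
  where
  open ≡-Reasoning
  open ℤ.+-*-Solver
  eq : ∀ a b c → (a ℤ.* b) ℤ.* (a ℤ.* c) ≡ (a ℤ.* a) ℤ.* (b ℤ.* c)
  eq = solve 3 (λ a b c → (a :* b) :* (a :* c) := (a :* a) :* (b :* c)) refl
coefficient-⊙ σ σσ (suc m) P Q = trans (coefficient-cong m (σ ⊙ Q) λ j → begin
  at (remainder (σ ⊙ P) (σ ⊙ Q)) j
    ≡⟨ at-remainder (σ ⊙ P) (σ ⊙ Q) j ⟩
  at (σ ⊙ P) (suc j) ℤ.- (at (σ ⊙ P) 0 ℤ.* at (σ ⊙ Q) 0) ℤ.* at (σ ⊙ Q) (suc j)
    ≡⟨ cong₂ ℤ._-_ (at-⊙ σ P (suc j)) (cong₂ ℤ._*_ (cong₂ ℤ._*_ (at-⊙ σ P 0) (at-⊙ σ Q 0)) (at-⊙ σ Q (suc j))) ⟩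
  σ ℤ.* at P (suc j) ℤ.- ((σ ℤ.* at P 0) ℤ.* (σ ℤ.* at Q 0)) ℤ.* (σ ℤ.* at Q (suc j))
    ≡⟨ eq σ (at P (suc j)) (at P 0) (at Q 0) (at Q (suc j)) ⟩
  σ ℤ.* (at P (suc j) ℤ.- (σ ℤ.* σ) ℤ.* (at P 0 ℤ.* at Q 0) ℤ.* at Q (suc j))
    ≡⟨ cong (λ x → σ ℤ.* (at P (suc j) ℤ.- x ℤ.* at Q (suc j)))
         (trans (cong (ℤ._* (at P 0 ℤ.* at Q 0)) σσ) (ℤ.*-identityˡ (at P 0 ℤ.* at Q 0))) ⟩
  σ ℤ.* (at P (suc j) ℤ.- (at P 0 ℤ.* at Q 0) ℤ.* at Q (suc j))
    ≡⟨ cong (σ ℤ.*_) (at-remainder P Q j) ⟨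
  σ ℤ.* at (remainder P Q) j
    ≡⟨ at-⊙ σ (remainder P Q) j ⟨
  at (σ ⊙ remainder P Q) j ∎)
  (coefficient-⊙ σ σσ m (remainder P Q) Q)
  where
  open ≡-Reasoning
  open ℤ.+-*-Solver
  eq : ∀ s a b c d → s ℤ.* a ℤ.- ((s ℤ.* b) ℤ.* (s ℤ.* c)) ℤ.* (s ℤ.* d) ≡
                     s ℤ.* (a ℤ.- (s ℤ.* s) ℤ.* (b ℤ.* c) ℤ.* d)
  eq = solve 5 (λ s a b c d → s :* a :- ((s :* b) :* (s :* c)) :* (s :* d)
                 := s :* (a :- (s :* s) :* (b :* c) :* d)) refl

-- Products of polynomials and transfer systems

infixl 7 _⊛_
_⊛_ : Polynomial → Polynomial → Polynomial
[]      ⊛ Q = []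
(a ∷ P) ⊛ Q = a ⊙ Q ⊕ (0ℤ ∷ P ⊛ Q)

infix 4 _≐[_]_ _≐[_]?_
-- Equality up to trailing zeros. When `N` is at least both lengths, padding makes it plain equality
-- of lists, which evaluation decides.
_≐[_]_ : Polynomial → ℕ → Polynomial → Set
P ≐[ N ] Q = P ⊕ replicate N 0ℤ ≡ Q ⊕ replicate N 0ℤ

_≐[_]?_ : ∀ P N Q → Dec (P ≐[ N ] Q)
P ≐[ N ]? Q = list-≡-dec ℤ._≟_ _ _

at-zeros : ∀ N j → at (replicate N 0ℤ) j ≡ 0ℤ
at-zeros zero    j       = refl
at-zeros (suc N) zero    = refl
at-zeros (suc N) (suc j) = at-zeros N j

≐[]⇒≐ : ∀ N {P Q} → P ≐[ N ] Q → P ≐ Q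
≐[]⇒≐ N {P} {Q} eq j = trans (sym (padded P)) (trans (cong (λ R → at R j) eq) (padded Q))
  where
  padded : ∀ R → at (R ⊕ replicate N 0ℤ) j ≡ at R j
  padded R = trans (at-⊕ R (replicate N 0ℤ) j)
    (trans (cong (λ x → at R j ℤ.+ x) (at-zeros N j)) (ℤ.+-identityʳ (at R j)))

-- Q(x) Σₘ walkCount E m i xᵐ up to degree N - 1; in the four systems below it is a polynomial of
-- degree less than 22.
numerator : ∀ {n} → Digraph n → Polynomial → ℕ → Fin n → Polynomial
numerator {n} E Q N i =
  take N (map (λ w → + Vec.lookup w i) (iterate step (Vec.replicate n 1) N) ⊛ Q)
  where
  step : Vec ℕ n → Vec ℕ n
  step w = Vec.tabulate λ i → sum (map (Vec.lookup w) (E i))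

-- σ normalises the denominator to have constant term 1.
record TransferSystem (F : RationalFunction) {n} (E : Digraph (suc n)) : Set where
  field
    σ      : ℤ
    σσ≡1   : σ ℤ.* σ ≡ 1ℤ
    Q      : Polynomial
    P      : Fin (suc n) → Polynomial
    N      : ℕ
    Q₀≡1   : at Q 0 ≡ 1ℤ
    den≡   : σ ⊙ Q ≡ den F
    num≐   : σ ⊙ P zero ≐[ N ] num F
    solve  : ∀ i → P i ≐[ N ] Q ⊕ (0ℤ ∷ ⊕-sum (map P (E i)))

  coefficient≡walks : ∀ m → coefficient m F ≡ + walkCount E m zero
  coefficient≡walks m = begin
    coefficient m (num F ∕ den F)            ≡⟨ cong (λ D → coefficient m (num F ∕ D)) den≡ ⟨
    coefficient m (num F ∕ (σ ⊙ Q))          ≡⟨ coefficient-cong m (σ ⊙ Q) (≐[]⇒≐ N num≐) ⟨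
    coefficient m ((σ ⊙ P zero) ∕ (σ ⊙ Q))   ≡⟨ coefficient-⊙ σ σσ≡1 m (P zero) Q ⟩
    coefficient m (P zero ∕ Q)               ≡⟨ coefficient≡walkCount {P = P} Q₀≡1 (λ i → ≐[]⇒≐ N (solve i)) m zero ⟩
    + walkCount E m zero                     ∎
    where open ≡-Reasoning

-- The numerators have 22 coefficients and the factor x adds one, so padding to 24 covers both
-- sides.
solvesTransfer? : ∀ F {n} (E : Digraph (suc n)) (σ : ℤ) → let Q = σ ⊙ den F; P = numerator E Q 22 in
  Dec ((σ ⊙ P zero ≐[ 24 ] num F) × (∀ i → P i ≐[ 24 ] Q ⊕ (0ℤ ∷ ⊕-sum (map P (E i)))))
solvesTransfer? F E σ = (_ ≐[ 24 ]? _) ×-dec Fin.all? λ i → _ ≐[ 24 ]? _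

transferSystem : ∀ F {n} (E : Digraph (suc n)) (σ : ℤ) → σ ℤ.* σ ≡ 1ℤ →
  at (σ ⊙ den F) 0 ≡ 1ℤ → σ ⊙ (σ ⊙ den F) ≡ den F → True (solvesTransfer? F E σ) → TransferSystem F E
transferSystem F E σ σσ q₀ d ok = record
  { σ = σ; σσ≡1 = σσ; Q = σ ⊙ den F; P = numerator E (σ ⊙ den F) 22; N = 24
  ; Q₀≡1 = q₀; den≡ = d
  ; num≐ = proj₁ (toWitness {a? = solvesTransfer? F E σ} ok)
  ; solve = proj₂ (toWitness {a? = solvesTransfer? F E σ} ok) }

S₁₋ : TransferSystem F₁₋ (successors T₁)
S₁₋ = transferSystem F₁₋ (successors T₁) (- 1ℤ) refl refl refl _

S₁₊ : TransferSystem F₁₊ (successors⁺ T₁)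
S₁₊ = transferSystem F₁₊ (successors⁺ T₁) (- 1ℤ) refl refl refl _

S₂₋ : TransferSystem F₂₋ (successors T₂)
S₂₋ = transferSystem F₂₋ (successors T₂) 1ℤ refl refl refl _

S₂₊ : TransferSystem F₂₊ (successors⁺ T₂)
S₂₊ = transferSystem F₂₊ (successors⁺ T₂) 1ℤ refl refl refl _

truncated : (Σ[ T ∈ Truncation 1 (identity 7) (identity 8) ]
    ((∀ m → + walks (adjacency T) m ≡ coefficient m F₁₋) ×
    (∀ m → + walks (withLoopAtLast (adjacency T)) m ≡ coefficient m F₁₊)))
    ×
    (Σ[ T ∈ Truncation 2 (identity 8) (identity 9) ]
    ((∀ m → + walks (adjacency T) m ≡ coefficient m F₂₋) ×
    (∀ m → + walks (withLoopAtLast (adjacency T)) m ≡ coefficient m F₂₊)))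
truncated =
  (T₁ , (λ m → walks≡ (adjacency T₁) S₁₋ (adjacency-represents T₁) m)
      , (λ m → walks≡ (withLoopAtLast (adjacency T₁)) S₁₊ (withLoop-represents T₁) m)) ,
  (T₂ , (λ m → walks≡ (adjacency T₂) S₂₋ (adjacency-represents T₂) m)
      , (λ m → walks≡ (withLoopAtLast (adjacency T₂)) S₂₊ (withLoop-represents T₂) m))
  where
  walks≡ : ∀ {F n} {E : Digraph (suc n)} (M : Matrix (suc n)) → TransferSystem F E → M Represents E →
    ∀ m → + walks M m ≡ coefficient m F
  walks≡ M S rep m = trans (cong +_ (∑power≡walkCount M _ rep m zero)) (sym (TransferSystem.coefficient≡walks S m))

-- Walks in a truncation against convex descendants

module _ {k υ ω} (T : Truncation k υ ω) where
  open Truncation T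

  private
    W : ℕ → Vertex → ℕ
    W = walkCount (successors T)

    cd : ℕ → List ℕ → ℕ
    cd = convexDescendants k

    contribution : ℕ → Maybe Vertex → ℕ
    contribution m = maybe (W m) 0

    W-suc : ∀ m i → W (suc m) i ≡ contribution m (edge i left) ℕ.+ contribution m (edge i right)
    W-suc m i with edge i left | edge i right
    ... | just a  | just b  = cong (W m a ℕ.+_) (ℕ.+-identityʳ (W m b))
    ... | just a  | nothing = refl
    ... | nothing | just b  = ℕ.+-identityʳ (W m b)
    ... | nothing | nothing = refl

    contribution≤ : ∀ m i s → (∀ j → W m j ℕ.≤ cd m (rep j)) →
      contribution m (edge i s) ℕ.≤ cd m (descendant s (rep i))
    contribution≤ m i s ih with edge i s in e
    ... | nothing = ℕ.z≤n
    ... | just j  = subst (W m j ℕ.≤_) (sym (proj₁ (proj₂ (edge-present i s j e)) m)) (ih j)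

  walkCount≤convexDescendants : ∀ m i → W m i ℕ.≤ cd m (rep i)
  walkCount≤convexDescendants zero i with kConvex? k (rep i)
  ... | yes _ = ℕ.≤-refl
  ... | no ¬c = contradiction (rep-convex i) ¬c
  walkCount≤convexDescendants (suc m) i =
    subst₂ ℕ._≤_ (sym (W-suc m i)) (sym (convexDescendants-suc k m (rep i)))
      (ℕ.+-mono-≤ (contribution≤ m i left ih) (contribution≤ m i right ih))
    where ih = walkCount≤convexDescendants m

  private
    strict-suc : ∀ m i s → contribution m (edge i s) ℕ.< cd m (descendant s (rep i)) →
      W (suc m) i ℕ.< cd (suc m) (rep i)
    strict-suc m i left  h =
      subst₂ ℕ._<_ (sym (W-suc m i)) (sym (convexDescendants-suc k m (rep i)))
        (ℕ.+-mono-<-≤ h (contribution≤ m i right (walkCount≤convexDescendants m)))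
    strict-suc m i right h =
      subst₂ ℕ._<_ (sym (W-suc m i)) (sym (convexDescendants-suc k m (rep i)))
        (ℕ.+-mono-≤-< (contribution≤ m i left (walkCount≤convexDescendants m)) h)

    Strict : Vertex → Set
    Strict i = ∃[ N ] (∀ m → N ℕ.≤ m → W m i ℕ.< cd m (rep i))

    -- A deficit at the target of an edge is a deficit at its source one generation later, since the
    -- other branch cannot make up for it: its walks never outnumber its convex descendants.
    strict-path : ∀ {i j} → Star (λ a b → ∃[ s ] edge a s ≡ just b) i j → Strict j → Strict i
    strict-path stop strict = strict
    strict-path (_◅_ {i} {j} (s , e) path) strict with N , h ← strict-path path strict =
      suc N , λ { (suc m) (ℕ.s≤s N≤m) → strict-suc m i s (step m (h m N≤m)) }
      where
      step : ∀ m → W m j ℕ.< cd m (rep j) → contribution m (edge i s) ℕ.< cd m (descendant s (rep i))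
      step m h = subst₂ ℕ._<_ (cong (contribution m) (sym e))
        (sym (proj₁ (proj₂ (edge-present i s j e)) m)) h

  walkCount<convexDescendants : ∀ i s → edge i s ≡ nothing →
    (∀ m → 0 ℕ.< cd m (descendant s (rep i))) →
    Σ[ N ∈ ℕ ] (∀ m → N ℕ.≤ m → W m zero ℕ.< cd m (1 ∷ 2 ∷ []))
  walkCount<convexDescendants i s e pos with N , h ← strict-path (reachable i)
    (1 , λ { (suc m) _ → strict-suc m i s (subst (λ x → contribution m x ℕ.< _) (sym e) (pos m)) }) =
    N , λ m N≤m → subst (λ π → W m zero ℕ.< cd m π) rep-start (h m N≤m)

-- A new 1 next to an end with letter 1 leaves the slack 1 ∸ (k + 1) = 0, so insertion on the left
-- remains possible for ever.
count-left : ∀ k g q → 0 ℕ.< count k g ((0 , 1) , q)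
count-left k zero    q = ℕ.s≤s ℕ.z≤n
count-left k (suc g) q = ℕ.<-≤-trans
  (subst (λ s → 0 ℕ.< count k g ((s , 1) , recede k q)) (sym (ℕ.0∸n≡0 k)) (count-left k g (recede k q)))
  (ℕ.m≤m+n _ _)

-- k-convex permutations as descendants

length-≤ : ∀ {A : Set} (xs ys : List A) → Unique xs → (∀ {x} → x ∈ xs → x ∈ ys) → length xs ℕ.≤ length ys
length-≤ []       ys _        _   = ℕ.z≤n
length-≤ (x ∷ xs) ys (x∉ ∷ u) sub with ys₁ , ys₂ , refl ← ∈-∃++ (sub (here refl)) =
  subst (suc (length xs) ℕ.≤_) (sym len) (ℕ.s≤s (length-≤ xs (ys₁ ++ ys₂) u λ z∈ → move z∈ (∈-++⁻ ys₁ (sub (there z∈)))))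
  where
  len : length (ys₁ ++ x ∷ ys₂) ≡ suc (length (ys₁ ++ ys₂))
  len = trans (length-++ ys₁) (trans (ℕ.+-suc (length ys₁) (length ys₂)) (cong suc (sym (length-++ ys₁))))
  move : ∀ {z} → z ∈ xs → z ∈ ys₁ ⊎ z ∈ x ∷ ys₂ → z ∈ ys₁ ++ ys₂
  move z∈ (inj₁ z∈₁)         = ∈-++⁺ˡ z∈₁
  move z∈ (inj₂ (here refl)) = contradiction refl (All.lookup x∉ z∈)
  move z∈ (inj₂ (there z∈₂)) = ∈-++⁺ʳ ys₁ z∈₂

-- Otherwise n distinct letters would lie among 2, ..., n.
1∈permutation : ∀ π → IsPermutation π → 1 ℕ.≤ length π → 1 ∈ π
1∈permutation π (u , range) 1≤n with 1 ∈? π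
... | yes 1∈ = 1∈
... | no  1∉ = contradiction
  (subst (length π ℕ.≤_) (length-applyUpTo (λ j → suc (suc j)) (pred (length π)))
    (length-≤ π (applyUpTo (λ j → suc (suc j)) (pred (length π))) u inside))
  (ℕ.<⇒≱ (pred< 1≤n))
  where
  pred< : ∀ {n} → 1 ℕ.≤ n → pred n ℕ.< n
  pred< (ℕ.s≤s _) = ℕ.≤-refl
  inside : ∀ {x} → x ∈ π → x ∈ applyUpTo (λ j → suc (suc j)) (pred (length π))
  inside {x} x∈ = go x x∈ (All.lookup range x∈)
    where
    go : ∀ x → x ∈ π → 1 ℕ.≤ x × x ℕ.≤ length π → x ∈ applyUpTo (λ j → suc (suc j)) (pred (length π))
    go 1             x∈ _       = contradiction x∈ 1∉
    go (suc (suc x)) x∈ (_ , h) = ∈-applyUpTo⁺ _ (ℕ.pred-mono-≤ h)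

-- Two distinct neighbours of 1 have sum at least 2 + 3, so the second difference at 1 is at least
-- 3. This is where k ≤ 2 enters; for k = 3 the permutation 213 has its 1 inside.
¬interior-1 : ∀ {k a c} → k ℕ.≤ 2 → 1 ℕ.≤ a → 1 ℕ.≤ c → a ≢ 1 → c ≢ 1 → a ≢ c →
  ¬ + a ℤ.+ + c ℤ.- + 2 ℤ.* + 1 ℤ.≤ + k
¬interior-1 {k} {suc zero} _ _ _ a≢1 _ _ _ = a≢1 refl
¬interior-1 {k} {suc (suc a)} {suc zero} _ _ _ _ c≢1 _ _ = c≢1 refl
¬interior-1 {k} {suc (suc a)} {suc (suc c)} k≤2 _ _ _ _ a≢c h
  with a ℕ.+ c in e | ℤ.drop‿+≤+ (subst (ℤ._≤ + 2) eq (ℤ.≤-trans h (ℤ.+≤+ k≤2)))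
  where
  open ℤ.+-*-Solver
  eq′ : ∀ a c → (+ 2 ℤ.+ a) ℤ.+ (+ 2 ℤ.+ c) ℤ.- + 2 ≡ (a ℤ.+ c) ℤ.+ + 2
  eq′ = solve 2 (λ a c → (con (+ 2) :+ a) :+ (con (+ 2) :+ c) :- con (+ 2) := (a :+ c) :+ con (+ 2)) refl
  eq : + suc (suc a) ℤ.+ + suc (suc c) ℤ.- + 2 ℤ.* + 1 ≡ + (a ℕ.+ c ℕ.+ 2)
  eq = eq′ (+ a) (+ c)
-- Here `a` and `c` are the letters lowered by 2, so a vanishing sum makes both letters equal to 2.
... | zero  | _ = a≢c (cong (λ z → suc (suc z)) (trans (ℕ.m+n≡0⇒m≡0 a e) (sym (ℕ.m+n≡0⇒n≡0 a e))))
... | suc n | ℕ.s≤s h′ = contradiction (subst (ℕ._≤ 1) (ℕ.+-comm n 2) h′) λ { (ℕ.s≤s ()) }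

-- The leading letter `a` supplies the left neighbour: a 1 in `π` that is not last would have
-- neighbours on both sides.
final-1 : ∀ {k} → k ℕ.≤ 2 → ∀ a π → Unique (a ∷ π) → All (1 ℕ.≤_) (a ∷ π) → KConvex k (a ∷ π) → 1 ∈ π →
  ∃[ σ ] a ∷ π ≡ σ ∷ʳ 1
final-1 k≤2 a (b ∷ []) _ _ _ (here refl) = a ∷ [] , refl
final-1 k≤2 a (b ∷ c ∷ π) ((a≢1 ∷ a≢c ∷ _) ∷ (1≢c ∷ _) ∷ _) (1≤a ∷ _ ∷ 1≤c ∷ _) (h , _) (here refl) =
  contradiction h (¬interior-1 k≤2 1≤a 1≤c a≢1 (1≢c ∘ sym) a≢c)
final-1 k≤2 a (b ∷ c ∷ π) (_ ∷ u) (_ ∷ r) (_ , h) (there 1∈)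
  with σ , eq ← final-1 k≤2 b (c ∷ π) u r h 1∈ = a ∷ σ , cong (a ∷_) eq

unique-∷ʳ⁺ : ∀ {x : ℕ} π → All (_≢ x) π → Unique π → Unique (π ∷ʳ x)
unique-∷ʳ⁺ []      _        _        = [] ∷ []
unique-∷ʳ⁺ (a ∷ π) (h ∷ hs) (a∉ ∷ u) = All.∷ʳ⁺ a∉ h ∷ unique-∷ʳ⁺ π hs u

unique-∷ʳ⁻ : ∀ {x : ℕ} π → Unique (π ∷ʳ x) → All (_≢ x) π × Unique π
unique-∷ʳ⁻ []      _        = [] , []
unique-∷ʳ⁻ (a ∷ π) (a∉ ∷ u) with h , u′ ← unique-∷ʳ⁻ π u | a∉′ , a≢x ← All.∷ʳ⁻ a∉ = a≢x ∷ h , a∉′ ∷ u′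

InRange : ℕ → ℕ → Set
InRange n a = 1 ℕ.≤ a × a ℕ.≤ n

length-descendant : ∀ s π → length (descendant s π) ≡ suc (length π)
length-descendant left  π = cong suc (length-map suc π)
length-descendant right π = trans (length-++ (map suc π))
  (trans (ℕ.+-comm _ 1) (cong suc (length-map suc π)))

descendant-permutation⁺ : ∀ s π → IsPermutation π → IsPermutation (descendant s π)
descendant-permutation⁺ s π (u , range) =
  unique s , subst (λ n → All (InRange n) (descendant s π)) (sym (length-descendant s π)) (inRange s)
  where
  shifted : ∀ {n} {xs} → All (InRange n) xs → All (InRange (suc n)) (map suc xs)
  shifted h = All.map⁺ (All.map (λ (_ , a≤n) → ℕ.s≤s ℕ.z≤n , ℕ.s≤s a≤n) h)
  >1 : All (_≢ 1) (map suc π)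
  >1 = All.map⁺ (All.map (λ { (1≤a , _) refl → case 1≤a of λ () }) range)
  unique : ∀ s → Unique (descendant s π)
  unique left  = All.map (λ ≢1 → ≢1 ∘ sym) >1 ∷ Unique.map⁺ ℕ.suc-injective u
  unique right = unique-∷ʳ⁺ (map suc π) >1 (Unique.map⁺ ℕ.suc-injective u)
  inRange : ∀ s → All (InRange (suc (length π))) (descendant s π)
  inRange left  = (ℕ.≤-refl , ℕ.s≤s ℕ.z≤n) ∷ shifted range
  inRange right = All.∷ʳ⁺ (shifted range) (ℕ.≤-refl , ℕ.s≤s ℕ.z≤n)

unshift : ∀ n σ → Unique σ → All (_≢ 1) σ → All (InRange (suc n)) σ →
  ∃[ τ ] (σ ≡ map suc τ × Unique τ × All (InRange n) τ)
unshift n σ u ≢1 range = map pred σ , eq , Unique.map⁻ (subst Unique eq u) , All.map⁺ (All.zipWith lower (≢1 , range))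
  where
  suc-pred : ∀ {a} → InRange (suc n) a → a ≡ suc (pred a)
  suc-pred (ℕ.s≤s _ , _) = refl
  lower : ∀ {a} → a ≢ 1 × InRange (suc n) a → InRange n (pred a)
  lower {suc zero}    (≢1 , _)              = contradiction refl ≢1
  lower {suc (suc a)} (_ , (_ , ℕ.s≤s a≤n)) = ℕ.s≤s ℕ.z≤n , a≤n
  eq : σ ≡ map suc (map pred σ)
  eq = trans (sym (map-id-local (All.map (sym ∘ suc-pred) range))) (map-∘ σ)

descendant-permutation⁻ : ∀ {k} → k ℕ.≤ 2 → ∀ a π → IsPermutation (a ∷ π) → KConvex k (a ∷ π) →
  ∃[ s ] ∃[ τ ] (a ∷ π ≡ descendant s τ × IsPermutation τ)
descendant-permutation⁻ k≤2 a π p@(u , range) h with 1∈permutation (a ∷ π) p (ℕ.s≤s ℕ.z≤n)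
descendant-permutation⁻ k≤2 a π (a∉ ∷ u , _ ∷ range) h | here refl
  with τ , refl , u′ , r ← unshift (length π) π u (All.map (_∘ sym) a∉) range =
  left , τ , refl , u′ , subst (λ n → All (InRange n) τ) (length-map suc τ) r
descendant-permutation⁻ k≤2 a π (u , range) h | there 1∈
  with σ , eq ← final-1 k≤2 a π u (All.map proj₁ range) h 1∈
  with ≢1 , uσ ← unique-∷ʳ⁻ σ (subst Unique eq u)
  with rσ , _ ← All.∷ʳ⁻ (subst (All (InRange (suc (length π)))) eq range)
  with τ , refl , u′ , r ← unshift (length π) σ uσ ≢1 rσ =
  right , τ , eq , u′ , subst (λ n → All (InRange n) τ) len r
  where
  len : length π ≡ length τ
  len = ℕ.suc-injective (trans (cong length eq) (length-descendant right τ))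

∈-generation-descendant : ∀ g {σ π} s → σ ∈ generation g π → descendant s σ ∈ generation (suc g) π
∈-generation-descendant zero    left  (here refl) = here refl
∈-generation-descendant zero    right (here refl) = there (here refl)
∈-generation-descendant (suc g) {σ} {π} s σ∈ with ∈-++⁻ (generation g (descendant left π)) σ∈
... | inj₁ σ∈′ = ∈-++⁺ˡ (∈-generation-descendant g s σ∈′)
... | inj₂ σ∈′ = ∈-++⁺ʳ (generation (suc g) (descendant left π)) (∈-generation-descendant g s σ∈′)

∈-generation⇒permutation : ∀ g {σ π} → IsPermutation π → σ ∈ generation g π →
  IsPermutation σ × length σ ≡ g ℕ.+ length π
∈-generation⇒permutation zero    p (here refl) = p , refl
∈-generation⇒permutation (suc g) {σ} {π} p σ∈ = [ from left , from right ]′ (∈-++⁻ (generation g (descendant left π)) σ∈)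
  where
  from : ∀ s → σ ∈ generation g (descendant s π) → IsPermutation σ × length σ ≡ suc g ℕ.+ length π
  from s σ∈′ with p′ , len ← ∈-generation⇒permutation g (descendant-permutation⁺ s π p) σ∈′ =
    p′ , trans len (trans (cong (g ℕ.+_) (length-descendant s π)) (ℕ.+-suc g (length π)))

left≢right : ∀ {π σ} → IsPermutation π → 1 ℕ.≤ length π → 1 ℕ.≤ length σ → descendant left σ ≢ descendant right π
left≢right {a ∷ π} (_ , (1≤a , _) ∷ _) _ _ eq = ℕ.<⇒≢ 1≤a (ℕ.suc-injective (proj₁ (∷-injective eq)))

-- A descendant determines its parent. A left one begins with 1 and a right one does not, so the
-- side is known; removing the 1 and lowering the letters undoes the step.
generation-injective : ∀ g {ρ π σ} → IsPermutation π → IsPermutation σ → 1 ℕ.≤ length π → 1 ℕ.≤ length σ →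
  ρ ∈ generation g π → ρ ∈ generation g σ → π ≡ σ
generation-injective zero    pπ pσ lπ lσ (here refl) (here refl) = refl
generation-injective (suc g) {ρ} {π} {σ} pπ pσ lπ lσ ρ∈π ρ∈σ =
  [ from left , from right ]′ (∈-++⁻ (generation g (descendant left π)) ρ∈π)
  where
  len : ∀ s {τ} → 1 ℕ.≤ length (descendant s τ)
  len s {τ} = subst (1 ℕ.≤_) (sym (length-descendant s τ)) (ℕ.s≤s ℕ.z≤n)
  parents : ∀ s t → descendant s π ≡ descendant t σ → π ≡ σ
  parents left  left  eq = map-injective ℕ.suc-injective (proj₂ (∷-injective eq))
  parents right right eq = map-injective ℕ.suc-injective (proj₁ (∷ʳ-injective (map suc π) (map suc σ) eq))
  parents left  right eq = contradiction eq (left≢right pσ lσ lπ)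
  parents right left  eq = contradiction (sym eq) (left≢right pπ lπ lσ)
  from : ∀ s → ρ ∈ generation g (descendant s π) → π ≡ σ
  from s ρ∈ = [ to′ left , to′ right ]′ (∈-++⁻ (generation g (descendant left σ)) ρ∈σ)
    where
    to′ : ∀ t → ρ ∈ generation g (descendant t σ) → π ≡ σ
    to′ t ρ∈′ = parents s t (generation-injective g (descendant-permutation⁺ s π pπ)
      (descendant-permutation⁺ t σ pσ) (len s) (len t) ρ∈ ρ∈′)

generation-disjoint : ∀ g {π σ} → IsPermutation π → IsPermutation σ → 1 ℕ.≤ length π → 1 ℕ.≤ length σ →
  π ≢ σ → Disjoint (generation g π) (generation g σ)
generation-disjoint g pπ pσ lπ lσ π≢σ (ρ∈π , ρ∈σ) = π≢σ (generation-injective g pπ pσ lπ lσ ρ∈π ρ∈σ)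

generation-unique : ∀ g {π} → IsPermutation π → 1 ℕ.≤ length π → Unique (generation g π)
generation-unique zero    p l = [] ∷ []
generation-unique (suc g) {π} p l = Unique.++⁺ (half left) (half right)
  (generation-disjoint g (descendant-permutation⁺ left π p) (descendant-permutation⁺ right π p)
    (len left) (len right) (left≢right p l l))
  where
  len : ∀ s → 1 ℕ.≤ length (descendant s π)
  len s = subst (1 ℕ.≤_) (sym (length-descendant s π)) (ℕ.s≤s ℕ.z≤n)
  half : ∀ s → Unique (generation g (descendant s π))
  half s = generation-unique g (descendant-permutation⁺ s π p) (len s)

∈-words⁺ : ∀ A n {π} → length π ≡ n → All (_∈ A) π → π ∈ words A n
∈-words⁺ A zero    {[]}    _    _        = here refl
∈-words⁺ A (suc n) {a ∷ π} refl (a∈ ∷ h) = ∈-cartesianProductWith⁺ _∷_ a∈ (∈-words⁺ A n refl h)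

∈-words⁻ : ∀ A n {π} → π ∈ words A n → length π ≡ n
∈-words⁻ A zero    (here refl) = refl
∈-words⁻ A (suc n) π∈ with a , π′ , _ , π′∈ , refl ← ∈-cartesianProductWith⁻ _∷_ A (words A n) π∈ =
  cong suc (∈-words⁻ A n π′∈)

words-unique : ∀ {A} n → Unique A → Unique (words A n)
words-unique zero    u = [] ∷ []
words-unique (suc n) u = Unique.cartesianProductWith⁺ _∷_ ∷-injective u (words-unique n u)

identity-unique : ∀ n → Unique (identity n)
identity-unique n = Unique.applyUpTo⁺₁ suc n λ i<j _ → ℕ.<⇒≢ i<j ∘ ℕ.suc-injective

perm12 : IsPermutation (1 ∷ 2 ∷ [])
perm12 = toWitness {a? = isPermutation? (1 ∷ 2 ∷ [])} _

perm21 : IsPermutation (2 ∷ 1 ∷ [])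
perm21 = toWitness {a? = isPermutation? (2 ∷ 1 ∷ [])} _

-- The letter 1 is removed from an end repeatedly, until length 1 is reached. Removal undoes the
-- latest step whereas `generation` unfolds from the first one; `∈-generation-descendant` reconciles
-- the two orders.
from12or21 : ∀ {k} → k ℕ.≤ 2 → ∀ m π → IsPermutation π → KConvex k π → length π ≡ 2 ℕ.+ m →
  π ∈ generation m (1 ∷ 2 ∷ []) ++ generation m (2 ∷ 1 ∷ [])
from12or21 {k} k≤2 m (a ∷ π) p h len with descendant-permutation⁻ k≤2 a π p h
... | s , τ , eq , pτ = subst (_∈ generation m (1 ∷ 2 ∷ []) ++ generation m (2 ∷ 1 ∷ [])) (sym eq)
        (go m s τ pτ (descendant-convex⁻ k s τ (subst (KConvex k) eq h))
          (ℕ.suc-injective (trans (sym (length-descendant s τ)) (trans (cong length (sym eq)) len))))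
  where
  go : ∀ m s τ → IsPermutation τ → KConvex k τ → length τ ≡ suc m →
    descendant s τ ∈ generation m (1 ∷ 2 ∷ []) ++ generation m (2 ∷ 1 ∷ [])
  go zero left  (1 ∷ []) _ _ refl = here refl
  go zero right (1 ∷ []) _ _ refl = there (here refl)
  go zero s (zero ∷ []) (_ , (() , _) ∷ _) _ refl
  go zero s (suc (suc b) ∷ []) (_ , (_ , ℕ.s≤s ()) ∷ _) _ refl
  go (suc m) s τ pτ hτ len =
    [ ∈-++⁺ˡ ∘ ∈-generation-descendant m s
    , ∈-++⁺ʳ (generation (suc m) (1 ∷ 2 ∷ [])) ∘ ∈-generation-descendant m s ]′
    (∈-++⁻ (generation m (1 ∷ 2 ∷ [])) (from12or21 k≤2 m τ pτ hτ len))

-- Both lists are free of repetitions and have the same members, hence the same length. The factor 2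
-- is the reversal symmetry between 12 and 21.
f≡2*convexDescendants : ∀ {k} → k ℕ.≤ 2 → ∀ m → f k (2 ℕ.+ m) ≡ 2 ℕ.* convexDescendants k m (1 ∷ 2 ∷ [])
f≡2*convexDescendants {k} k≤2 m = begin
  length X                                                       ≡⟨ ↭-length (∼bag⇒↭ (unique∧set⇒bag X-unique Y-unique (mk⇔ X⊆Y Y⊆X))) ⟩
  length (filter (kConvex? k) (G₁ ++ G₂))                        ≡⟨ trans (cong length (filter-++ (kConvex? k) G₁ G₂)) (length-++ (filter (kConvex? k) G₁)) ⟩
  cd (1 ∷ 2 ∷ []) ℕ.+ cd (2 ∷ 1 ∷ [])                            ≡⟨ cong (cd (1 ∷ 2 ∷ []) ℕ.+_) reverse ⟩
  cd (1 ∷ 2 ∷ []) ℕ.+ cd (1 ∷ 2 ∷ [])                            ≡⟨ cong (cd (1 ∷ 2 ∷ []) ℕ.+_) (ℕ.+-identityʳ (cd (1 ∷ 2 ∷ []))) ⟨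
  2 ℕ.* cd (1 ∷ 2 ∷ [])                                          ∎
  where
  open ≡-Reasoning
  n = 2 ℕ.+ m
  cd = convexDescendants k m
  P? = λ π → isPermutation? π ×-dec kConvex? k π
  G₁ = generation m (1 ∷ 2 ∷ [])
  G₂ = generation m (2 ∷ 1 ∷ [])
  X = filter P? (words (identity n) n)
  X-unique : Unique X
  X-unique = Unique.filter⁺ P? (words-unique n (identity-unique n))
  Y-unique : Unique (filter (kConvex? k) (G₁ ++ G₂))
  Y-unique = Unique.filter⁺ (kConvex? k) (Unique.++⁺
    (generation-unique m perm12 (ℕ.s≤s ℕ.z≤n)) (generation-unique m perm21 (ℕ.s≤s ℕ.z≤n))
    (generation-disjoint m perm12 perm21 (ℕ.s≤s ℕ.z≤n) (ℕ.s≤s ℕ.z≤n) λ ()))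
  X⊆Y : ∀ {π} → π ∈ X → π ∈ filter (kConvex? k) (G₁ ++ G₂)
  X⊆Y {π} π∈ with π∈w , p , h ← ∈-filter⁻ P? {xs = words (identity n) n} π∈ =
    ∈-filter⁺ (kConvex? k) (from12or21 k≤2 m π p h (∈-words⁻ (identity n) n π∈w)) h
  Y⊆X : ∀ {π} → π ∈ filter (kConvex? k) (G₁ ++ G₂) → π ∈ X
  Y⊆X {π} π∈ with π∈G , h ← ∈-filter⁻ (kConvex? k) {xs = G₁ ++ G₂} π∈ = ∈-filter⁺ P?
      (∈-words⁺ (identity n) n len (subst (λ l → All (_∈ identity l) π) len (All.map letter (proj₂ p)))) (p , h)
    where
    both : IsPermutation π × length π ≡ m ℕ.+ 2
    both = [ ∈-generation⇒permutation m perm12 , ∈-generation⇒permutation m perm21 ]′ (∈-++⁻ G₁ π∈G)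
    p = proj₁ both
    len : length π ≡ n
    len = trans (proj₂ both) (ℕ.+-comm m 2)
    letter : ∀ {a} → InRange (length π) a → a ∈ identity (length π)
    letter {suc a} (_ , h) = ∈-applyUpTo⁺ suc h
  reverse : cd (2 ∷ 1 ∷ []) ≡ cd (1 ∷ 2 ∷ [])
  reverse = sameState⇒sameVertex (2 ∷ 1 ∷ []) (1 ∷ 2 ∷ [])
    (ℕ.s≤s (ℕ.s≤s ℕ.z≤n)) (ℕ.s≤s (ℕ.s≤s ℕ.z≤n)) _ _ (inj₂ refl) m

-- Rational arithmetic

0≤* : ∀ {p q} → 0ℚᵘ ℚ.≤ p → 0ℚᵘ ℚ.≤ q → 0ℚᵘ ℚ.≤ p ℚ.* q
0≤* {p} {q} 0≤p 0≤q = ℚ.≤-respˡ-≃ (ℚ.*-zeroˡ 0ℚᵘ) (*-mono ℚ.≤-refl ℚ.≤-refl 0≤p 0≤q)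

0≤+ : ∀ {p q} → 0ℚᵘ ℚ.≤ p → 0ℚᵘ ℚ.≤ q → 0ℚᵘ ℚ.≤ p ℚ.+ q
0≤+ 0≤p 0≤q = ℚ.≤-respˡ-≃ (ℚ.+-identityˡ 0ℚᵘ) (ℚ.+-mono-≤ 0≤p 0≤q)

*-monoˡ : ∀ {p q} r → 0ℚᵘ ℚ.≤ r → p ℚ.≤ q → r ℚ.* p ℚ.≤ r ℚ.* q
*-monoˡ r 0≤r = ℚ.*-monoʳ-≤-nonNeg r {{ℚ.nonNegative 0≤r}}

*-monoʳ : ∀ {p q} r → 0ℚᵘ ℚ.≤ r → p ℚ.≤ q → p ℚ.* r ℚ.≤ q ℚ.* r
*-monoʳ r 0≤r = ℚ.*-monoˡ-≤-nonNeg r {{ℚ.nonNegative 0≤r}}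

*-cancelˡ : ∀ {p q} r → 0ℚᵘ ℚ.< r → r ℚ.* p ℚ.≤ r ℚ.* q → p ℚ.≤ q
*-cancelˡ r 0<r = ℚ.*-cancelˡ-≤-pos r {{ℚ.positive 0<r}}

0<* : ∀ {p q} → 0ℚᵘ ℚ.< p → 0ℚᵘ ℚ.< q → 0ℚᵘ ℚ.< p ℚ.* q
0<* {p} {q} 0<p 0<q = ℚ.<-respˡ-≃ (ℚ.*-zeroʳ p) (ℚ.*-monoʳ-<-pos p {{ℚ.positive 0<p}} 0<q)

∣∣≤ : ∀ {p a} → p ℚ.≤ a → ℚ.- p ℚ.≤ a → ∣ p ∣ ℚ.≤ a
∣∣≤ {p} p≤a -p≤a with ℚ.∣p∣≡p∨∣p∣≡-p p
... | inj₁ eq = subst (ℚ._≤ _) (sym eq) p≤a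
... | inj₂ eq = subst (ℚ._≤ _) (sym eq) -p≤a

p≤∣p∣ : ∀ p → p ℚ.≤ ∣ p ∣
p≤∣p∣ p with ℚ.≤-total 0ℚᵘ p
... | inj₁ 0≤p = ℚ.≤-reflexive (ℚ.≃-sym (ℚ.0≤p⇒∣p∣≃p 0≤p))
... | inj₂ p≤0 = ℚ.≤-trans p≤0 (ℚ.0≤∣p∣ p)

-p≤∣p∣ : ∀ p → ℚ.- p ℚ.≤ ∣ p ∣
-p≤∣p∣ p = ℚ.≤-respʳ-≃ (ℚ.∣-p∣≃∣p∣ p) (p≤∣p∣ (ℚ.- p))

sq : ℚᵘ → ℚᵘ
sq p = p ℚ.* p

0≤sq : ∀ p → 0ℚᵘ ℚ.≤ sq p
0≤sq p = ℚ.≤-respʳ-≃ (ℚ.≃-trans (ℚ.≃-sym (ℚ.∣p*q∣≃∣p∣*∣q∣ p p)) eq) (0≤* (ℚ.0≤∣p∣ p) (ℚ.0≤∣p∣ p))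
  where
  eq : ∣ p ℚ.* p ∣ ℚ.≃ p ℚ.* p
  eq with ℚ.≤-total 0ℚᵘ p
  ... | inj₁ 0≤p = ℚ.0≤p⇒∣p∣≃p (0≤* 0≤p 0≤p)
  ... | inj₂ p≤0 = ℚ.0≤p⇒∣p∣≃p (ℚ.≤-respʳ-≃ (neg-sq p) (0≤* (ℚ.neg-mono-≤ p≤0) (ℚ.neg-mono-≤ p≤0)))
    where
    open +-*-Solver
    neg-sq : ∀ p → ℚ.- p ℚ.* ℚ.- p ℚ.≃ p ℚ.* p
    neg-sq = solve 1 (λ p → (:- p) :* (:- p) := p :* p) ℚ.≃-refl

sq-cancel-≤ : ∀ {p a} → 0ℚᵘ ℚ.≤ a → sq p ℚ.≤ sq a → p ℚ.≤ a
sq-cancel-≤ {p} {a} 0≤a h = ℚ.≮⇒≥ λ a<p →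
  let 0<p = ℚ.≤-<-trans 0≤a a<p in
  ℚ.<-irrefl ℚ.≃-refl (ℚ.≤-<-trans h (ℚ.≤-<-trans
    (*-monoˡ a 0≤a (ℚ.<⇒≤ a<p)) (ℚ.*-monoˡ-<-pos p {{ℚ.positive 0<p}} a<p)))

∣∣≤-sq : ∀ {p a} → 0ℚᵘ ℚ.≤ a → sq p ℚ.≤ sq a → ∣ p ∣ ℚ.≤ a
∣∣≤-sq {p} 0≤a h = ∣∣≤ (sq-cancel-≤ 0≤a h) (sq-cancel-≤ 0≤a (ℚ.≤-respˡ-≃ (eq p) h))
  where
  open +-*-Solver
  eq : ∀ p → sq p ℚ.≃ sq (ℚ.- p)
  eq = solve 1 (λ p → p :* p := (:- p) :* (:- p)) ℚ.≃-refl

natℚ : ℕ → ℚᵘ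
natℚ n = + n ℚ./ 1

natℚ-+ : ∀ m n → natℚ (m ℕ.+ n) ℚ.≃ natℚ m ℚ.+ natℚ n
natℚ-+ m n = ℚ.*≡* (cong (ℤ._* + 1) (sym (cong₂ ℤ._+_ (ℤ.*-identityʳ (+ m)) (ℤ.*-identityʳ (+ n)))))

natℚ-mono : ∀ {m n} → m ℕ.≤ n → natℚ m ℚ.≤ natℚ n
natℚ-mono m≤n = ℚ.*≤* (ℤ.*-monoʳ-≤-nonNeg (+ 1) (ℤ.+≤+ m≤n))

0≤natℚ : ∀ n → 0ℚᵘ ℚ.≤ natℚ n
0≤natℚ n = natℚ-mono {0} {n} ℕ.z≤n

archimedean : ∀ {θ} → 0ℚᵘ ℚ.< θ → ∃[ N ] 1ℚᵘ ℚ.≤ natℚ N ℚ.* θ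
-- The denominator of θ is large enough, because its numerator is at least 1.
archimedean {mkℚᵘ (+ suc n) d} _ = suc d ,
  ℚ.≤-trans (ℚ.*≤* (ℤ.≤-reflexive (cong +_ {x = 1 ℕ.* (1 ℕ.* suc d)} {y = suc d ℕ.* 1 ℕ.* 1} (eq d)))) (*-monoˡ (natℚ (suc d)) (0≤natℚ (suc d)) (ℚ.*≤* {mkℚᵘ (+ 1) d} {mkℚᵘ (+ suc n) d} (ℤ.*-monoʳ-≤-nonNeg (+ suc d) (ℤ.+≤+ {1} {suc n} (ℕ.s≤s ℕ.z≤n)))))
  where
  eq : ∀ d → 1 ℕ.* (1 ℕ.* suc d) ≡ suc d ℕ.* 1 ℕ.* 1
  eq d = trans (ℕ.*-identityˡ _) (trans (ℕ.*-identityˡ _) (sym (trans (ℕ.*-identityʳ _) (ℕ.*-identityʳ _))))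
archimedean {mkℚᵘ (+ zero) d} (ℚ.*<* (ℤ.+<+ ()))
archimedean {mkℚᵘ (ℤ.-[1+ n ]) d} (ℚ.*<* ())

pow : ℚᵘ → ℕ → ℚᵘ
pow q zero    = 1ℚᵘ
pow q (suc n) = q ℚ.* pow q n

0≤power : ∀ {q} n → 0ℚᵘ ℚ.≤ q → 0ℚᵘ ℚ.≤ pow q n
0≤power zero    0≤q = ℚ.<⇒≤ (ℚ.positive⁻¹ 1ℚᵘ)
0≤power (suc n) 0≤q = 0≤* 0≤q (0≤power n 0≤q)

power-≤1 : ∀ {q} n → 0ℚᵘ ℚ.≤ q → q ℚ.≤ 1ℚᵘ → pow q n ℚ.≤ 1ℚᵘ
power-≤1 zero    0≤q q≤1 = ℚ.≤-refl
power-≤1 (suc n) 0≤q q≤1 = *-mono 0≤q (0≤power n 0≤q) q≤1 (power-≤1 n 0≤q q≤1)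

power-mono : ∀ {p q} n → 0ℚᵘ ℚ.≤ p → p ℚ.≤ q → pow p n ℚ.≤ pow q n
power-mono zero    0≤p p≤q = ℚ.≤-refl
power-mono (suc n) 0≤p p≤q = *-mono 0≤p (0≤power n 0≤p) p≤q (power-mono n 0≤p p≤q)

power-* : ∀ p q n → pow (p ℚ.* q) n ℚ.≃ pow p n ℚ.* pow q n
power-* p q zero    = ℚ.≃-refl
power-* p q (suc n) = ℚ.≃-trans (ℚ.*-congˡ {p ℚ.* q} (power-* p q n)) (eq p q (pow p n) (pow q n))
  where
  open +-*-Solver
  eq : ∀ a b c d → (a ℚ.* b) ℚ.* (c ℚ.* d) ℚ.≃ (a ℚ.* c) ℚ.* (b ℚ.* d)
  eq = solve 4 (λ a b c d → (a :* b) :* (c :* d) := (a :* c) :* (b :* d)) ℚ.≃-refl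

power-+ : ∀ q m n → pow q (m ℕ.+ n) ℚ.≃ pow q m ℚ.* pow q n
power-+ q zero    n = ℚ.≃-sym (ℚ.*-identityˡ (pow q n))
power-+ q (suc m) n = ℚ.≃-trans (ℚ.*-congˡ {q} (power-+ q m n)) (ℚ.≃-sym (ℚ.*-assoc q (pow q m) (pow q n)))

-- Bernoulli: qⁿ (1 + n (1 - q)) ≤ 1.
power-bernoulli : ∀ {q} n → 0ℚᵘ ℚ.≤ q → q ℚ.≤ 1ℚᵘ →
  pow q n ℚ.* (1ℚᵘ ℚ.+ natℚ n ℚ.* (1ℚᵘ ℚ.- q)) ℚ.≤ 1ℚᵘ
power-bernoulli {q} zero 0≤q q≤1 = ℚ.≤-reflexive (eq q)
  where
  open +-*-Solver
  eq : ∀ q → 1ℚᵘ ℚ.* (1ℚᵘ ℚ.+ 0ℚᵘ ℚ.* (1ℚᵘ ℚ.- q)) ℚ.≃ 1ℚᵘ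
  eq = solve 1 (λ q → con 1ℚᵘ :* (con 1ℚᵘ :+ con 0ℚᵘ :* (con 1ℚᵘ :- q)) := con 1ℚᵘ) ℚ.≃-refl
power-bernoulli {q} (suc n) 0≤q q≤1 = begin
  (q ℚ.* X) ℚ.* (1ℚᵘ ℚ.+ natℚ (suc n) ℚ.* δ)        ≃⟨ ℚ.*-congˡ {q ℚ.* X} (ℚ.+-congʳ 1ℚᵘ (ℚ.*-congʳ {δ} (natℚ-+ 1 n))) ⟩
  (q ℚ.* X) ℚ.* (1ℚᵘ ℚ.+ (1ℚᵘ ℚ.+ N) ℚ.* δ)           ≤⟨ ℚ.p≤p+q ((q ℚ.* X) ℚ.* (1ℚᵘ ℚ.+ (1ℚᵘ ℚ.+ N) ℚ.* δ)) ((X ℚ.* (δ ℚ.* δ)) ℚ.* (1ℚᵘ ℚ.+ N))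
                                                          {{ℚ.nonNegative (0≤* (0≤* 0≤X (0≤sq δ)) (0≤+ (ℚ.<⇒≤ (ℚ.positive⁻¹ 1ℚᵘ)) (0≤natℚ n)))}} ⟩
  (q ℚ.* X) ℚ.* (1ℚᵘ ℚ.+ (1ℚᵘ ℚ.+ N) ℚ.* δ) ℚ.+ (X ℚ.* (δ ℚ.* δ)) ℚ.* (1ℚᵘ ℚ.+ N)  ≃⟨ eq q X N ⟩
  X ℚ.* (1ℚᵘ ℚ.+ N ℚ.* δ)                             ≤⟨ power-bernoulli n 0≤q q≤1 ⟩
  1ℚᵘ                                                 ∎
  where
  open ℚ.≤-Reasoning
  X = pow q n
  N = natℚ n
  δ = 1ℚᵘ ℚ.- q
  0≤X = 0≤power n 0≤q
  open +-*-Solver using (solve; _:=_; _:+_; _:*_; _:-_; con)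
  eq : ∀ q X N → (q ℚ.* X) ℚ.* (1ℚᵘ ℚ.+ (1ℚᵘ ℚ.+ N) ℚ.* (1ℚᵘ ℚ.- q)) ℚ.+ (X ℚ.* ((1ℚᵘ ℚ.- q) ℚ.* (1ℚᵘ ℚ.- q))) ℚ.* (1ℚᵘ ℚ.+ N) ℚ.≃
                 X ℚ.* (1ℚᵘ ℚ.+ N ℚ.* (1ℚᵘ ℚ.- q))
  eq = solve 3 (λ q X N → let one = con 1ℚᵘ in
    (q :* X) :* (one :+ (one :+ N) :* (one :- q)) :+ (X :* ((one :- q) :* (one :- q))) :* (one :+ N)
    := X :* (one :+ N :* (one :- q))) ℚ.≃-refl

-- If qⁿ > ε while 1 ≤ n (1 - q) ε, then n (1 - q) qⁿ ≥ 1 and the product in Bernoulli's inequality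
-- exceeds 1.
power-vanishes : ∀ {q} → 0ℚᵘ ℚ.≤ q → q ℚ.< 1ℚᵘ → ∀ {ε} → 0ℚᵘ ℚ.< ε →
  ∃[ N ] (∀ n → N ℕ.≤ n → pow q n ℚ.≤ ε)
power-vanishes {q} 0≤q q<1 {ε} 0<ε = proj₁ arch , bound
  where
  open ℚ.≤-Reasoning
  δ = 1ℚᵘ ℚ.- q
  0<δ : 0ℚᵘ ℚ.< δ
  0<δ = ℚ.<-respˡ-≃ (ℚ.+-inverseʳ q) (ℚ.+-monoˡ-< (ℚ.- q) q<1)
  arch = archimedean (0<* 0<δ 0<ε)
  open +-*-Solver using (solve; _:=_; _:+_; _:*_; _:-_; con)
  eq : ∀ n d X → (n ℚ.* d) ℚ.* X ℚ.+ X ℚ.≃ X ℚ.* (1ℚᵘ ℚ.+ n ℚ.* d)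
  eq = solve 3 (λ n d X → (n :* d) :* X :+ X := X :* (con 1ℚᵘ :+ n :* d)) ℚ.≃-refl
  bound : ∀ n → proj₁ arch ℕ.≤ n → pow q n ℚ.≤ ε
  bound n N≤n = ℚ.≮⇒≥ λ ε<X → ℚ.<-irrefl ℚ.≃-refl (begin-strict
    1ℚᵘ                                          ≤⟨ proj₂ arch ⟩
    natℚ (proj₁ arch) ℚ.* (δ ℚ.* ε)            ≤⟨ *-monoʳ (δ ℚ.* ε) (ℚ.<⇒≤ (0<* 0<δ 0<ε)) (natℚ-mono N≤n) ⟩
    natℚ n ℚ.* (δ ℚ.* ε)                       ≃⟨ ℚ.≃-sym (ℚ.*-assoc (natℚ n) δ ε) ⟩
    (natℚ n ℚ.* δ) ℚ.* ε                       ≤⟨ *-monoˡ (natℚ n ℚ.* δ) (0≤* (0≤natℚ n) (ℚ.<⇒≤ 0<δ)) (ℚ.<⇒≤ ε<X) ⟩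
    (natℚ n ℚ.* δ) ℚ.* X n                     ≃⟨ ℚ.≃-sym (ℚ.+-identityʳ _) ⟩
    (natℚ n ℚ.* δ) ℚ.* X n ℚ.+ 0ℚᵘ             <⟨ ℚ.+-monoʳ-< ((natℚ n ℚ.* δ) ℚ.* X n) (ℚ.<-trans 0<ε ε<X) ⟩
    (natℚ n ℚ.* δ) ℚ.* X n ℚ.+ X n             ≃⟨ eq (natℚ n) δ (X n) ⟩
    X n ℚ.* (1ℚᵘ ℚ.+ natℚ n ℚ.* δ)             ≤⟨ power-bernoulli n 0≤q (ℚ.<⇒≤ q<1) ⟩
    1ℚᵘ                                          ∎)
    where X = pow q

-- Gaussian rationals

ℚ[i] : Set
ℚ[i] = ℚᵘ × ℚᵘ

infix 4 _∼_
_∼_ : ℚ[i] → ℚ[i] → Set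
(x , y) ∼ (u , v) = (x ℚ.≃ u) × (y ℚ.≃ v)

∼-trans : ∀ {z w u} → z ∼ w → w ∼ u → z ∼ u
∼-trans (a , b) (c , d) = ℚ.≃-trans a c , ℚ.≃-trans b d

∼-sym : ∀ {z w} → z ∼ w → w ∼ z
∼-sym (a , b) = ℚ.≃-sym a , ℚ.≃-sym b

∼-refl : ∀ {z} → z ∼ z
∼-refl = ℚ.≃-refl , ℚ.≃-refl

infixl 6 _+ᵍ_ _-ᵍ_
infixl 7 _*ᵍ_
_+ᵍ_ _-ᵍ_ _*ᵍ_ : ℚ[i] → ℚ[i] → ℚ[i]
(x , y) +ᵍ (u , v) = x ℚ.+ u , y ℚ.+ v
(x , y) -ᵍ (u , v) = x ℚ.- u , y ℚ.- v
(x , y) *ᵍ (u , v) = x ℚ.* u ℚ.+ ℚ.- (y ℚ.* v) , x ℚ.* v ℚ.+ y ℚ.* u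

ratᵍ : ℚᵘ → ℚ[i]
ratᵍ c = c , 0ℚᵘ

intᵍ : ℤ → ℚ[i]
intᵍ c = ratᵍ (c ℚ./ 1)

+ᵍ-cong : ∀ {z z′ w w′} → z ∼ z′ → w ∼ w′ → z +ᵍ w ∼ z′ +ᵍ w′
+ᵍ-cong (a , b) (c , d) = ℚ.+-cong a c , ℚ.+-cong b d

*ᵍ-congˡ : ∀ z {w w′} → w ∼ w′ → z *ᵍ w ∼ z *ᵍ w′
*ᵍ-congˡ (x , y) (c , d) =
  ℚ.+-cong (ℚ.*-congˡ {x} c) (ℚ.-‿cong (ℚ.*-congˡ {y} d)) ,
  ℚ.+-cong (ℚ.*-congˡ {x} d) (ℚ.*-congˡ {y} c)

norm² : ℚ[i] → ℚᵘ
norm² (x , y) = x ℚ.* x ℚ.+ y ℚ.* y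

norm²-cong : ∀ {z w} → z ∼ w → norm² z ℚ.≃ norm² w
norm²-cong (a , b) = ℚ.+-cong (ℚ.*-cong a a) (ℚ.*-cong b b)

norm²-* : ∀ z w → norm² (z *ᵍ w) ℚ.≃ norm² z ℚ.* norm² w
norm²-* (x , y) (u , v) = eq x y u v
  where
  open +-*-Solver
  eq : ∀ x y u v → norm² ((x , y) *ᵍ (u , v)) ℚ.≃ norm² (x , y) ℚ.* norm² (u , v)
  eq = solve 4 (λ x y u v →
    (x :* u :+ :- (y :* v)) :* (x :* u :+ :- (y :* v)) :+ (x :* v :+ y :* u) :* (x :* v :+ y :* u)
    := (x :* x :+ y :* y) :* (u :* u :+ v :* v)) ℚ.≃-refl

0≤norm² : ∀ z → 0ℚᵘ ℚ.≤ norm² z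
0≤norm² (x , y) = 0≤+ (0≤sq x) (0≤sq y)

-- ∣ z ∣ ≤ a, stated without square roots.
infix 4 ∥_∥≤_
record ∥_∥≤_ (z : ℚ[i]) (a : ℚᵘ) : Set where
  constructor bound
  field
    nonneg : 0ℚᵘ ℚ.≤ a
    square : norm² z ℚ.≤ sq a
open ∥_∥≤_

∥∥-cong : ∀ {z w a} → z ∼ w → ∥ z ∥≤ a → ∥ w ∥≤ a
∥∥-cong eq (bound 0≤a h) = bound 0≤a (ℚ.≤-respˡ-≃ (norm²-cong eq) h)

∥∥-weaken : ∀ {z a b} → a ℚ.≤ b → ∥ z ∥≤ a → ∥ z ∥≤ b
∥∥-weaken a≤b (bound 0≤a h) = bound (ℚ.≤-trans 0≤a a≤b) (ℚ.≤-trans h (*-mono 0≤a 0≤a a≤b a≤b))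

∥∥-rat : ∀ {c a} → ∣ c ∣ ℚ.≤ a → ∥ ratᵍ c ∥≤ a
∥∥-rat {c} {a} h = bound 0≤a (begin
  c ℚ.* c ℚ.+ 0ℚᵘ ℚ.* 0ℚᵘ  ≃⟨ eq c ⟩
  c ℚ.* c                  ≤⟨ p≤∣p∣ (c ℚ.* c) ⟩
  ∣ c ℚ.* c ∣              ≃⟨ ℚ.∣p*q∣≃∣p∣*∣q∣ c c ⟩
  ∣ c ∣ ℚ.* ∣ c ∣          ≤⟨ *-mono (ℚ.0≤∣p∣ c) (ℚ.0≤∣p∣ c) h h ⟩
  sq a                     ∎)
  where
  open ℚ.≤-Reasoning
  0≤a = ℚ.≤-trans (ℚ.0≤∣p∣ c) h
  open +-*-Solver using (solve; _:=_; _:+_; _:*_; con)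
  eq : ∀ c → c ℚ.* c ℚ.+ 0ℚᵘ ℚ.* 0ℚᵘ ℚ.≃ c ℚ.* c
  eq = solve 1 (λ c → c :* c :+ con 0ℚᵘ :* con 0ℚᵘ := c :* c) ℚ.≃-refl

∥∥-* : ∀ {z w a b} → ∥ z ∥≤ a → ∥ w ∥≤ b → ∥ z *ᵍ w ∥≤ a ℚ.* b
∥∥-* {z} {w} {a} {b} (bound 0≤a h) (bound 0≤b h′) = bound (0≤* 0≤a 0≤b) (begin
  norm² (z *ᵍ w)          ≃⟨ norm²-* z w ⟩
  norm² z ℚ.* norm² w     ≤⟨ *-mono (0≤norm² z) (0≤norm² w) h h′ ⟩
  sq a ℚ.* sq b           ≃⟨ eq a b ⟩
  sq (a ℚ.* b)            ∎)
  where
  open ℚ.≤-Reasoning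
  open +-*-Solver using (solve; _:=_; _:+_; _:*_; con)
  eq : ∀ a b → sq a ℚ.* sq b ℚ.≃ sq (a ℚ.* b)
  eq = solve 2 (λ a b → (a :* a) :* (b :* b) := (a :* b) :* (a :* b)) ℚ.≃-refl

-- The triangle inequality, by Lagrange's identity (xu + yv)² + (xv - yu)² = ∣z∣²∣w∣².
∥∥-+ : ∀ {z w a b} → ∥ z ∥≤ a → ∥ w ∥≤ b → ∥ z +ᵍ w ∥≤ a ℚ.+ b
∥∥-+ {x , y} {u , v} {a} {b} (bound 0≤a h) (bound 0≤b h′) = bound (0≤+ 0≤a 0≤b) (begin
  norm² ((x , y) +ᵍ (u , v))                            ≃⟨ eq x y u v ⟩
  (norm² (x , y) ℚ.+ norm² (u , v)) ℚ.+ (ip ℚ.+ ip)     ≤⟨ ℚ.+-mono-≤ (ℚ.+-mono-≤ h h′) (ℚ.+-mono-≤ ip≤ ip≤) ⟩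
  (sq a ℚ.+ sq b) ℚ.+ (a ℚ.* b ℚ.+ a ℚ.* b)             ≃⟨ eq₂ a b ⟩
  sq (a ℚ.+ b)                                          ∎)
  where
  open ℚ.≤-Reasoning
  ip = x ℚ.* u ℚ.+ y ℚ.* v
  op = x ℚ.* v ℚ.- y ℚ.* u
  open +-*-Solver using (solve; _:=_; _:+_; _:*_; _:-_; con)
  eq : ∀ x y u v → norm² ((x , y) +ᵍ (u , v)) ℚ.≃
    (norm² (x , y) ℚ.+ norm² (u , v)) ℚ.+ ((x ℚ.* u ℚ.+ y ℚ.* v) ℚ.+ (x ℚ.* u ℚ.+ y ℚ.* v))
  eq = solve 4 (λ x y u v → (x :+ u) :* (x :+ u) :+ (y :+ v) :* (y :+ v) :=
    ((x :* x :+ y :* y) :+ (u :* u :+ v :* v)) :+ ((x :* u :+ y :* v) :+ (x :* u :+ y :* v))) ℚ.≃-refl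
  eq₂ : ∀ a b → (sq a ℚ.+ sq b) ℚ.+ (a ℚ.* b ℚ.+ a ℚ.* b) ℚ.≃ sq (a ℚ.+ b)
  eq₂ = solve 2 (λ a b → (a :* a :+ b :* b) :+ (a :* b :+ a :* b) := (a :+ b) :* (a :+ b)) ℚ.≃-refl
  lagrange : ∀ x y u v → sq (x ℚ.* u ℚ.+ y ℚ.* v) ℚ.+ sq (x ℚ.* v ℚ.- y ℚ.* u) ℚ.≃ norm² (x , y) ℚ.* norm² (u , v)
  lagrange = solve 4 (λ x y u v →
    (x :* u :+ y :* v) :* (x :* u :+ y :* v) :+ (x :* v :- y :* u) :* (x :* v :- y :* u) :=
    (x :* x :+ y :* y) :* (u :* u :+ v :* v)) ℚ.≃-refl
  eq₃ : ∀ a b → sq a ℚ.* sq b ℚ.≃ sq (a ℚ.* b)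
  eq₃ = solve 2 (λ a b → (a :* a) :* (b :* b) := (a :* b) :* (a :* b)) ℚ.≃-refl
  ip≤ : ip ℚ.≤ a ℚ.* b
  ip≤ = sq-cancel-≤ (0≤* 0≤a 0≤b) (begin
    sq ip                                ≤⟨ ℚ.p≤p+q (sq ip) (sq op) {{ℚ.nonNegative (0≤sq op)}} ⟩
    sq ip ℚ.+ sq op                      ≃⟨ lagrange x y u v ⟩
    norm² (x , y) ℚ.* norm² (u , v)      ≤⟨ *-mono (0≤norm² (x , y)) (0≤norm² (u , v)) h h′ ⟩
    sq a ℚ.* sq b                        ≃⟨ eq₃ a b ⟩
    sq (a ℚ.* b)                         ∎)

∥∥-minus : ∀ {z w a b} → ∥ z ∥≤ a → ∥ w ∥≤ b → ∥ z -ᵍ w ∥≤ a ℚ.+ b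
∥∥-minus {z} {u , v} hz (bound 0≤b h) =
  ∥∥-+ {z} {ℚ.- u , ℚ.- v} hz (bound 0≤b (ℚ.≤-respˡ-≃ (eq u v) h))
  where
  open +-*-Solver
  eq : ∀ u v → norm² (u , v) ℚ.≃ norm² (ℚ.- u , ℚ.- v)
  eq = solve 2 (λ u v → u :* u :+ v :* v := (:- u) :* (:- u) :+ (:- v) :* (:- v)) ℚ.≃-refl

∥∥⇒re : ∀ {x y a} → ∥ x , y ∥≤ a → ∣ x ∣ ℚ.≤ a
∥∥⇒re {x} {y} (bound 0≤a h) = ∣∣≤-sq 0≤a (ℚ.≤-trans (ℚ.p≤p+q (sq x) (sq y) {{ℚ.nonNegative (0≤sq y)}}) h)

∥∥⇒im : ∀ {x y a} → ∥ x , y ∥≤ a → ∣ y ∣ ℚ.≤ a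
∥∥⇒im {x} {y} (bound 0≤a h) = ∣∣≤-sq 0≤a (ℚ.≤-trans (ℚ.p≤q+p (sq y) (sq x) {{ℚ.nonNegative (0≤sq x)}}) h)

∥∥-fromParts : ∀ {x y a} → ∣ x ∣ ℚ.≤ a → ∣ y ∣ ℚ.≤ a → ∥ x , y ∥≤ a ℚ.+ a
∥∥-fromParts {x} {y} {a} hx hy = ∥∥-cong {ratᵍ x +ᵍ iy} {x , y} (ℚ.+-identityʳ x , ℚ.+-identityˡ y)
  (∥∥-+ {ratᵍ x} {iy} (∥∥-rat hx) (bound (nonneg ry) (ℚ.≤-respˡ-≃ (ℚ.+-comm (sq y) (sq 0ℚᵘ)) (square ry))))
  where
  iy = 0ℚᵘ , y
  ry = ∥∥-rat {y} hy

-- Polynomials at Gaussian rationals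

-- The n-th approximation to evaluate P z, for the n-th approximation (x , y) to z.
eval : Polynomial → ℚ[i] → ℚ[i]
eval []      z = 0ℚᵘ , 0ℚᵘ
eval (c ∷ P) z = intᵍ c +ᵍ z *ᵍ eval P z

evalℚ : Polynomial → ℚᵘ → ℚᵘ
evalℚ []      x = 0ℚᵘ
evalℚ (c ∷ P) x = c ℚ./ 1 ℚ.+ x ℚ.* evalℚ P x

eval-real : ∀ P x → eval P (ratᵍ x) ∼ ratᵍ (evalℚ P x)
eval-real []      x = ∼-refl
eval-real (c ∷ P) x with a , b ← eval-real P x =
  ℚ.+-congʳ (c ℚ./ 1) (ℚ.≃-trans (ℚ.+-cong (ℚ.*-congˡ {x} a) (ℚ.-‿cong (ℚ.*-congˡ {0ℚᵘ} b))) (eq x (evalℚ P x))) ,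
  ℚ.≃-trans (ℚ.+-congʳ 0ℚᵘ (ℚ.+-cong (ℚ.*-congˡ {x} b) (ℚ.*-congˡ {0ℚᵘ} a))) (eq′ x (evalℚ P x))
  where
  open +-*-Solver
  eq : ∀ x p → x ℚ.* p ℚ.+ ℚ.- (0ℚᵘ ℚ.* 0ℚᵘ) ℚ.≃ x ℚ.* p
  eq = solve 2 (λ x p → x :* p :+ :- (con 0ℚᵘ :* con 0ℚᵘ) := x :* p) ℚ.≃-refl
  eq′ : ∀ x p → 0ℚᵘ ℚ.+ (x ℚ.* 0ℚᵘ ℚ.+ 0ℚᵘ ℚ.* p) ℚ.≃ 0ℚᵘ
  eq′ = solve 2 (λ x p → con 0ℚᵘ :+ (x :* con 0ℚᵘ :+ con 0ℚᵘ :* p) := con 0ℚᵘ) ℚ.≃-refl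

/1-+ : ∀ a b → (a ℤ.+ b) ℚ./ 1 ℚ.≃ a ℚ./ 1 ℚ.+ b ℚ./ 1
/1-+ a b = ℚ.*≡* (cong (ℤ._* + 1) (sym (cong₂ ℤ._+_ (ℤ.*-identityʳ a) (ℤ.*-identityʳ b))))

/1-* : ∀ a b → (a ℤ.* b) ℚ./ 1 ℚ.≃ (a ℚ./ 1) ℚ.* (b ℚ./ 1)
/1-* a b = ℚ.*≡* refl

evalℚ-⊕ : ∀ P Q x → evalℚ (P ⊕ Q) x ℚ.≃ evalℚ P x ℚ.+ evalℚ Q x
evalℚ-⊕ []      Q       x = ℚ.≃-sym (ℚ.+-identityˡ (evalℚ Q x))
evalℚ-⊕ (a ∷ P) []      x = ℚ.≃-sym (ℚ.+-identityʳ (evalℚ (a ∷ P) x))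
evalℚ-⊕ (a ∷ P) (b ∷ Q) x = ℚ.≃-trans (ℚ.+-cong (/1-+ a b) (ℚ.*-congˡ {x} (evalℚ-⊕ P Q x)))
  (eq (a ℚ./ 1) (b ℚ./ 1) x (evalℚ P x) (evalℚ Q x))
  where
  open +-*-Solver
  eq : ∀ a b x p q → (a ℚ.+ b) ℚ.+ x ℚ.* (p ℚ.+ q) ℚ.≃ (a ℚ.+ x ℚ.* p) ℚ.+ (b ℚ.+ x ℚ.* q)
  eq = solve 5 (λ a b x p q → (a :+ b) :+ x :* (p :+ q) := (a :+ x :* p) :+ (b :+ x :* q)) ℚ.≃-refl

evalℚ-⊙ : ∀ c P x → evalℚ (c ⊙ P) x ℚ.≃ c ℚ./ 1 ℚ.* evalℚ P x
evalℚ-⊙ c []      x = ℚ.≃-sym (ℚ.*-zeroʳ (c ℚ./ 1))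
evalℚ-⊙ c (a ∷ P) x = ℚ.≃-trans (ℚ.+-cong (/1-* c a) (ℚ.*-congˡ {x} (evalℚ-⊙ c P x)))
  (eq (c ℚ./ 1) (a ℚ./ 1) x (evalℚ P x))
  where
  open +-*-Solver
  eq : ∀ c a x p → c ℚ.* a ℚ.+ x ℚ.* (c ℚ.* p) ℚ.≃ c ℚ.* (a ℚ.+ x ℚ.* p)
  eq = solve 4 (λ c a x p → c :* a :+ x :* (c :* p) := c :* (a :+ x :* p)) ℚ.≃-refl

eval-⊕ : ∀ P Q z → eval (P ⊕ Q) z ∼ eval P z +ᵍ eval Q z
eval-⊕ []      Q       z = ∼-sym (ℚ.+-identityˡ _ , ℚ.+-identityˡ _)
eval-⊕ (a ∷ P) []      z = ∼-sym (ℚ.+-identityʳ _ , ℚ.+-identityʳ _)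
eval-⊕ (a ∷ P) (b ∷ Q) z@(x , y) = ∼-trans
  (+ᵍ-cong {intᵍ (a ℤ.+ b)} {intᵍ a +ᵍ intᵍ b} (/1-+ a b , ℚ.≃-sym (ℚ.+-identityˡ 0ℚᵘ)) (*ᵍ-congˡ z (eval-⊕ P Q z)))
  (let p , p′ = eval P z ; q , q′ = eval Q z in
   eq (a ℚ./ 1) (b ℚ./ 1) x y p p′ q q′ , eq′ 0ℚᵘ 0ℚᵘ x y p p′ q q′)
  where
  open +-*-Solver
  eq : ∀ a b x y p p′ q q′ →
    (a ℚ.+ b) ℚ.+ (x ℚ.* (p ℚ.+ q) ℚ.+ ℚ.- (y ℚ.* (p′ ℚ.+ q′))) ℚ.≃
    (a ℚ.+ (x ℚ.* p ℚ.+ ℚ.- (y ℚ.* p′))) ℚ.+ (b ℚ.+ (x ℚ.* q ℚ.+ ℚ.- (y ℚ.* q′)))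
  eq = solve 8 (λ a b x y p p′ q q′ → (a :+ b) :+ (x :* (p :+ q) :+ :- (y :* (p′ :+ q′))) :=
    (a :+ (x :* p :+ :- (y :* p′))) :+ (b :+ (x :* q :+ :- (y :* q′)))) ℚ.≃-refl
  eq′ : ∀ a b x y p p′ q q′ →
    (a ℚ.+ b) ℚ.+ (x ℚ.* (p′ ℚ.+ q′) ℚ.+ y ℚ.* (p ℚ.+ q)) ℚ.≃
    (a ℚ.+ (x ℚ.* p′ ℚ.+ y ℚ.* p)) ℚ.+ (b ℚ.+ (x ℚ.* q′ ℚ.+ y ℚ.* q))
  eq′ = solve 8 (λ a b x y p p′ q q′ → (a :+ b) :+ (x :* (p′ :+ q′) :+ y :* (p :+ q)) :=
    (a :+ (x :* p′ :+ y :* p)) :+ (b :+ (x :* q′ :+ y :* q))) ℚ.≃-refl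

eval-⊙ : ∀ c P z → eval (c ⊙ P) z ∼ intᵍ c *ᵍ eval P z
eval-⊙ c []      z = ∼-sym (eq (c ℚ./ 1) , eq′ (c ℚ./ 1))
  where
  open +-*-Solver
  eq : ∀ c → c ℚ.* 0ℚᵘ ℚ.+ ℚ.- (0ℚᵘ ℚ.* 0ℚᵘ) ℚ.≃ 0ℚᵘ
  eq = solve 1 (λ c → c :* con 0ℚᵘ :+ :- (con 0ℚᵘ :* con 0ℚᵘ) := con 0ℚᵘ) ℚ.≃-refl
  eq′ : ∀ c → c ℚ.* 0ℚᵘ ℚ.+ 0ℚᵘ ℚ.* 0ℚᵘ ℚ.≃ 0ℚᵘ
  eq′ = solve 1 (λ c → c :* con 0ℚᵘ :+ con 0ℚᵘ :* con 0ℚᵘ := con 0ℚᵘ) ℚ.≃-refl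
eval-⊙ c (a ∷ P) z@(x , y) = ∼-trans
  (+ᵍ-cong {intᵍ (c ℤ.* a)} {(c ℚ./ 1) ℚ.* (a ℚ./ 1) , 0ℚᵘ} (/1-* c a , ℚ.≃-refl) (*ᵍ-congˡ z (eval-⊙ c P z)))
  (let p , p′ = eval P z in eq (c ℚ./ 1) (a ℚ./ 1) x y p p′ , eq′ (c ℚ./ 1) (a ℚ./ 1) x y p p′)
  where
  open +-*-Solver
  eq : ∀ c a x y p p′ →
    c ℚ.* a ℚ.+ (x ℚ.* (c ℚ.* p ℚ.+ ℚ.- (0ℚᵘ ℚ.* p′)) ℚ.+ ℚ.- (y ℚ.* (c ℚ.* p′ ℚ.+ 0ℚᵘ ℚ.* p))) ℚ.≃
    c ℚ.* (a ℚ.+ (x ℚ.* p ℚ.+ ℚ.- (y ℚ.* p′))) ℚ.+ ℚ.- (0ℚᵘ ℚ.* (0ℚᵘ ℚ.+ (x ℚ.* p′ ℚ.+ y ℚ.* p)))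
  eq = solve 6 (λ c a x y p p′ → let o = con 0ℚᵘ in
    c :* a :+ (x :* (c :* p :+ :- (o :* p′)) :+ :- (y :* (c :* p′ :+ o :* p))) :=
    c :* (a :+ (x :* p :+ :- (y :* p′))) :+ :- (o :* (o :+ (x :* p′ :+ y :* p)))) ℚ.≃-refl
  eq′ : ∀ c a x y p p′ →
    0ℚᵘ ℚ.+ (x ℚ.* (c ℚ.* p′ ℚ.+ 0ℚᵘ ℚ.* p) ℚ.+ y ℚ.* (c ℚ.* p ℚ.+ ℚ.- (0ℚᵘ ℚ.* p′))) ℚ.≃
    c ℚ.* (0ℚᵘ ℚ.+ (x ℚ.* p′ ℚ.+ y ℚ.* p)) ℚ.+ 0ℚᵘ ℚ.* (a ℚ.+ (x ℚ.* p ℚ.+ ℚ.- (y ℚ.* p′)))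
  eq′ = solve 6 (λ c a x y p p′ → let o = con 0ℚᵘ in
    o :+ (x :* (c :* p′ :+ o :* p) :+ y :* (c :* p :+ :- (o :* p′))) :=
    c :* (o :+ (x :* p′ :+ y :* p)) :+ o :* (a :+ (x :* p :+ :- (y :* p′)))) ℚ.≃-refl

eval-⊛ : ∀ P Q z → eval (P ⊛ Q) z ∼ eval P z *ᵍ eval Q z
eval-⊛ []      Q z = ∼-sym (let q , q′ = eval Q z in eq q q′ , eq′ q q′)
  where
  open +-*-Solver
  eq : ∀ q q′ → 0ℚᵘ ℚ.* q ℚ.+ ℚ.- (0ℚᵘ ℚ.* q′) ℚ.≃ 0ℚᵘ
  eq = solve 2 (λ q q′ → con 0ℚᵘ :* q :+ :- (con 0ℚᵘ :* q′) := con 0ℚᵘ) ℚ.≃-refl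
  eq′ : ∀ q q′ → 0ℚᵘ ℚ.* q′ ℚ.+ 0ℚᵘ ℚ.* q ℚ.≃ 0ℚᵘ
  eq′ = solve 2 (λ q q′ → con 0ℚᵘ :* q′ :+ con 0ℚᵘ :* q := con 0ℚᵘ) ℚ.≃-refl
eval-⊛ (a ∷ P) Q z@(x , y) = ∼-trans (eval-⊕ (a ⊙ Q) (0ℤ ∷ P ⊛ Q) z) (∼-trans
  (+ᵍ-cong (eval-⊙ a Q z) (+ᵍ-cong {intᵍ 0ℤ} {0ℚᵘ , 0ℚᵘ} ∼-refl (*ᵍ-congˡ z (eval-⊛ P Q z))))
  (let p , p′ = eval P z ; q , q′ = eval Q z in eq (a ℚ./ 1) x y p p′ q q′ , eq′ (a ℚ./ 1) x y p p′ q q′))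
  where
  open +-*-Solver
  eq : ∀ a x y p p′ q q′ →
    (a ℚ.* q ℚ.+ ℚ.- (0ℚᵘ ℚ.* q′)) ℚ.+ (0ℚᵘ ℚ.+ (x ℚ.* (p ℚ.* q ℚ.+ ℚ.- (p′ ℚ.* q′)) ℚ.+ ℚ.- (y ℚ.* (p ℚ.* q′ ℚ.+ p′ ℚ.* q)))) ℚ.≃
    (a ℚ.+ (x ℚ.* p ℚ.+ ℚ.- (y ℚ.* p′))) ℚ.* q ℚ.+ ℚ.- ((0ℚᵘ ℚ.+ (x ℚ.* p′ ℚ.+ y ℚ.* p)) ℚ.* q′)
  eq = solve 7 (λ a x y p p′ q q′ → let o = con 0ℚᵘ in
    (a :* q :+ :- (o :* q′)) :+ (o :+ (x :* (p :* q :+ :- (p′ :* q′)) :+ :- (y :* (p :* q′ :+ p′ :* q)))) :=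
    (a :+ (x :* p :+ :- (y :* p′))) :* q :+ :- ((o :+ (x :* p′ :+ y :* p)) :* q′)) ℚ.≃-refl
  eq′ : ∀ a x y p p′ q q′ →
    (a ℚ.* q′ ℚ.+ 0ℚᵘ ℚ.* q) ℚ.+ (0ℚᵘ ℚ.+ (x ℚ.* (p ℚ.* q′ ℚ.+ p′ ℚ.* q) ℚ.+ y ℚ.* (p ℚ.* q ℚ.+ ℚ.- (p′ ℚ.* q′)))) ℚ.≃
    (a ℚ.+ (x ℚ.* p ℚ.+ ℚ.- (y ℚ.* p′))) ℚ.* q′ ℚ.+ (0ℚᵘ ℚ.+ (x ℚ.* p′ ℚ.+ y ℚ.* p)) ℚ.* q
  eq′ = solve 7 (λ a x y p p′ q q′ → let o = con 0ℚᵘ in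
    (a :* q′ :+ o :* q) :+ (o :+ (x :* (p :* q′ :+ p′ :* q) :+ y :* (p :* q :+ :- (p′ :* q′)))) :=
    (a :+ (x :* p :+ :- (y :* p′))) :* q′ :+ (o :+ (x :* p′ :+ y :* p)) :* q) ℚ.≃-refl

-- The divided difference (P(w) - P(z)) / (w - z), written without division so that it also makes
-- sense for w = z.
quotient : Polynomial → ℚ[i] → ℚ[i] → ℚ[i]
quotient []      w z = 0ℚᵘ , 0ℚᵘ
quotient (c ∷ P) w z = eval P w +ᵍ z *ᵍ quotient P w z

eval-difference : ∀ P w z → eval P w -ᵍ eval P z ∼ (w -ᵍ z) *ᵍ quotient P w z
eval-difference []      (x , y) (u , v) = eq x y u v , eq′ x y u v
  where
  open +-*-Solver
  eq : ∀ x y u v → 0ℚᵘ ℚ.- 0ℚᵘ ℚ.≃ (x ℚ.- u) ℚ.* 0ℚᵘ ℚ.+ ℚ.- ((y ℚ.- v) ℚ.* 0ℚᵘ)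
  eq = solve 4 (λ x y u v → con 0ℚᵘ :- con 0ℚᵘ := (x :- u) :* con 0ℚᵘ :+ :- ((y :- v) :* con 0ℚᵘ)) ℚ.≃-refl
  eq′ : ∀ x y u v → 0ℚᵘ ℚ.- 0ℚᵘ ℚ.≃ (x ℚ.- u) ℚ.* 0ℚᵘ ℚ.+ (y ℚ.- v) ℚ.* 0ℚᵘ
  eq′ = solve 4 (λ x y u v → con 0ℚᵘ :- con 0ℚᵘ := (x :- u) :* con 0ℚᵘ :+ (y :- v) :* con 0ℚᵘ) ℚ.≃-refl
eval-difference (c ∷ P) w@(x , y) z@(u , v) = let p , p′ = eval P w ; q , q′ = eval P z ; d , d′ = quotient P w z in
  ∼-trans (eq (c ℚ./ 1) x y u v p p′ q q′ , eq′ 0ℚᵘ x y u v p p′ q q′)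
  (∼-trans (+ᵍ-cong {(w -ᵍ z) *ᵍ eval P w} ∼-refl (*ᵍ-congˡ z (eval-difference P w z)))
  (eq₂ x y u v p p′ d d′ , eq₂′ x y u v p p′ d d′))
  where
  open +-*-Solver
  eq : ∀ c x y u v p p′ q q′ →
    (c ℚ.+ (x ℚ.* p ℚ.+ ℚ.- (y ℚ.* p′))) ℚ.- (c ℚ.+ (u ℚ.* q ℚ.+ ℚ.- (v ℚ.* q′))) ℚ.≃
    ((x ℚ.- u) ℚ.* p ℚ.+ ℚ.- ((y ℚ.- v) ℚ.* p′)) ℚ.+ (u ℚ.* (p ℚ.- q) ℚ.+ ℚ.- (v ℚ.* (p′ ℚ.- q′)))
  eq = solve 9 (λ c x y u v p p′ q q′ →
    (c :+ (x :* p :+ :- (y :* p′))) :- (c :+ (u :* q :+ :- (v :* q′))) :=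
    ((x :- u) :* p :+ :- ((y :- v) :* p′)) :+ (u :* (p :- q) :+ :- (v :* (p′ :- q′)))) ℚ.≃-refl
  eq′ : ∀ c x y u v p p′ q q′ →
    (c ℚ.+ (x ℚ.* p′ ℚ.+ y ℚ.* p)) ℚ.- (c ℚ.+ (u ℚ.* q′ ℚ.+ v ℚ.* q)) ℚ.≃
    ((x ℚ.- u) ℚ.* p′ ℚ.+ (y ℚ.- v) ℚ.* p) ℚ.+ (u ℚ.* (p′ ℚ.- q′) ℚ.+ v ℚ.* (p ℚ.- q))
  eq′ = solve 9 (λ c x y u v p p′ q q′ →
    (c :+ (x :* p′ :+ y :* p)) :- (c :+ (u :* q′ :+ v :* q)) :=
    ((x :- u) :* p′ :+ (y :- v) :* p) :+ (u :* (p′ :- q′) :+ v :* (p :- q))) ℚ.≃-refl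
  eq₂ : ∀ x y u v p p′ d d′ →
    ((x ℚ.- u) ℚ.* p ℚ.+ ℚ.- ((y ℚ.- v) ℚ.* p′)) ℚ.+
      (u ℚ.* ((x ℚ.- u) ℚ.* d ℚ.+ ℚ.- ((y ℚ.- v) ℚ.* d′)) ℚ.+ ℚ.- (v ℚ.* ((x ℚ.- u) ℚ.* d′ ℚ.+ (y ℚ.- v) ℚ.* d))) ℚ.≃
    (x ℚ.- u) ℚ.* (p ℚ.+ (u ℚ.* d ℚ.+ ℚ.- (v ℚ.* d′))) ℚ.+ ℚ.- ((y ℚ.- v) ℚ.* (p′ ℚ.+ (u ℚ.* d′ ℚ.+ v ℚ.* d)))
  eq₂ = solve 8 (λ x y u v p p′ d d′ →
    ((x :- u) :* p :+ :- ((y :- v) :* p′)) :+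
      (u :* ((x :- u) :* d :+ :- ((y :- v) :* d′)) :+ :- (v :* ((x :- u) :* d′ :+ (y :- v) :* d))) :=
    (x :- u) :* (p :+ (u :* d :+ :- (v :* d′))) :+ :- ((y :- v) :* (p′ :+ (u :* d′ :+ v :* d)))) ℚ.≃-refl
  eq₂′ : ∀ x y u v p p′ d d′ →
    ((x ℚ.- u) ℚ.* p′ ℚ.+ (y ℚ.- v) ℚ.* p) ℚ.+
      (u ℚ.* ((x ℚ.- u) ℚ.* d′ ℚ.+ (y ℚ.- v) ℚ.* d) ℚ.+ v ℚ.* ((x ℚ.- u) ℚ.* d ℚ.+ ℚ.- ((y ℚ.- v) ℚ.* d′))) ℚ.≃
    (x ℚ.- u) ℚ.* (p′ ℚ.+ (u ℚ.* d′ ℚ.+ v ℚ.* d)) ℚ.+ (y ℚ.- v) ℚ.* (p ℚ.+ (u ℚ.* d ℚ.+ ℚ.- (v ℚ.* d′)))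
  eq₂′ = solve 8 (λ x y u v p p′ d d′ →
    ((x :- u) :* p′ :+ (y :- v) :* p) :+
      (u :* ((x :- u) :* d′ :+ (y :- v) :* d) :+ v :* ((x :- u) :* d :+ :- ((y :- v) :* d′))) :=
    (x :- u) :* (p′ :+ (u :* d′ :+ v :* d)) :+ (y :- v) :* (p :+ (u :* d :+ :- (v :* d′)))) ℚ.≃-refl

-- Value and derivative at R of the majorant with coefficients ∣ cᵢ ∣. By the triangle inequality
-- they bound P and its divided differences on the disc of radius R.
supBound lipschitz : Polynomial → ℚᵘ → ℚᵘ
supBound []      R = 0ℚᵘ
supBound (c ∷ P) R = ∣ c ℚ./ 1 ∣ ℚ.+ R ℚ.* supBound P R
lipschitz []      R = 0ℚᵘ
lipschitz (c ∷ P) R = supBound P R ℚ.+ R ℚ.* lipschitz P R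

eval-bound : ∀ P {R z} → ∥ z ∥≤ R → ∥ eval P z ∥≤ supBound P R
eval-bound []      h = bound ℚ.≤-refl (ℚ.≤-reflexive (ℚ.*≡* refl))
eval-bound (c ∷ P) {z = z} h = ∥∥-+ {intᵍ c} {z *ᵍ eval P z} (∥∥-rat {c ℚ./ 1} ℚ.≤-refl) (∥∥-* {z} {eval P z} h (eval-bound P h))

quotient-bound : ∀ P {R w z} → ∥ w ∥≤ R → ∥ z ∥≤ R → ∥ quotient P w z ∥≤ lipschitz P R
quotient-bound []      hw hz = bound ℚ.≤-refl (ℚ.≤-reflexive (ℚ.*≡* refl))
quotient-bound (c ∷ P) {w = w} {z} hw hz =
  ∥∥-+ {eval P w} {z *ᵍ quotient P w z} (eval-bound P hw) (∥∥-* {z} {quotient P w z} hz (quotient-bound P hw hz))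

-- A lower bound for ∣ B(w) - B(z) ∣ / ∣ w - z ∣ on the disc of radius R when the linear term dominates.
slope : Polynomial → ℚᵘ → ℚᵘ
slope (b₀ ∷ b₁ ∷ B) R = b₁ ℚ./ 1 ℚ.- (R ℚ.* supBound B R ℚ.+ R ℚ.* lipschitz (b₁ ∷ B) R)
slope _             R = 0ℚᵘ

-- The divided difference is b₁ plus two terms whose moduli add up to at most η. Its real part is
-- therefore at least b₁ - η ≥ 1, and so is its modulus.
eval-expansive : ∀ B {R w z δ} → 1ℚᵘ ℚ.≤ slope B R → ∥ w ∥≤ R → ∥ z ∥≤ R →
  ∥ eval B w -ᵍ eval B z ∥≤ δ → ∥ w -ᵍ z ∥≤ δ
eval-expansive []       (ℚ.*≤* (ℤ.+≤+ ()))
eval-expansive (_ ∷ []) (ℚ.*≤* (ℤ.+≤+ ()))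
eval-expansive (b₀ ∷ b₁ ∷ B) {R} {w} {z} {δ} 1≤slope hw hz (bound 0≤δ h) = bound 0≤δ (begin
  norm² (w -ᵍ z)                                          ≃⟨ ℚ.≃-sym (ℚ.*-identityʳ (norm² (w -ᵍ z))) ⟩
  norm² (w -ᵍ z) ℚ.* 1ℚᵘ                                  ≤⟨ *-monoˡ (norm² (w -ᵍ z)) (0≤norm² (w -ᵍ z)) 1≤norm² ⟩
  norm² (w -ᵍ z) ℚ.* norm² (quotient (b₀ ∷ b₁ ∷ B) w z)   ≃⟨ ℚ.≃-sym (norm²-* (w -ᵍ z) (quotient (b₀ ∷ b₁ ∷ B) w z)) ⟩
  norm² ((w -ᵍ z) *ᵍ quotient (b₀ ∷ b₁ ∷ B) w z)          ≃⟨ ℚ.≃-sym (norm²-cong (eval-difference (b₀ ∷ b₁ ∷ B) w z)) ⟩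
  norm² (eval (b₀ ∷ b₁ ∷ B) w -ᵍ eval (b₀ ∷ b₁ ∷ B) z)    ≤⟨ h ⟩
  sq δ                                                    ∎)
  where
  open ℚ.≤-Reasoning
  η = R ℚ.* supBound B R ℚ.+ R ℚ.* lipschitz (b₁ ∷ B) R
  b = b₁ ℚ./ 1
  E₁ = w *ᵍ eval B w
  E₂ = z *ᵍ quotient (b₁ ∷ B) w z
  e = proj₁ E₁ ℚ.+ proj₁ E₂
  ∣e∣≤η : ∣ e ∣ ℚ.≤ η
  ∣e∣≤η = ∥∥⇒re (∥∥-+ {E₁} {E₂} (∥∥-* {w} {eval B w} hw (eval-bound B hw))
    (∥∥-* {z} {quotient (b₁ ∷ B) w z} hz (quotient-bound (b₁ ∷ B) hw hz)))
  qre = proj₁ (quotient (b₀ ∷ b₁ ∷ B) w z)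
  qim = proj₂ (quotient (b₀ ∷ b₁ ∷ B) w z)
  open +-*-Solver using (solve; _:=_; _:+_; _:*_; _:-_; :-_; con)
  eq : ∀ b e₁ e₂ → b ℚ.- ℚ.- (e₁ ℚ.+ e₂) ℚ.≃ (b ℚ.+ e₁) ℚ.+ e₂
  eq = solve 3 (λ b e₁ e₂ → b :- (:- (e₁ :+ e₂)) := (b :+ e₁) :+ e₂) ℚ.≃-refl
  1≤qre : 1ℚᵘ ℚ.≤ qre
  1≤qre = begin
    1ℚᵘ               ≤⟨ 1≤slope ⟩
    b ℚ.- η           ≤⟨ ℚ.+-monoʳ-≤ b (ℚ.neg-mono-≤ (ℚ.≤-trans (-p≤∣p∣ e) ∣e∣≤η)) ⟩
    b ℚ.- ℚ.- e       ≃⟨ eq b (proj₁ E₁) (proj₁ E₂) ⟩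
    qre                ∎
  1≤norm² : 1ℚᵘ ℚ.≤ norm² (quotient (b₀ ∷ b₁ ∷ B) w z)
  1≤norm² = begin
    1ℚᵘ ℚ.* 1ℚᵘ       ≤⟨ *-mono (ℚ.<⇒≤ (ℚ.positive⁻¹ 1ℚᵘ)) (ℚ.<⇒≤ (ℚ.positive⁻¹ 1ℚᵘ)) 1≤qre 1≤qre ⟩
    sq qre             ≤⟨ ℚ.p≤p+q (sq qre) (sq qim) {{ℚ.nonNegative (0≤sq qim)}} ⟩
    sq qre ℚ.+ sq qim   ∎

-- Approximate zeros are treated because a complex root is given only by Gaussian rationals at which
-- Q is small. The factor `A` costs `supBound A R`; expansiveness of `A ⊛ Q` then turns small values
-- into closeness.
zeros-close : ∀ A Q {R w z δ} → 1ℚᵘ ℚ.≤ slope (A ⊛ Q) R → ∥ w ∥≤ R → ∥ z ∥≤ R →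
  ∥ eval Q w ∥≤ δ → ∥ eval Q z ∥≤ δ → ∥ w -ᵍ z ∥≤ supBound A R ℚ.* δ ℚ.+ supBound A R ℚ.* δ
zeros-close A Q {R} {w} {z} h hw hz hQw hQz = eval-expansive (A ⊛ Q) h hw hz
  (∥∥-minus {eval (A ⊛ Q) w} {eval (A ⊛ Q) z} (small hw hQw) (small hz hQz))
  where
  small : ∀ {w δ} → ∥ w ∥≤ R → ∥ eval Q w ∥≤ δ → ∥ eval (A ⊛ Q) w ∥≤ supBound A R ℚ.* δ
  small {w} hw hQ = ∥∥-cong (∼-sym (eval-⊛ A Q w)) (∥∥-* {eval A w} {eval Q w} (eval-bound A hw) hQ)

evalℚ-lipschitz : ∀ P {R x y} → ∣ x ∣ ℚ.≤ R → ∣ y ∣ ℚ.≤ R → ∣ evalℚ P x ℚ.- evalℚ P y ∣ ℚ.≤ ∣ x ℚ.- y ∣ ℚ.* lipschitz P R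
evalℚ-lipschitz P {R} {x} {y} hx hy = ∥∥⇒re {evalℚ P x ℚ.- evalℚ P y} {0ℚᵘ ℚ.- 0ℚᵘ} (∥∥-cong
  {(ratᵍ x -ᵍ ratᵍ y) *ᵍ quotient P (ratᵍ x) (ratᵍ y)}
  (∼-trans (∼-sym (eval-difference P (ratᵍ x) (ratᵍ y))) (minus (eval-real P x) (eval-real P y)))
  (∥∥-* {ratᵍ x -ᵍ ratᵍ y} {quotient P (ratᵍ x) (ratᵍ y)}
    (∥∥-cong {ratᵍ (x ℚ.- y)} (ℚ.≃-refl , ℚ.≃-refl) (∥∥-rat {x ℚ.- y} ℚ.≤-refl))
    (quotient-bound P (∥∥-rat hx) (∥∥-rat hy))))
  where
  minus : ∀ {z z′ w w′} → z ∼ z′ → w ∼ w′ → z -ᵍ w ∼ z′ -ᵍ w′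
  minus (a , b) (c , d) = ℚ.+-cong a (ℚ.-‿cong c) , ℚ.+-cong b (ℚ.-‿cong d)

-- Eigenvector inequalities at rational points

2ℚ : ℚᵘ
2ℚ = + 2 ℚ./ 1

0≤1 : 0ℚᵘ ℚ.≤ 1ℚᵘ
0≤1 = ℚ.<⇒≤ (ℚ.positive⁻¹ 1ℚᵘ)

sumℚ : List ℚᵘ → ℚᵘ
sumℚ = foldr ℚ._+_ 0ℚᵘ

sumℚ-mono : ∀ {I : Set} {u v : I → ℚᵘ} → (∀ i → u i ℚ.≤ v i) → ∀ is → sumℚ (map u is) ℚ.≤ sumℚ (map v is)
sumℚ-mono h []       = ℚ.≤-refl
sumℚ-mono h (i ∷ is) = ℚ.+-mono-≤ (h i) (sumℚ-mono h is)

sumℚ-scale : ∀ {I : Set} c (u : I → ℕ) is →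
  sumℚ (map (λ i → c ℚ.* natℚ (u i)) is) ℚ.≃ c ℚ.* natℚ (sum (map u is))
sumℚ-scale c u []       = ℚ.≃-sym (ℚ.*-zeroʳ c)
sumℚ-scale c u (i ∷ is) = begin
  c ℚ.* natℚ (u i) ℚ.+ sumℚ (map (λ i → c ℚ.* natℚ (u i)) is)  ≈⟨ ℚ.+-congʳ (c ℚ.* natℚ (u i)) (sumℚ-scale c u is) ⟩
  c ℚ.* natℚ (u i) ℚ.+ c ℚ.* natℚ (sum (map u is))             ≈⟨ ℚ.≃-sym (ℚ.*-distribˡ-+ c (natℚ (u i)) (natℚ (sum (map u is)))) ⟩
  c ℚ.* (natℚ (u i) ℚ.+ natℚ (sum (map u is)))                 ≈⟨ ℚ.*-congˡ {c} (ℚ.≃-sym (natℚ-+ (u i) (sum (map u is)))) ⟩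
  c ℚ.* natℚ (u i ℕ.+ sum (map u is))                            ∎
  where open SetoidReasoning ℚ.≃-setoid

evalℚ-zeros : ∀ N x → evalℚ (replicate N 0ℤ) x ℚ.≃ 0ℚᵘ
evalℚ-zeros zero    x = ℚ.≃-refl
evalℚ-zeros (suc N) x = ℚ.≃-trans (ℚ.+-congʳ 0ℚᵘ (ℚ.≃-trans (ℚ.*-congˡ {x} (evalℚ-zeros N x)) (ℚ.*-zeroʳ x)))
  (ℚ.+-identityˡ 0ℚᵘ)

evalℚ-≐ : ∀ N {P Q} x → P ≐[ N ] Q → evalℚ P x ℚ.≃ evalℚ Q x
evalℚ-≐ N {P} {Q} x eq = ℚ.≃-trans (ℚ.≃-sym (padded P))
  (ℚ.≃-trans (ℚ.≃-reflexive (cong (λ R → evalℚ R x) eq)) (padded Q))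
  where
  padded : ∀ R → evalℚ (R ⊕ replicate N 0ℤ) x ℚ.≃ evalℚ R x
  padded R = ℚ.≃-trans (evalℚ-⊕ R (replicate N 0ℤ) x)
    (ℚ.≃-trans (ℚ.+-congʳ (evalℚ R x) (evalℚ-zeros N x)) (ℚ.+-identityʳ (evalℚ R x)))

evalℚ-⊕-sum : ∀ {I : Set} (P : I → Polynomial) is x → evalℚ (⊕-sum (map P is)) x ℚ.≃ sumℚ (map (λ i → evalℚ (P i) x) is)
evalℚ-⊕-sum P []       x = ℚ.≃-refl
evalℚ-⊕-sum P (i ∷ is) x = ℚ.≃-trans (evalℚ-⊕ (P i) (⊕-sum (map P is)) x) (ℚ.+-congʳ (evalℚ (P i) x) (evalℚ-⊕-sum P is x))

evalℚ-head : ∀ Q x → evalℚ Q x ℚ.≃ at Q 0 ℚ./ 1 ℚ.+ x ℚ.* evalℚ (divideByX Q) x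
evalℚ-head []      x = ℚ.≃-sym (ℚ.≃-trans (ℚ.+-identityˡ _) (ℚ.*-zeroʳ x))
evalℚ-head (c ∷ Q) x = ℚ.≃-refl

-- At a zero x of Q the values P i (x) form an eigenvector of the digraph for the eigenvalue 1 / x;
-- beside it they are a super- or subsolution, according to the sign of Q(x).
module Eigenvector {F n} {E : Digraph (suc n)} (S : TransferSystem F E) where
  open TransferSystem S

  value : ℚᵘ → Fin (suc n) → ℚᵘ
  value x i = evalℚ (P i) x

  value-eq : ∀ x i → value x i ℚ.≃ evalℚ Q x ℚ.+ x ℚ.* sumℚ (map (value x) (E i))
  value-eq x i = ℚ.≃-trans (evalℚ-≐ N x (solve i)) (ℚ.≃-trans (evalℚ-⊕ Q _ x)
    (ℚ.+-congʳ (evalℚ Q x) (ℚ.≃-trans (ℚ.+-identityˡ _) (ℚ.*-congˡ {x} (evalℚ-⊕-sum P (E i) x)))))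

  weighted : ℚᵘ → ℕ → ℚᵘ → Fin (suc n) → ℚᵘ
  weighted x m c i = (c ℚ.* pow x m) ℚ.* natℚ (walkCount E m i)

  weighted-zero : ∀ x c i → weighted x 0 c i ℚ.≃ c
  weighted-zero x c i = ℚ.≃-trans (ℚ.*-identityʳ (c ℚ.* 1ℚᵘ)) (ℚ.*-identityʳ c)

  weighted-suc : ∀ x m c i → weighted x (suc m) c i ℚ.≃ x ℚ.* sumℚ (map (weighted x m c) (E i))
  weighted-suc x m c i = ℚ.≃-trans (eq c x (pow x m) (natℚ (walkCount E (suc m) i)))
    (ℚ.*-congˡ {x} (ℚ.≃-sym (sumℚ-scale (c ℚ.* pow x m) (walkCount E m) (E i))))
    where
    open +-*-Solver using (_:=_; _:*_) renaming (solve to ring)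
    eq : ∀ c x p w → (c ℚ.* (x ℚ.* p)) ℚ.* w ℚ.≃ x ℚ.* ((c ℚ.* p) ℚ.* w)
    eq = ring 4 (λ c x p w → (c :* (x :* p)) :* w := x :* ((c :* p) :* w)) ℚ.≃-refl

  -- With Q(x) ≥ 0 the vector v of values satisfies v ≥ x M v. Iterating x M from the constant
  -- vector a ≤ v keeps it below v, and the m-th iterate is a xᵐ times the walk counts. For Q(x) ≤ 0
  -- every inequality is reversed in `walks-lower`.
  walks-upper : ∀ {x a} → 0ℚᵘ ℚ.≤ x → 0ℚᵘ ℚ.≤ evalℚ Q x → (∀ i → a ℚ.≤ value x i) →
    ∀ m i → weighted x m a i ℚ.≤ value x i
  walks-upper {x} {a} 0≤x 0≤Q h zero    i = ℚ.≤-respˡ-≃ (ℚ.≃-sym (weighted-zero x a i)) (h i)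
  walks-upper {x} {a} 0≤x 0≤Q h (suc m) i = begin
    weighted x (suc m) a i                                    ≃⟨ weighted-suc x m a i ⟩
    x ℚ.* sumℚ (map (weighted x m a) (E i))                   ≤⟨ *-monoˡ x 0≤x (sumℚ-mono (walks-upper 0≤x 0≤Q h m) (E i)) ⟩
    x ℚ.* sumℚ (map (value x) (E i))                          ≤⟨ ℚ.p≤q+p _ (evalℚ Q x) {{ℚ.nonNegative 0≤Q}} ⟩
    evalℚ Q x ℚ.+ x ℚ.* sumℚ (map (value x) (E i))            ≃⟨ ℚ.≃-sym (value-eq x i) ⟩
    value x i                                                 ∎
    where open ℚ.≤-Reasoning

  walks-lower : ∀ {x b} → 0ℚᵘ ℚ.≤ x → evalℚ Q x ℚ.≤ 0ℚᵘ → (∀ i → value x i ℚ.≤ b) →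
    ∀ m i → value x i ℚ.≤ weighted x m b i
  walks-lower {x} {b} 0≤x Q≤0 h zero    i = ℚ.≤-respʳ-≃ (ℚ.≃-sym (weighted-zero x b i)) (h i)
  walks-lower {x} {b} 0≤x Q≤0 h (suc m) i = begin
    value x i                                                 ≃⟨ value-eq x i ⟩
    evalℚ Q x ℚ.+ x ℚ.* sumℚ (map (value x) (E i))            ≤⟨ ℚ.+-monoˡ-≤ _ Q≤0 ⟩
    0ℚᵘ ℚ.+ x ℚ.* sumℚ (map (value x) (E i))                  ≃⟨ ℚ.+-identityˡ _ ⟩
    x ℚ.* sumℚ (map (value x) (E i))                          ≤⟨ *-monoˡ x 0≤x (sumℚ-mono (walks-lower 0≤x Q≤0 h m) (E i)) ⟩
    x ℚ.* sumℚ (map (weighted x m b) (E i))                   ≃⟨ ℚ.≃-sym (weighted-suc x m b i) ⟩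
    weighted x (suc m) b i                                    ∎
    where open ℚ.≤-Reasoning

scale-below : ∀ {C ε} → 0ℚᵘ ℚ.≤ C → 0ℚᵘ ℚ.< ε → Σ[ δ ∈ ℚᵘ ] (0ℚᵘ ℚ.< δ × C ℚ.* δ ℚ.≤ ε)
scale-below {C} {ε} 0≤C 0<ε = δ , 0<* 0<ε (ℚ.positive⁻¹ (ℚ.1/ D)) , (begin
  C ℚ.* δ                   ≤⟨ *-monoʳ δ (ℚ.<⇒≤ (0<* 0<ε (ℚ.positive⁻¹ (ℚ.1/ D)))) (ℚ.p≤q+p C 1ℚᵘ) ⟩
  D ℚ.* (ε ℚ.* ℚ.1/ D)      ≃⟨ eq D ε (ℚ.1/ D) ⟩
  ε ℚ.* (D ℚ.* ℚ.1/ D)      ≃⟨ ℚ.*-congˡ {ε} (ℚ.*-inverseʳ D) ⟩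
  ε ℚ.* 1ℚᵘ                 ≃⟨ ℚ.*-identityʳ ε ⟩
  ε                         ∎)
  where
  open ℚ.≤-Reasoning
  -- Dividing by 1 + C instead of C covers C = 0.
  D = 1ℚᵘ ℚ.+ C
  instance
    D-pos : ℚ.Positive D
    D-pos = ℚ.positive (ℚ.<-respˡ-≃ (ℚ.+-identityˡ 0ℚᵘ) (ℚ.+-mono-<-≤ (ℚ.positive⁻¹ 1ℚᵘ) 0≤C))
    D≢0 : ℚ.NonZero D
    D≢0 = ℚ.pos⇒nonZero D
    1/D-pos : ℚ.Positive (ℚ.1/ D)
    1/D-pos = ℚ.1/pos⇒pos D
  δ = ε ℚ.* ℚ.1/ D
  open +-*-Solver using (solve; _:=_; _:*_)
  eq : ∀ d e i → d ℚ.* (e ℚ.* i) ℚ.≃ e ℚ.* (d ℚ.* i)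
  eq = solve 3 (λ d e i → d :* (e :* i) := e :* (d :* i)) ℚ.≃-refl

-- On [0 , 1] the chords of xᵐ have slope at most m.
power-gap : ∀ {l h} m → 0ℚᵘ ℚ.≤ l → l ℚ.≤ h → h ℚ.≤ 1ℚᵘ →
  pow h m ℚ.≤ pow l m ℚ.+ natℚ m ℚ.* (h ℚ.- l)
power-gap {l} {h} zero 0≤l l≤h h≤1 = ℚ.≤-reflexive (eq (h ℚ.- l))
  where
  open +-*-Solver using (solve; _:=_; _:+_; _:*_; con)
  eq : ∀ d → 1ℚᵘ ℚ.≃ 1ℚᵘ ℚ.+ 0ℚᵘ ℚ.* d
  eq = solve 1 (λ d → con 1ℚᵘ := con 1ℚᵘ :+ con 0ℚᵘ :* d) ℚ.≃-refl
power-gap {l} {h} (suc m) 0≤l l≤h h≤1 = begin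
  h ℚ.* pow h m                                        ≤⟨ *-monoˡ h 0≤h (power-gap m 0≤l l≤h h≤1) ⟩
  h ℚ.* (X ℚ.+ N ℚ.* d)                                   ≃⟨ eq h l X N ⟩
  (l ℚ.* X ℚ.+ d ℚ.* X) ℚ.+ h ℚ.* (N ℚ.* d)               ≤⟨ ℚ.+-mono-≤ (ℚ.+-monoʳ-≤ (l ℚ.* X) (*-monoˡ d 0≤d (power-≤1 m 0≤l (ℚ.≤-trans l≤h h≤1))))
                                                               (*-monoʳ (N ℚ.* d) (0≤* (0≤natℚ m) 0≤d) h≤1) ⟩
  (l ℚ.* X ℚ.+ d ℚ.* 1ℚᵘ) ℚ.+ 1ℚᵘ ℚ.* (N ℚ.* d)           ≃⟨ eq′ (l ℚ.* X) d N ⟩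
  l ℚ.* X ℚ.+ (1ℚᵘ ℚ.+ N) ℚ.* d                           ≃⟨ ℚ.+-congʳ (l ℚ.* X) (ℚ.*-congʳ {d} (ℚ.≃-sym (natℚ-+ 1 m))) ⟩
  l ℚ.* X ℚ.+ natℚ (suc m) ℚ.* d                        ∎
  where
  open ℚ.≤-Reasoning
  X = pow l m
  N = natℚ m
  d = h ℚ.- l
  0≤d = ℚ.p≤q⇒0≤q-p l≤h
  0≤h = ℚ.≤-trans 0≤l l≤h
  open +-*-Solver using (solve; _:=_; _:+_; _:*_; _:-_; con)
  eq : ∀ h l X N → h ℚ.* (X ℚ.+ N ℚ.* (h ℚ.- l)) ℚ.≃ (l ℚ.* X ℚ.+ (h ℚ.- l) ℚ.* X) ℚ.+ h ℚ.* (N ℚ.* (h ℚ.- l))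
  eq = solve 4 (λ h l X N → h :* (X :+ N :* (h :- l)) := (l :* X :+ (h :- l) :* X) :+ h :* (N :* (h :- l))) ℚ.≃-refl
  eq′ : ∀ y d N → (y ℚ.+ d ℚ.* 1ℚᵘ) ℚ.+ 1ℚᵘ ℚ.* (N ℚ.* d) ℚ.≃ y ℚ.+ (1ℚᵘ ℚ.+ N) ℚ.* d
  eq′ = solve 3 (λ y d N → (y :+ d :* con 1ℚᵘ) :+ con 1ℚᵘ :* (N :* d) := y :+ (con 1ℚᵘ :+ N) :* d) ℚ.≃-refl

-- Bisection

-- The signs at both ends are kept as an invariant, not only the convergence: upper bounds for walks
-- come from lower ends, where g ≥ 0, and lower bounds from upper ends, where g ≤ 0.
module Bisection (g : ℚᵘ → ℚᵘ) (lo hi : ℚᵘ) (lo≤hi : lo ℚ.≤ hi)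
  (g-lo : 0ℚᵘ ℚ.≤ g lo) (g-hi : g hi ℚ.≤ 0ℚᵘ) where

  midpoint : ℚᵘ × ℚᵘ → ℚᵘ
  midpoint (l , h) = ½ ℚ.* (l ℚ.+ h)

  halve : ℚᵘ × ℚᵘ → ℚᵘ × ℚᵘ
  halve (l , h) with 0ℚᵘ ℚ.≤? g (midpoint (l , h))
  ... | yes _ = midpoint (l , h) , h
  ... | no  _ = l , midpoint (l , h)

  interval : ℕ → ℚᵘ × ℚᵘ
  interval zero    = lo , hi
  interval (suc j) = halve (interval j)

  lower upper : ℕ → ℚᵘ
  lower = proj₁ ∘ interval
  upper = proj₂ ∘ interval

  record Brackets (I : ℚᵘ × ℚᵘ) : Set where
    constructor brackets
    field
      ordered : proj₁ I ℚ.≤ proj₂ I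
      g-lower : 0ℚᵘ ℚ.≤ g (proj₁ I)
      g-upper : g (proj₂ I) ℚ.≤ 0ℚᵘ
  open Brackets

  l≤mid : ∀ {l h} → l ℚ.≤ h → l ℚ.≤ midpoint (l , h)
  l≤mid {l} {h} l≤h = ℚ.≤-respˡ-≃ (ℚ.≃-trans (ℚ.*-distribˡ-+ ½ l l) (half+half l))
    (*-monoˡ ½ (ℚ.<⇒≤ (ℚ.positive⁻¹ ½)) (ℚ.+-monoʳ-≤ l l≤h))

  mid≤h : ∀ {l h} → l ℚ.≤ h → midpoint (l , h) ℚ.≤ h
  mid≤h {l} {h} l≤h = ℚ.≤-respʳ-≃ (ℚ.≃-trans (ℚ.*-distribˡ-+ ½ h h) (half+half h))
    (*-monoˡ ½ (ℚ.<⇒≤ (ℚ.positive⁻¹ ½)) (ℚ.+-monoˡ-≤ h l≤h))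

  halve-brackets : ∀ I → Brackets I → Brackets (halve I)
  halve-brackets (l , h) (brackets l≤h gl gh) with 0ℚᵘ ℚ.≤? g (midpoint (l , h))
  ... | yes 0≤g = brackets (mid≤h l≤h) 0≤g gh
  ... | no  0≰g = brackets (l≤mid l≤h) gl (ℚ.≰⇒≥ 0≰g)

  halve-nested : ∀ I → Brackets I → proj₁ I ℚ.≤ proj₁ (halve I) × proj₂ (halve I) ℚ.≤ proj₂ I
  halve-nested (l , h) (brackets l≤h _ _) with 0ℚᵘ ℚ.≤? g (midpoint (l , h))
  ... | yes _ = l≤mid l≤h , ℚ.≤-refl
  ... | no  _ = ℚ.≤-refl , mid≤h l≤h

  halve-width : ∀ I → proj₂ (halve I) ℚ.- proj₁ (halve I) ℚ.≃ ½ ℚ.* (proj₂ I ℚ.- proj₁ I)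
  halve-width (l , h) with 0ℚᵘ ℚ.≤? g (midpoint (l , h))
  ... | yes _ = eq l h
    where
    open +-*-Solver
    eq : ∀ l h → h ℚ.- ½ ℚ.* (l ℚ.+ h) ℚ.≃ ½ ℚ.* (h ℚ.- l)
    eq = solve 2 (λ l h → h :- con ½ :* (l :+ h) := con ½ :* (h :- l)) ℚ.≃-refl
  ... | no  _ = eq l h
    where
    open +-*-Solver
    eq : ∀ l h → ½ ℚ.* (l ℚ.+ h) ℚ.- l ℚ.≃ ½ ℚ.* (h ℚ.- l)
    eq = solve 2 (λ l h → con ½ :* (l :+ h) :- l := con ½ :* (h :- l)) ℚ.≃-refl

  bracketed : ∀ j → Brackets (interval j)
  bracketed zero    = brackets lo≤hi g-lo g-hi
  bracketed (suc j) = halve-brackets (interval j) (bracketed j)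

  lower≤upper : ∀ j → lower j ℚ.≤ upper j
  lower≤upper j = ordered (bracketed j)

  width : ∀ j → upper j ℚ.- lower j ℚ.≃ pow ½ j ℚ.* (hi ℚ.- lo)
  width zero    = ℚ.≃-sym (ℚ.*-identityˡ (hi ℚ.- lo))
  width (suc j) = ℚ.≃-trans (halve-width (interval j))
    (ℚ.≃-trans (ℚ.*-congˡ {½} (width j)) (ℚ.≃-sym (ℚ.*-assoc ½ (pow ½ j) (hi ℚ.- lo))))

  nested : ∀ {i j} → i ℕ.≤′ j → lower i ℚ.≤ lower j × upper j ℚ.≤ upper i
  nested ℕ.≤′-refl = ℚ.≤-refl , ℚ.≤-refl
  nested {i} (ℕ.≤′-step {j} i≤j) with a , b ← nested i≤j | c , d ← halve-nested (interval j) (bracketed j) =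
    ℚ.≤-trans a c , ℚ.≤-trans d b

  lo≤lower : ∀ j → lo ℚ.≤ lower j
  lo≤lower j = proj₁ (nested (ℕ.≤⇒≤′ {0} {j} ℕ.z≤n))

  upper≤hi : ∀ j → upper j ℚ.≤ hi
  upper≤hi j = proj₂ (nested (ℕ.≤⇒≤′ {0} {j} ℕ.z≤n))

  0≤width : ∀ j → 0ℚᵘ ℚ.≤ upper j ℚ.- lower j
  0≤width j = ℚ.p≤q⇒0≤q-p (lower≤upper j)

  width-vanishes : ∀ {C ε} → 0ℚᵘ ℚ.≤ C → 0ℚᵘ ℚ.< ε → Eventually (λ j → C ℚ.* (upper j ℚ.- lower j) ℚ.≤ ε)
  width-vanishes {C} {ε} 0≤C 0<ε =
    proj₁ vanish , λ j N≤j → begin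
    C ℚ.* (upper j ℚ.- lower j)               ≃⟨ ℚ.*-congˡ {C} (width j) ⟩
    C ℚ.* (pow ½ j ℚ.* (hi ℚ.- lo))        ≃⟨ eq C (pow ½ j) (hi ℚ.- lo) ⟩
    (C ℚ.* (hi ℚ.- lo)) ℚ.* pow ½ j        ≤⟨ *-monoˡ (C ℚ.* (hi ℚ.- lo)) (0≤* 0≤C (ℚ.p≤q⇒0≤q-p lo≤hi)) (proj₂ vanish j N≤j) ⟩
    (C ℚ.* (hi ℚ.- lo)) ℚ.* δ                 ≤⟨ proj₂ (proj₂ below) ⟩
    ε                                         ∎
    where
    below : Σ[ δ ∈ ℚᵘ ] (0ℚᵘ ℚ.< δ × (C ℚ.* (hi ℚ.- lo)) ℚ.* δ ℚ.≤ ε)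
    below = scale-below (0≤* 0≤C (ℚ.p≤q⇒0≤q-p lo≤hi)) 0<ε
    δ = proj₁ below
    vanish : Eventually (λ j → pow ½ j ℚ.≤ δ)
    vanish = power-vanishes {½} (ℚ.<⇒≤ (ℚ.positive⁻¹ ½)) (ℚ.*<* (ℤ.+<+ (ℕ.s≤s (ℕ.s≤s ℕ.z≤n)))) (proj₁ (proj₂ below))
    open ℚ.≤-Reasoning
    open +-*-Solver using (solve; _:=_; _:*_)
    eq : ∀ c p w → c ℚ.* (p ℚ.* w) ℚ.≃ (c ℚ.* w) ℚ.* p
    eq = solve 3 (λ c p w → c :* (p :* w) := (c :* w) :* p) ℚ.≃-refl

  lower-cauchy : Cauchy lower
  lower-cauchy ε 0<ε = N , λ m n N≤m N≤n → ∣∣≤ (close m n N≤m N≤n)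
    (ℚ.≤-respˡ-≃ (neg-minus (lower n) (lower m)) (close n m N≤n N≤m))
    where
    small : Eventually (λ j → 1ℚᵘ ℚ.* (upper j ℚ.- lower j) ℚ.≤ ε)
    small = width-vanishes 0≤1 0<ε
    N = proj₁ small
    open ℚ.≤-Reasoning
    open +-*-Solver using (solve; _:=_; _:-_; :-_)
    neg-minus : ∀ x y → x ℚ.- y ℚ.≃ ℚ.- (y ℚ.- x)
    neg-minus = solve 2 (λ x y → x :- y := :- (y :- x)) ℚ.≃-refl
    close : ∀ m n → N ℕ.≤ m → N ℕ.≤ n → lower m ℚ.- lower n ℚ.≤ ε
    close m n N≤m N≤n = begin
      lower m ℚ.- lower n            ≤⟨ ℚ.+-mono-≤ (ℚ.≤-trans (lower≤upper m) (proj₂ (nested (ℕ.≤⇒≤′ N≤m))))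
                                                   (ℚ.neg-mono-≤ (proj₁ (nested (ℕ.≤⇒≤′ N≤n)))) ⟩
      upper N ℚ.- lower N            ≃⟨ ℚ.≃-sym (ℚ.*-identityˡ (upper N ℚ.- lower N)) ⟩
      1ℚᵘ ℚ.* (upper N ℚ.- lower N)  ≤⟨ proj₂ small N ℕ.≤-refl ⟩
      ε                              ∎

-- From rational approximants to estimates for reals

evaluate-seq : ∀ P z j → (seq (re (evaluate P z)) j , seq (im (evaluate P z)) j) ≡ eval P (seq (re z) j , seq (im z) j)
evaluate-seq []      z j = refl
evaluate-seq (c ∷ P) z j = cong (λ u → intᵍ c +ᵍ (seq (re z) j , seq (im z) j) *ᵍ u) (evaluate-seq P z j)

^ᵣ-seq : ∀ x m j → seq (x ^ᵣ m) j ≡ pow (seq x j) m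
^ᵣ-seq x zero    j = refl
^ᵣ-seq x (suc m) j = cong (seq x j ℚ.*_) (^ᵣ-seq x m j)

-- A bound in the sense of `∥_∥≤_` carries its own nonnegativity, so the bound at the point 0
-- already contains the claim.
lipschitz-nonneg : ∀ P {R} → 0ℚᵘ ℚ.≤ R → 0ℚᵘ ℚ.≤ lipschitz P R
lipschitz-nonneg P {R} 0≤R = ∥_∥≤_.nonneg (quotient-bound P {R} {ratᵍ 0ℚᵘ} {ratᵍ 0ℚᵘ} (∥∥-rat 0≤R) (∥∥-rat 0≤R))

supBound-nonneg : ∀ P {R} → 0ℚᵘ ℚ.≤ R → 0ℚᵘ ℚ.≤ supBound P R
supBound-nonneg P {R} 0≤R = ∥_∥≤_.nonneg (eval-bound P {R} {ratᵍ 0ℚᵘ} (∥∥-rat 0≤R))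

-- Here p ≈ 1 / X, so that bounds for X W turn into bounds for W by multiples of p.
bounded-by-power : ∀ {a b C W M q X p p₂ ε} → 0ℚᵘ ℚ.< a → 0ℚᵘ ℚ.≤ C → 0ℚᵘ ℚ.≤ W → 0ℚᵘ ℚ.≤ p →
  2ℚ ℚ.* b ℚ.≤ a ℚ.* C → (a ℚ.* X) ℚ.* W ℚ.≤ b → 1ℚᵘ ℚ.≤ p ℚ.* X ℚ.+ M ℚ.* q →
  ((2ℚ ℚ.* W) ℚ.* M) ℚ.* q ℚ.≤ ε → p ℚ.≤ p₂ → 2ℚ ℚ.* W ℚ.≤ C ℚ.* p₂ ℚ.+ ε
bounded-by-power {a} {b} {C} {W} {M} {q} {X} {p} {p₂} {ε} 0<a 0≤C 0≤W 0≤p 2b≤aC h 1≤ small p≤p₂ = *-cancelˡ a 0<a (begin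
  a ℚ.* (2ℚ ℚ.* W)                                                  ≃⟨ ℚ.*-congˡ {a} (ℚ.≃-sym (ℚ.*-identityʳ (2ℚ ℚ.* W))) ⟩
  a ℚ.* ((2ℚ ℚ.* W) ℚ.* 1ℚᵘ)                                        ≤⟨ *-monoˡ a 0≤a (*-monoˡ (2ℚ ℚ.* W) (0≤* 0≤2 0≤W) 1≤) ⟩
  a ℚ.* ((2ℚ ℚ.* W) ℚ.* (p ℚ.* X ℚ.+ M ℚ.* q))                      ≃⟨ eq₁ a W p X M q ⟩
  p ℚ.* (2ℚ ℚ.* ((a ℚ.* X) ℚ.* W)) ℚ.+ a ℚ.* (((2ℚ ℚ.* W) ℚ.* M) ℚ.* q)
    ≤⟨ ℚ.+-mono-≤ (*-monoˡ p 0≤p (*-monoˡ 2ℚ 0≤2 h)) (*-monoˡ a 0≤a small) ⟩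
  p ℚ.* (2ℚ ℚ.* b) ℚ.+ a ℚ.* ε                                      ≤⟨ ℚ.+-monoˡ-≤ (a ℚ.* ε) (*-monoˡ p 0≤p 2b≤aC) ⟩
  p ℚ.* (a ℚ.* C) ℚ.+ a ℚ.* ε                                       ≤⟨ ℚ.+-monoˡ-≤ (a ℚ.* ε) (*-monoʳ (a ℚ.* C) (0≤* 0≤a 0≤C) p≤p₂) ⟩
  p₂ ℚ.* (a ℚ.* C) ℚ.+ a ℚ.* ε                                      ≃⟨ eq₂ p₂ a C ε ⟩
  a ℚ.* (C ℚ.* p₂ ℚ.+ ε)                                            ∎)
  where
  open ℚ.≤-Reasoning
  0≤a = ℚ.<⇒≤ 0<a
  0≤2 : 0ℚᵘ ℚ.≤ 2ℚ
  0≤2 = 0≤natℚ 2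
  open +-*-Solver using (solve; _:=_; _:+_; _:*_; con)
  eq₁ : ∀ a w p x n q → a ℚ.* ((2ℚ ℚ.* w) ℚ.* (p ℚ.* x ℚ.+ n ℚ.* q)) ℚ.≃
    p ℚ.* (2ℚ ℚ.* ((a ℚ.* x) ℚ.* w)) ℚ.+ a ℚ.* (((2ℚ ℚ.* w) ℚ.* n) ℚ.* q)
  eq₁ = solve 6 (λ a w p x n q → a :* ((con 2ℚ :* w) :* (p :* x :+ n :* q)) :=
    p :* (con 2ℚ :* ((a :* x) :* w)) :+ a :* (((con 2ℚ :* w) :* n) :* q)) ℚ.≃-refl
  eq₂ : ∀ p a c e → p ℚ.* (a ℚ.* c) ℚ.+ a ℚ.* e ℚ.≃ a ℚ.* (c ℚ.* p ℚ.+ e)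
  eq₂ = solve 4 (λ p a c e → p :* (a :* c) :+ a :* e := a :* (c :* p :+ e)) ℚ.≃-refl

-- The two factors β come from the shift by 2 between the index of the sequence and the length of
-- the walks; β ≤ 2 absorbs them into the condition on c.
bounds-power : ∀ {a b c W e X p β ε} → 0ℚᵘ ℚ.< b → 0ℚᵘ ℚ.≤ c → 0ℚᵘ ℚ.≤ W → 0ℚᵘ ℚ.≤ p → 0ℚᵘ ℚ.≤ β → β ℚ.≤ 2ℚ →
  2ℚ ℚ.* (b ℚ.* c) ℚ.≤ a → a ℚ.≤ (b ℚ.* X) ℚ.* W → p ℚ.* X ℚ.≤ 1ℚᵘ ℚ.+ e →
  (2ℚ ℚ.* W) ℚ.* e ℚ.≤ ε → c ℚ.* (β ℚ.* (β ℚ.* p)) ℚ.≤ 2ℚ ℚ.* W ℚ.+ ε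
bounds-power {a} {b} {c} {W} {e} {X} {p} {β} {ε} 0<b 0≤c 0≤W 0≤p 0≤β β≤2 2bc≤a h pX≤ small = *-cancelˡ b 0<b (begin
  b ℚ.* (c ℚ.* (β ℚ.* (β ℚ.* p)))                    ≃⟨ eq₁ b c β p ⟩
  (b ℚ.* c) ℚ.* ((β ℚ.* β) ℚ.* p)                    ≤⟨ *-monoˡ (b ℚ.* c) (0≤* 0≤b 0≤c) (*-monoʳ p 0≤p (*-mono 0≤β 0≤β β≤2 β≤2)) ⟩
  (b ℚ.* c) ℚ.* ((2ℚ ℚ.* 2ℚ) ℚ.* p)                  ≃⟨ eq₂ b c p ⟩
  (2ℚ ℚ.* (b ℚ.* c)) ℚ.* (2ℚ ℚ.* p)                  ≤⟨ *-monoʳ (2ℚ ℚ.* p) (0≤* 0≤2 0≤p) (ℚ.≤-trans 2bc≤a h) ⟩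
  ((b ℚ.* X) ℚ.* W) ℚ.* (2ℚ ℚ.* p)                   ≃⟨ eq₃ b X W p ⟩
  (b ℚ.* (2ℚ ℚ.* W)) ℚ.* (p ℚ.* X)                   ≤⟨ *-monoˡ (b ℚ.* (2ℚ ℚ.* W)) (0≤* 0≤b (0≤* 0≤2 0≤W)) pX≤ ⟩
  (b ℚ.* (2ℚ ℚ.* W)) ℚ.* (1ℚᵘ ℚ.+ e)                 ≃⟨ eq₄ b W e ⟩
  b ℚ.* (2ℚ ℚ.* W ℚ.+ (2ℚ ℚ.* W) ℚ.* e)              ≤⟨ *-monoˡ b 0≤b (ℚ.+-monoʳ-≤ (2ℚ ℚ.* W) small) ⟩
  b ℚ.* (2ℚ ℚ.* W ℚ.+ ε)                             ∎)
  where
  open ℚ.≤-Reasoning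
  0≤b = ℚ.<⇒≤ 0<b
  0≤2 : 0ℚᵘ ℚ.≤ 2ℚ
  0≤2 = 0≤natℚ 2
  open +-*-Solver using (solve; _:=_; _:+_; _:*_; con)
  eq₁ : ∀ b c x p → b ℚ.* (c ℚ.* (x ℚ.* (x ℚ.* p))) ℚ.≃ (b ℚ.* c) ℚ.* ((x ℚ.* x) ℚ.* p)
  eq₁ = solve 4 (λ b c x p → b :* (c :* (x :* (x :* p))) := (b :* c) :* ((x :* x) :* p)) ℚ.≃-refl
  eq₂ : ∀ b c p → (b ℚ.* c) ℚ.* ((2ℚ ℚ.* 2ℚ) ℚ.* p) ℚ.≃ (2ℚ ℚ.* (b ℚ.* c)) ℚ.* (2ℚ ℚ.* p)
  eq₂ = solve 3 (λ b c p → (b :* c) :* ((con 2ℚ :* con 2ℚ) :* p) := (con 2ℚ :* (b :* c)) :* (con 2ℚ :* p)) ℚ.≃-refl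
  eq₃ : ∀ b u w p → ((b ℚ.* u) ℚ.* w) ℚ.* (2ℚ ℚ.* p) ℚ.≃ (b ℚ.* (2ℚ ℚ.* w)) ℚ.* (p ℚ.* u)
  eq₃ = solve 4 (λ b u w p → ((b :* u) :* w) :* (con 2ℚ :* p) := (b :* (con 2ℚ :* w)) :* (p :* u)) ℚ.≃-refl
  eq₄ : ∀ b w e → (b ℚ.* (2ℚ ℚ.* w)) ℚ.* (1ℚᵘ ℚ.+ e) ℚ.≃ b ℚ.* (2ℚ ℚ.* w ℚ.+ (2ℚ ℚ.* w) ℚ.* e)
  eq₄ = solve 3 (λ b w e → (b :* (con 2ℚ :* w)) :* (con 1ℚᵘ :+ e) := b :* (con 2ℚ :* w :+ (con 2ℚ :* w) :* e)) ℚ.≃-refl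

power-cong : ∀ {x y} m → x ℚ.≃ y → pow x m ℚ.≃ pow y m
power-cong zero    eq = ℚ.≃-refl
power-cong (suc m) eq = ℚ.*-cong eq (power-cong m eq)

1≤power1 : ∀ m → 1ℚᵘ ℚ.≤ pow 1ℚᵘ m
1≤power1 zero    = ℚ.≤-refl
1≤power1 (suc m) = ℚ.≤-respʳ-≃ (ℚ.≃-sym (ℚ.*-identityˡ (pow 1ℚᵘ m))) (1≤power1 m)

-- A is at most H x⁻ᵐ and W at least (a / b) y⁻ᵐ. If W ≤ A held for m, then a ≤ b H zᵐ would follow,
-- because y ≤ z x; but zᵐ tends to 0.
overtake : ∀ {x y z a b H} (A W : ℕ → ℕ) → 0ℚᵘ ℚ.≤ x → 0ℚᵘ ℚ.≤ y → 0ℚᵘ ℚ.≤ z → z ℚ.< 1ℚᵘ → y ℚ.≤ z ℚ.* x →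
  0ℚᵘ ℚ.< a → 0ℚᵘ ℚ.≤ b → 0ℚᵘ ℚ.≤ H →
  (∀ m → natℚ (A m) ℚ.* pow x m ℚ.≤ H) → (∀ m → a ℚ.≤ (b ℚ.* pow y m) ℚ.* natℚ (W m)) →
  Eventually (λ m → A m ℕ.< W m)
overtake {x} {y} {z} {a} {b} {H} A W 0≤x 0≤y 0≤z z<1 y≤zx 0<a 0≤b 0≤H upper lower = proj₁ vanish , λ m N≤m →
  ℕ.≰⇒> λ W≤A → ℚ.<-irrefl ℚ.≃-refl (begin-strict
    a                                                               ≤⟨ lower m ⟩
    (b ℚ.* pow y m) ℚ.* natℚ (W m)                             ≤⟨ *-mono (0≤* 0≤b (0≤power m 0≤y)) (0≤natℚ (W m))
                                                                         (*-monoˡ b 0≤b (power-mono m 0≤y y≤zx)) (natℚ-mono W≤A) ⟩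
    (b ℚ.* pow (z ℚ.* x) m) ℚ.* natℚ (A m)                     ≃⟨ ℚ.*-congʳ {natℚ (A m)} (ℚ.*-congˡ {b} (power-* z x m)) ⟩
    (b ℚ.* (pow z m ℚ.* pow x m)) ℚ.* natℚ (A m)            ≃⟨ eq b (pow z m) (pow x m) (natℚ (A m)) ⟩
    (b ℚ.* pow z m) ℚ.* (natℚ (A m) ℚ.* pow x m)            ≤⟨ *-monoˡ (b ℚ.* pow z m) (0≤* 0≤b (0≤power m 0≤z)) (upper m) ⟩
    (b ℚ.* pow z m) ℚ.* H                                        ≃⟨ eq′ b (pow z m) H ⟩
    (b ℚ.* H) ℚ.* pow z m                                        ≤⟨ *-monoˡ (b ℚ.* H) (0≤* 0≤b 0≤H) (proj₂ vanish m N≤m) ⟩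
    (b ℚ.* H) ℚ.* δ                                                 ≤⟨ proj₂ (proj₂ below) ⟩
    -- Aiming below half of a makes the chain from a back to a strict.
    ½ ℚ.* a                                                         <⟨ ℚ.*-monoˡ-<-pos a {{ℚ.positive 0<a}} ½<1 ⟩
    1ℚᵘ ℚ.* a                                                       ≃⟨ ℚ.*-identityˡ a ⟩
    a                                                               ∎)
  where
  open ℚ.≤-Reasoning
  below : Σ[ δ ∈ ℚᵘ ] (0ℚᵘ ℚ.< δ × (b ℚ.* H) ℚ.* δ ℚ.≤ ½ ℚ.* a)
  below = scale-below (0≤* 0≤b 0≤H) (0<half 0<a)
  δ = proj₁ below
  vanish : Eventually (λ m → pow z m ℚ.≤ δ)
  vanish = power-vanishes 0≤z z<1 (proj₁ (proj₂ below))
  ½<1 : ½ ℚ.< 1ℚᵘ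
  ½<1 = ℚ.*<* (ℤ.+<+ (ℕ.s≤s (ℕ.s≤s ℕ.z≤n)))
  open +-*-Solver using (solve; _:=_; _:*_)
  eq : ∀ b z x w → (b ℚ.* (z ℚ.* x)) ℚ.* w ℚ.≃ (b ℚ.* z) ℚ.* (w ℚ.* x)
  eq = solve 4 (λ b z x w → (b :* (z :* x)) :* w := (b :* z) :* (w :* x)) ℚ.≃-refl
  eq′ : ∀ b z h → (b ℚ.* z) ℚ.* h ℚ.≃ (b ℚ.* h) ℚ.* z
  eq′ = solve 3 (λ b z h → (b :* z) :* h := (b :* h) :* z) ℚ.≃-refl

-- R is the radius of a disc in which the root is the only one; a and b bound the eigenvector near the
-- root, and c and C are the constants of the Θ-estimate.
module Growth {F n} {E : Digraph (suc n)} (S : TransferSystem F E) (root base places : ℕ)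
  (A : Polynomial) (R a b c C : ℚᵘ) where

  open TransferSystem S hiding (N)
  open Eigenvector S

  -- `lo` and `hi` are the ends of the rounding interval of the root: half a unit of the 20th place
  -- is 5 units of the 21st. `β⁻` and `β⁺` play this role for the base. `γ` is the margin by which
  -- squared moduli of other roots are separated.
  lo hi w γ β⁻ β⁺ L : ℚᵘ
  lo = decimal (10 ℕ.* root ∸ 5) 21
  hi = decimal (10 ℕ.* root ℕ.+ 5) 21
  w  = hi ℚ.- lo
  γ  = + 1 ℚ./ 1000
  β⁻ = decimal base places ℚ.- decimal 5 (suc places)
  β⁺ = decimal base places ℚ.+ decimal 5 (suc places)
  L  = lipschitz Q R

  -- The value at lo and a Lipschitz constant confine p to [a , b] on the whole interval [lo , hi].
  Between : Polynomial → Set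
  Between p = (a ℚ.+ w ℚ.* lipschitz p R ℚ.≤ evalℚ p lo) × (evalℚ p lo ℚ.+ w ℚ.* lipschitz p R ℚ.≤ b)

  between? : ∀ p → Dec (Between p)
  between? p = (_ ℚ.≤? _) ×-dec (_ ℚ.≤? _)

  record Certificate : Set where
    constructor certificate
    field
      0<lo    : 0ℚᵘ ℚ.< lo
      lo≤hi   : lo ℚ.≤ hi
      hi≤R    : hi ℚ.≤ R
      R≤1     : R ℚ.≤ 1ℚᵘ
      Q-lo    : 0ℚᵘ ℚ.≤ evalℚ Q lo
      Q-hi    : evalℚ Q hi ℚ.≤ 0ℚᵘ
      root⁻   : decimal root 20 ℚ.- decimal 5 21 ℚ.≤ lo
      root⁺   : hi ℚ.≤ decimal root 20 ℚ.+ decimal 5 21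
      1≤β⁻    : 1ℚᵘ ℚ.≤ β⁻
      β⁺≤2    : β⁺ ℚ.≤ 2ℚ
      base⁻   : β⁻ ℚ.* hi ℚ.+ L ℚ.* w ℚ.≤ 1ℚᵘ
      base⁺   : 1ℚᵘ ℚ.≤ β⁺ ℚ.* lo
      gap     : sq hi ℚ.+ (γ ℚ.+ γ ℚ.+ γ) ℚ.≤ sq R
      steep   : 1ℚᵘ ℚ.≤ slope (A ⊛ den F) R
      0<a     : 0ℚᵘ ℚ.< a
      0<b     : 0ℚᵘ ℚ.< b
      0<c     : 0ℚᵘ ℚ.< c
      0<C     : 0ℚᵘ ℚ.< C
      2b≤aC   : 2ℚ ℚ.* b ℚ.≤ a ℚ.* C
      2bc≤a   : 2ℚ ℚ.* (b ℚ.* c) ℚ.≤ a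
      ∣σ∣≤1   : ∣ σ ℚ./ 1 ∣ ℚ.≤ 1ℚᵘ
      values  : ∀ i → Between (P i)

  certificate? : Dec Certificate
  certificate? = map′
    (λ ((h₁ , h₂ , h₃ , h₄ , h₅ , h₆ , h₇ , h₈) , (h₉ , h₁₀ , h₁₁ , h₁₂ , h₁₃ , h₁₄) , (h₁₅ , h₁₆ , h₁₇ , h₁₈ , h₁₉ , h₂₀ , h₂₁ , h₂₂)) →
      certificate h₁ h₂ h₃ h₄ h₅ h₆ h₇ h₈ h₉ h₁₀ h₁₁ h₁₂ h₁₃ h₁₄ h₁₅ h₁₆ h₁₇ h₁₈ h₁₉ h₂₀ h₂₁ h₂₂)
    (λ (certificate h₁ h₂ h₃ h₄ h₅ h₆ h₇ h₈ h₉ h₁₀ h₁₁ h₁₂ h₁₃ h₁₄ h₁₅ h₁₆ h₁₇ h₁₈ h₁₉ h₂₀ h₂₁ h₂₂) →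
      ((h₁ , h₂ , h₃ , h₄ , h₅ , h₆ , h₇ , h₈) , (h₉ , h₁₀ , h₁₁ , h₁₂ , h₁₃ , h₁₄) , (h₁₅ , h₁₆ , h₁₇ , h₁₈ , h₁₉ , h₂₀ , h₂₁ , h₂₂)))
    (((_ ℚ.<? _) ×-dec (_ ℚ.≤? _) ×-dec (_ ℚ.≤? _) ×-dec (_ ℚ.≤? _) ×-dec (_ ℚ.≤? _) ×-dec (_ ℚ.≤? _) ×-dec (_ ℚ.≤? _) ×-dec (_ ℚ.≤? _)) ×-dec
     ((_ ℚ.≤? _) ×-dec (_ ℚ.≤? _) ×-dec (_ ℚ.≤? _) ×-dec (_ ℚ.≤? _) ×-dec (_ ℚ.≤? _) ×-dec (_ ℚ.≤? _)) ×-dec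
     ((_ ℚ.<? _) ×-dec (_ ℚ.<? _) ×-dec (_ ℚ.<? _) ×-dec (_ ℚ.<? _) ×-dec (_ ℚ.≤? _) ×-dec (_ ℚ.≤? _) ×-dec (_ ℚ.≤? _) ×-dec
      Fin.all? (λ i → between? (P i))))

  Slower : (x z H : ℚᵘ) → Set
  Slower x z H = (0ℚᵘ ℚ.≤ x) × (0ℚᵘ ℚ.≤ z) × (z ℚ.< 1ℚᵘ) × (hi ℚ.≤ z ℚ.* x) × (0ℚᵘ ℚ.≤ H)

  slower? : ∀ x z H → Dec (Slower x z H)
  slower? x z H = (_ ℚ.≤? _) ×-dec (_ ℚ.≤? _) ×-dec (_ ℚ.<? _) ×-dec (_ ℚ.≤? _) ×-dec (_ ℚ.≤? _)

  module _ (cert : Certificate) where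
    open Certificate cert
    open Bisection (evalℚ Q) lo hi lo≤hi Q-lo Q-hi

    0≤lo : 0ℚᵘ ℚ.≤ lo
    0≤lo = ℚ.<⇒≤ 0<lo

    0≤hi : 0ℚᵘ ℚ.≤ hi
    0≤hi = ℚ.≤-trans 0≤lo lo≤hi

    0≤R : 0ℚᵘ ℚ.≤ R
    0≤R = ℚ.≤-trans 0≤hi hi≤R

    0≤L : 0ℚᵘ ℚ.≤ L
    0≤L = lipschitz-nonneg Q 0≤R

    d q : ℕ → ℚᵘ
    d j = upper j ℚ.- lower j
    q j = evalℚ Q (lower j)

    lower≤hi : ∀ j → lower j ℚ.≤ hi
    lower≤hi j = ℚ.≤-trans (lower≤upper j) (upper≤hi j)

    lo≤upper : ∀ j → lo ℚ.≤ upper j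
    lo≤upper j = ℚ.≤-trans (lo≤lower j) (lower≤upper j)

    0<lower : ∀ j → 0ℚᵘ ℚ.< lower j
    0<lower j = ℚ.<-≤-trans 0<lo (lo≤lower j)

    0≤lower : ∀ j → 0ℚᵘ ℚ.≤ lower j
    0≤lower j = ℚ.<⇒≤ (0<lower j)

    inDisc : ∀ {x} → lo ℚ.≤ x → x ℚ.≤ hi → ∣ x ∣ ℚ.≤ R
    inDisc {x} lo≤x x≤hi = ℚ.≤-respˡ-≃ (ℚ.≃-sym (ℚ.0≤p⇒∣p∣≃p (ℚ.≤-trans 0≤lo lo≤x))) (ℚ.≤-trans x≤hi hi≤R)

    0≤q : ∀ j → 0ℚᵘ ℚ.≤ q j
    0≤q j = Brackets.g-lower (bracketed j)

    q≤ : ∀ j → q j ℚ.≤ L ℚ.* d j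
    q≤ j = begin
      q j                                              ≤⟨ ℚ.p≤p+q (q j) (ℚ.- evalℚ Q (upper j)) {{ℚ.nonNegative (ℚ.neg-mono-≤ (Brackets.g-upper (bracketed j)))}} ⟩
      q j ℚ.- evalℚ Q (upper j)                        ≤⟨ p≤∣p∣ _ ⟩
      ∣ q j ℚ.- evalℚ Q (upper j) ∣                    ≤⟨ evalℚ-lipschitz Q (inDisc (lo≤lower j) (lower≤hi j)) (inDisc (lo≤upper j) (upper≤hi j)) ⟩
      ∣ lower j ℚ.- upper j ∣ ℚ.* L                    ≃⟨ ℚ.*-congʳ {L} (ℚ.≃-trans (ℚ.≃-sym (ℚ.∣-p∣≃∣p∣ (lower j ℚ.- upper j)))
                                                            (ℚ.≃-trans (ℚ.∣-∣-cong (eq (lower j) (upper j))) (ℚ.0≤p⇒∣p∣≃p (0≤width j)))) ⟩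
      d j ℚ.* L                                        ≃⟨ ℚ.*-comm (d j) L ⟩
      L ℚ.* d j                                        ∎
      where
      open ℚ.≤-Reasoning
      open +-*-Solver using (_:=_; _:-_; :-_) renaming (solve to ring)
      eq : ∀ l u → ℚ.- (l ℚ.- u) ℚ.≃ u ℚ.- l
      eq = ring 2 (λ l u → :- (l :- u) := u :- l) ℚ.≃-refl

    d≤w : ∀ j → d j ℚ.≤ w
    d≤w j = ℚ.+-mono-≤ (upper≤hi j) (ℚ.neg-mono-≤ (lo≤lower j))

    q-vanishes : ∀ {K ε} → 0ℚᵘ ℚ.≤ K → 0ℚᵘ ℚ.< ε → Eventually (λ j → K ℚ.* q j ℚ.≤ ε)
    q-vanishes {K} {ε} 0≤K 0<ε = proj₁ v , λ j N≤j → begin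
      K ℚ.* q j              ≤⟨ *-monoˡ K 0≤K (q≤ j) ⟩
      K ℚ.* (L ℚ.* d j)      ≃⟨ ℚ.≃-sym (ℚ.*-assoc K L (d j)) ⟩
      (K ℚ.* L) ℚ.* d j      ≤⟨ proj₂ v j N≤j ⟩
      ε                      ∎
      where
      open ℚ.≤-Reasoning
      v : Eventually (λ j → (K ℚ.* L) ℚ.* d j ℚ.≤ ε)
      v = width-vanishes (0≤* 0≤K 0≤L) 0<ε

    r : ℝ
    r = mkℝ lower lower-cauchy

    -- Q = 1 + x Q′ makes 1 / r = - Q′(r).
    1/r : ℝ
    1/r = re (evaluate (- 1ℤ ⊙ divideByX Q) (fromℝ r))

    β : ℕ → ℚᵘ
    β = seq 1/r

    β≃ : ∀ j → β j ℚ.≃ evalℚ (- 1ℤ ⊙ divideByX Q) (lower j)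
    β≃ j = ℚ.≃-trans (ℚ.≃-reflexive (cong proj₁ (evaluate-seq (- 1ℤ ⊙ divideByX Q) (fromℝ r) j)))
      (proj₁ (eval-real (- 1ℤ ⊙ divideByX Q) (lower j)))

    -- The approximants of 1 / r and r are not inverse to each other; the defect is exactly the
    -- value q j of Q, which all later estimates carry along.
    β*lower : ∀ j → β j ℚ.* lower j ℚ.≃ 1ℚᵘ ℚ.- q j
    β*lower j = begin
      β j ℚ.* lower j                            ≈⟨ ℚ.*-congʳ {lower j} (ℚ.≃-trans (β≃ j) (evalℚ-⊙ (- 1ℤ) (divideByX Q) (lower j))) ⟩
      (- 1ℤ ℚ./ 1 ℚ.* q′) ℚ.* lower j            ≈⟨ eq q′ (lower j) ⟩
      1ℚᵘ ℚ.- (1ℚᵘ ℚ.+ lower j ℚ.* q′)           ≈⟨ ℚ.+-congʳ 1ℚᵘ (ℚ.-‿cong (ℚ.≃-sym (ℚ.≃-trans (evalℚ-head Q (lower j))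
                                                      (ℚ.+-congˡ (lower j ℚ.* q′) (ℚ.≃-reflexive (cong (ℚ._/ 1) Q₀≡1)))))) ⟩
      1ℚᵘ ℚ.- q j                                ∎
      where
      open SetoidReasoning ℚ.≃-setoid
      q′ = evalℚ (divideByX Q) (lower j)
      open +-*-Solver using (_:=_; _:-_; _:+_; _:*_; con) renaming (solve to ring)
      eq : ∀ q l → (- 1ℤ ℚ./ 1 ℚ.* q) ℚ.* l ℚ.≃ 1ℚᵘ ℚ.- (1ℚᵘ ℚ.+ l ℚ.* q)
      eq = ring 2 (λ q l → (con (- 1ℤ ℚ./ 1) :* q) :* l := con 1ℚᵘ :- (con 1ℚᵘ :+ l :* q)) ℚ.≃-refl

    isRoot : IsRoot (den F) (fromℝ r)
    isRoot = real , imaginary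
      where
      open ℚ.≤-Reasoning
      x y : ℕ → ℚᵘ
      x j = seq (re (evaluate (den F) (fromℝ r))) j
      y j = seq (im (evaluate (den F) (fromℝ r))) j
      approx : ∀ j → (x j , y j) ∼ ratᵍ (evalℚ (den F) (lower j))
      approx j = ∼-trans {x j , y j} {eval (den F) (ratᵍ (lower j))}
        (ℚ.≃-reflexive (cong proj₁ (evaluate-seq (den F) (fromℝ r) j)) ,
         ℚ.≃-reflexive (cong proj₂ (evaluate-seq (den F) (fromℝ r) j)))
        (eval-real (den F) (lower j))
      open +-*-Solver using (_:=_; _:-_; con) renaming (solve to ring)
      minus0 : ∀ x → x ℚ.- 0ℚᵘ ℚ.≃ x
      minus0 = ring 1 (λ x → x :- con 0ℚᵘ := x) ℚ.≃-refl
      small : ∀ j → ∣ evalℚ (den F) (lower j) ∣ ℚ.≤ 1ℚᵘ ℚ.* q j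
      small j = begin
        ∣ evalℚ (den F) (lower j) ∣        ≃⟨ ℚ.∣-∣-cong (ℚ.≃-trans (ℚ.≃-reflexive (cong (λ D → evalℚ D (lower j)) (sym den≡))) (evalℚ-⊙ σ Q (lower j))) ⟩
        ∣ σ ℚ./ 1 ℚ.* q j ∣                ≃⟨ ℚ.∣p*q∣≃∣p∣*∣q∣ (σ ℚ./ 1) (q j) ⟩
        ∣ σ ℚ./ 1 ∣ ℚ.* ∣ q j ∣            ≤⟨ *-monoʳ ∣ q j ∣ (ℚ.0≤∣p∣ (q j)) ∣σ∣≤1 ⟩
        1ℚᵘ ℚ.* ∣ q j ∣                    ≃⟨ ℚ.*-congˡ {1ℚᵘ} (ℚ.0≤p⇒∣p∣≃p (0≤q j)) ⟩
        1ℚᵘ ℚ.* q j                        ∎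
      real : re (evaluate (den F) (fromℝ r)) ≈ᵣ 0ᵣ
      real ε 0<ε = proj₁ v , λ j N≤j → ℚ.≤-trans
        (ℚ.≤-respˡ-≃ (ℚ.≃-sym (ℚ.∣-∣-cong {x j ℚ.- 0ℚᵘ} {evalℚ (den F) (lower j)} (ℚ.≃-trans (minus0 (x j)) (proj₁ (approx j))))) (small j)) (proj₂ v j N≤j)
        where
        v : Eventually (λ j → 1ℚᵘ ℚ.* q j ℚ.≤ ε)
        v = q-vanishes 0≤1 0<ε
      imaginary : im (evaluate (den F) (fromℝ r)) ≈ᵣ 0ᵣ
      imaginary ε 0<ε = 0 , λ j _ → ℚ.≤-respˡ-≃ (ℚ.≃-sym (ℚ.∣-∣-cong {y j ℚ.- 0ℚᵘ} {0ℚᵘ} (ℚ.≃-trans (minus0 (y j)) (proj₂ (approx j))))) (ℚ.<⇒≤ 0<ε)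

    root-digits : r ≐ root ·10⁻ 20
    root-digits =
      (λ ε 0<ε → 0 , λ j _ → ℚ.≤-trans (ℚ.≤-trans root⁻ (lo≤lower j)) (ℚ.p≤p+q (lower j) ε {{ℚ.nonNegative (ℚ.<⇒≤ 0<ε)}})) ,
      (λ ε 0<ε → 0 , λ j _ → ℚ.≤-trans (ℚ.≤-trans (lower≤hi j) root⁺) (ℚ.p≤p+q _ ε {{ℚ.nonNegative (ℚ.<⇒≤ 0<ε)}}))

    -- β j times `lower j` is 1 - q j, and q j is at most L w on the whole interval. The summand L w
    -- in `base⁻` pays for this defect before `lower j` is cancelled.
    β⁻≤β : ∀ j → β⁻ ℚ.≤ β j
    β⁻≤β j = *-cancelˡ (lower j) (0<lower j) (begin
      lower j ℚ.* β⁻                        ≃⟨ ℚ.*-comm (lower j) β⁻ ⟩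
      β⁻ ℚ.* lower j                        ≤⟨ *-monoˡ β⁻ (ℚ.≤-trans 0≤1 1≤β⁻) (lower≤hi j) ⟩
      β⁻ ℚ.* hi                             ≃⟨ ℚ.≃-sym (eq (β⁻ ℚ.* hi) (L ℚ.* w)) ⟩
      (β⁻ ℚ.* hi ℚ.+ L ℚ.* w) ℚ.- L ℚ.* w   ≤⟨ ℚ.+-mono-≤ base⁻ (ℚ.neg-mono-≤ (ℚ.≤-trans (q≤ j) (*-monoˡ L 0≤L (d≤w j)))) ⟩
      1ℚᵘ ℚ.- q j                           ≃⟨ ℚ.≃-sym (β*lower j) ⟩
      β j ℚ.* lower j                       ≃⟨ ℚ.*-comm (β j) (lower j) ⟩
      lower j ℚ.* β j                       ∎)
      where
      open ℚ.≤-Reasoning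
      open +-*-Solver using (_:=_; _:-_; _:+_; con) renaming (solve to ring)
      eq : ∀ x y → (x ℚ.+ y) ℚ.- y ℚ.≃ x
      eq = ring 2 (λ x y → (x :+ y) :- y := x) ℚ.≃-refl

    β*lower≤1 : ∀ j → β j ℚ.* lower j ℚ.≤ 1ℚᵘ
    β*lower≤1 j = begin
      β j ℚ.* lower j     ≃⟨ β*lower j ⟩
      1ℚᵘ ℚ.- q j         ≤⟨ ℚ.+-monoʳ-≤ 1ℚᵘ (ℚ.neg-mono-≤ (0≤q j)) ⟩
      1ℚᵘ ℚ.- 0ℚᵘ         ≃⟨ ℚ.+-identityʳ 1ℚᵘ ⟩
      1ℚᵘ                 ∎
      where open ℚ.≤-Reasoning

    0≤β : ∀ j → 0ℚᵘ ℚ.≤ β j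
    0≤β j = ℚ.≤-trans (ℚ.≤-trans 0≤1 1≤β⁻) (β⁻≤β j)

    0≤β⁺ : 0ℚᵘ ℚ.≤ β⁺
    0≤β⁺ = *-cancelˡ lo 0<lo (ℚ.≤-respˡ-≃ (ℚ.≃-sym (ℚ.*-zeroʳ lo))
      (ℚ.≤-respʳ-≃ (ℚ.*-comm β⁺ lo) (ℚ.≤-trans 0≤1 base⁺)))

    β≤β⁺ : ∀ j → β j ℚ.≤ β⁺
    β≤β⁺ j = *-cancelˡ (lower j) (0<lower j) (begin
      lower j ℚ.* β j     ≃⟨ ℚ.*-comm (lower j) (β j) ⟩
      β j ℚ.* lower j     ≤⟨ β*lower≤1 j ⟩
      1ℚᵘ                 ≤⟨ base⁺ ⟩
      β⁺ ℚ.* lo           ≤⟨ *-monoˡ β⁺ 0≤β⁺ (lo≤lower j) ⟩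
      β⁺ ℚ.* lower j      ≃⟨ ℚ.*-comm β⁺ (lower j) ⟩
      lower j ℚ.* β⁺      ∎)
      where open ℚ.≤-Reasoning

    inverse : 1/r *ᵣ r ≈ᵣ 1ᵣ
    inverse ε 0<ε = proj₁ v , λ j N≤j → begin
      ∣ β j ℚ.* lower j ℚ.- 1ℚᵘ ∣   ≃⟨ ℚ.∣-∣-cong (ℚ.≃-trans (ℚ.+-congˡ (ℚ.- 1ℚᵘ) (β*lower j)) (eq (q j))) ⟩
      ∣ ℚ.- (1ℚᵘ ℚ.* q j) ∣         ≃⟨ ℚ.∣-p∣≃∣p∣ (1ℚᵘ ℚ.* q j) ⟩
      ∣ 1ℚᵘ ℚ.* q j ∣               ≃⟨ ℚ.0≤p⇒∣p∣≃p (0≤* 0≤1 (0≤q j)) ⟩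
      1ℚᵘ ℚ.* q j                   ≤⟨ proj₂ v j N≤j ⟩
      ε                             ∎
      where
      open ℚ.≤-Reasoning
      open +-*-Solver using (_:=_; _:-_; _:*_; :-_; con) renaming (solve to ring)
      eq : ∀ q → (1ℚᵘ ℚ.- q) ℚ.- 1ℚᵘ ℚ.≃ ℚ.- (1ℚᵘ ℚ.* q)
      eq = ring 1 (λ q → (con 1ℚᵘ :- q) :- con 1ℚᵘ := :- (con 1ℚᵘ :* q)) ℚ.≃-refl
      v : Eventually (λ j → 1ℚᵘ ℚ.* q j ℚ.≤ ε)
      v = q-vanishes 0≤1 0<ε

    base-digits : 1/r ≐ base ·10⁻ places
    base-digits =
      (λ ε 0<ε → 0 , λ j _ → ℚ.≤-trans (β⁻≤β j) (ℚ.p≤p+q (β j) ε {{ℚ.nonNegative (ℚ.<⇒≤ 0<ε)}})) ,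
      (λ ε 0<ε → 0 , λ j _ → ℚ.≤-trans (β≤β⁺ j) (ℚ.p≤p+q β⁺ ε {{ℚ.nonNegative (ℚ.<⇒≤ 0<ε)}}))

    -- Eventually the approximants of z and r lie in the disc and give small values of the
    -- denominator, so `zeros-close` applies at each common index.
    separation : ∀ z → IsRoot (den F) z → Eventually (λ j → seq ∣ z ∣² j ℚ.≤ sq R) → z ≈ fromℝ r
    separation z (re0 , im0) inside = (λ ε 0<ε → close ε 0<ε ∥∥⇒re) , (λ ε 0<ε → close ε 0<ε ∥∥⇒im)
      where
      open ℚ.≤-Reasoning
      α = supBound A R
      zⱼ rⱼ : ℕ → ℚ[i]
      zⱼ j = seq (re z) j , seq (im z) j
      rⱼ j = ratᵍ (lower j)
      near : ∀ ε → 0ℚᵘ ℚ.< ε → Eventually (λ j → ∥ zⱼ j -ᵍ rⱼ j ∥≤ ε)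
      near ε 0<ε = N , λ j N≤j → ∥∥-weaken {zⱼ j -ᵍ rⱼ j} αδ≤ε (zeros-close A (den F) steep
          (bound 0≤R (proj₂ inside j (ℕ.m⊔n≤o⇒m≤o Nᵢ _ N≤j)))
          (∥∥-rat (inDisc (lo≤lower j) (lower≤hi j)))
          (small z j (proj₂ zᵣ j (ℕ.m⊔n≤o⇒m≤o (proj₁ zᵣ) _ (n₁ j N≤j))) (proj₂ zᵢ j (ℕ.m⊔n≤o⇒m≤o (proj₁ zᵢ) _ (n₂ j N≤j))))
          (small (fromℝ r) j (proj₂ rᵣ j (ℕ.m⊔n≤o⇒m≤o (proj₁ rᵣ) _ (n₃ j N≤j))) (proj₂ rᵢ j (ℕ.m⊔n≤o⇒n≤o (proj₁ rᵣ) _ (n₃ j N≤j)))))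
        where
        below : Σ[ δ ∈ ℚᵘ ] (0ℚᵘ ℚ.< δ × (α ℚ.+ α) ℚ.* δ ℚ.≤ ε)
        below = scale-below (0≤+ (supBound-nonneg A 0≤R) (supBound-nonneg A 0≤R)) 0<ε
        δ = proj₁ below
        0<½δ : 0ℚᵘ ℚ.< ½ ℚ.* δ
        0<½δ = 0<half (proj₁ (proj₂ below))
        αδ≤ε : α ℚ.* δ ℚ.+ α ℚ.* δ ℚ.≤ ε
        αδ≤ε = ℚ.≤-respˡ-≃ (ℚ.*-distribʳ-+ δ α α) (proj₂ (proj₂ below))
        zᵣ : Eventually (λ j → ∣ seq (re (evaluate (den F) z)) j ℚ.- 0ℚᵘ ∣ ℚ.≤ ½ ℚ.* δ)
        zᵣ = re0 (½ ℚ.* δ) 0<½δ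
        zᵢ : Eventually (λ j → ∣ seq (im (evaluate (den F) z)) j ℚ.- 0ℚᵘ ∣ ℚ.≤ ½ ℚ.* δ)
        zᵢ = im0 (½ ℚ.* δ) 0<½δ
        rᵣ : Eventually (λ j → ∣ seq (re (evaluate (den F) (fromℝ r))) j ℚ.- 0ℚᵘ ∣ ℚ.≤ ½ ℚ.* δ)
        rᵣ = proj₁ isRoot (½ ℚ.* δ) 0<½δ
        rᵢ : Eventually (λ j → ∣ seq (im (evaluate (den F) (fromℝ r))) j ℚ.- 0ℚᵘ ∣ ℚ.≤ ½ ℚ.* δ)
        rᵢ = proj₂ isRoot (½ ℚ.* δ) 0<½δ
        Nᵢ = proj₁ inside
        N = Nᵢ ⊔ (proj₁ zᵣ ⊔ (proj₁ zᵢ ⊔ (proj₁ rᵣ ⊔ proj₁ rᵢ)))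
        n₁ : ∀ j → N ℕ.≤ j → proj₁ zᵣ ⊔ (proj₁ zᵢ ⊔ (proj₁ rᵣ ⊔ proj₁ rᵢ)) ℕ.≤ j
        n₁ j N≤j = ℕ.m⊔n≤o⇒n≤o Nᵢ _ N≤j
        n₂ : ∀ j → N ℕ.≤ j → proj₁ zᵢ ⊔ (proj₁ rᵣ ⊔ proj₁ rᵢ) ℕ.≤ j
        n₂ j N≤j = ℕ.m⊔n≤o⇒n≤o (proj₁ zᵣ) _ (n₁ j N≤j)
        n₃ : ∀ j → N ℕ.≤ j → proj₁ rᵣ ⊔ proj₁ rᵢ ℕ.≤ j
        n₃ j N≤j = ℕ.m⊔n≤o⇒n≤o (proj₁ zᵢ) _ (n₂ j N≤j)
        small : ∀ u j → ∣ seq (re (evaluate (den F) u)) j ℚ.- 0ℚᵘ ∣ ℚ.≤ ½ ℚ.* δ →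
          ∣ seq (im (evaluate (den F) u)) j ℚ.- 0ℚᵘ ∣ ℚ.≤ ½ ℚ.* δ → ∥ eval (den F) (seq (re u) j , seq (im u) j) ∥≤ δ
        small u j hr hi = subst (∥_∥≤ δ) (evaluate-seq (den F) u j)
          (∥∥-weaken {seq (re (evaluate (den F) u)) j , seq (im (evaluate (den F) u)) j} (ℚ.≤-reflexive (half+half δ))
            (∥∥-fromParts (ℚ.≤-respˡ-≃ (ℚ.∣-∣-cong (ℚ.+-identityʳ _)) hr) (ℚ.≤-respˡ-≃ (ℚ.∣-∣-cong (ℚ.+-identityʳ _)) hi)))
      close : ∀ ε → 0ℚᵘ ℚ.< ε → {x : ℕ → ℚᵘ} → (∀ {j} → ∥ zⱼ j -ᵍ rⱼ j ∥≤ ε → ∣ x j ∣ ℚ.≤ ε) → Eventually (λ j → ∣ x j ∣ ℚ.≤ ε)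
      close ε 0<ε part = proj₁ (near ε 0<ε) , λ j N≤j → part (proj₂ (near ε 0<ε) j N≤j)

    -- The order of reals is not decidable, so one rational term v N of ∣ z ∣² is examined, from
    -- which later terms differ by at most γ. If v N ≤ hi² + 2γ, all later terms stay within the
    -- disc and z would be r. Otherwise they exceed hi² + γ. Thus one γ is for moving up, one for
    -- moving down, and one is the gap that remains.
    minimal : ∀ z → IsRoot (den F) z → ¬ (z ≈ fromℝ r) → fromℝ r <∣∣ z
    minimal z isRoot-z z≉r = γ , ℚ.positive⁻¹ γ , N , far
      where
      open ℚ.≤-Reasoning
      v : ℕ → ℚᵘ
      v = seq ∣ z ∣²
      settle : Σ[ N ∈ ℕ ] (∀ m n → N ℕ.≤ m → N ℕ.≤ n → ∣ v m ℚ.- v n ∣ ℚ.≤ γ)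
      settle = cauchy ∣ z ∣² γ (ℚ.positive⁻¹ γ)
      N = proj₁ settle
      move : ∀ m n → N ℕ.≤ m → N ℕ.≤ n → v m ℚ.≤ v n ℚ.+ γ
      move m n N≤m N≤n = begin
        v m                          ≃⟨ eq (v m) (v n) ⟩
        v n ℚ.+ (v m ℚ.- v n)        ≤⟨ ℚ.+-monoʳ-≤ (v n) (ℚ.≤-trans (p≤∣p∣ (v m ℚ.- v n)) (proj₂ settle m n N≤m N≤n)) ⟩
        v n ℚ.+ γ                    ∎
        where
        open +-*-Solver using (_:=_; _:-_; _:+_; con) renaming (solve to ring)
        eq : ∀ x y → x ℚ.≃ y ℚ.+ (x ℚ.- y)
        eq = ring 2 (λ x y → x := y :+ (x :- y)) ℚ.≃-refl
      outside : ¬ v N ℚ.≤ sq hi ℚ.+ (γ ℚ.+ γ)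
      outside vN≤ = z≉r (separation z isRoot-z (N , λ j N≤j → begin
        v j                                    ≤⟨ move j N N≤j ℕ.≤-refl ⟩
        v N ℚ.+ γ                              ≤⟨ ℚ.+-monoˡ-≤ γ vN≤ ⟩
        (sq hi ℚ.+ (γ ℚ.+ γ)) ℚ.+ γ            ≃⟨ ℚ.+-assoc (sq hi) (γ ℚ.+ γ) γ ⟩
        sq hi ℚ.+ (γ ℚ.+ γ ℚ.+ γ)              ≤⟨ gap ⟩
        sq R                                   ∎))
      far : ∀ j → N ℕ.≤ j → seq ∣ fromℝ r ∣² j ℚ.+ γ ℚ.≤ v j
      far j N≤j = begin
        (sq (lower j) ℚ.+ sq 0ℚᵘ) ℚ.+ γ        ≤⟨ ℚ.+-monoˡ-≤ γ (ℚ.+-monoˡ-≤ (sq 0ℚᵘ) (*-mono (0≤lower j) (0≤lower j) (lower≤hi j) (lower≤hi j))) ⟩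
        (sq hi ℚ.+ sq 0ℚᵘ) ℚ.+ γ               ≃⟨ eq (sq hi) γ ⟩
        (sq hi ℚ.+ (γ ℚ.+ γ)) ℚ.- γ            ≤⟨ ℚ.+-monoˡ-≤ (ℚ.- γ) (ℚ.≰⇒≥ outside) ⟩
        v N ℚ.- γ                              ≤⟨ ℚ.+-monoˡ-≤ (ℚ.- γ) (move N j ℕ.≤-refl N≤j) ⟩
        (v j ℚ.+ γ) ℚ.- γ                      ≃⟨ eq′ (v j) γ ⟩
        v j                                    ∎
        where
        open +-*-Solver using (_:=_; _:-_; _:+_; _:*_; con) renaming (solve to ring)
        eq : ∀ h g → (h ℚ.+ 0ℚᵘ ℚ.* 0ℚᵘ) ℚ.+ g ℚ.≃ (h ℚ.+ (g ℚ.+ g)) ℚ.- g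
        eq = ring 2 (λ h g → (h :+ con 0ℚᵘ :* con 0ℚᵘ) :+ g := (h :+ (g :+ g)) :- g) ℚ.≃-refl
        eq′ : ∀ x g → (x ℚ.+ g) ℚ.- g ℚ.≃ x
        eq′ = ring 2 (λ x g → (x :+ g) :- g := x) ℚ.≃-refl

    -- Growth of the coefficients

    value-near : ∀ {x} → lo ℚ.≤ x → x ℚ.≤ hi → ∀ i → ∣ value x i ℚ.- value lo i ∣ ℚ.≤ w ℚ.* lipschitz (P i) R
    value-near {x} lo≤x x≤hi i = ℚ.≤-trans
      (evalℚ-lipschitz (P i) (inDisc lo≤x x≤hi) (inDisc ℚ.≤-refl lo≤hi))
      (*-monoʳ (lipschitz (P i) R) (lipschitz-nonneg (P i) 0≤R)
        (ℚ.≤-respˡ-≃ (ℚ.≃-sym (ℚ.0≤p⇒∣p∣≃p (ℚ.p≤q⇒0≤q-p lo≤x))) (ℚ.+-monoˡ-≤ (ℚ.- lo) x≤hi)))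

    value≥a : ∀ {x} → lo ℚ.≤ x → x ℚ.≤ hi → ∀ i → a ℚ.≤ value x i
    value≥a {x} lo≤x x≤hi i = begin
      a                                           ≃⟨ eq a e ⟩
      (a ℚ.+ e) ℚ.- e                             ≤⟨ ℚ.+-mono-≤ (proj₁ (values i)) (ℚ.neg-mono-≤ (ℚ.≤-trans (-p≤∣p∣ _) (value-near lo≤x x≤hi i))) ⟩
      value lo i ℚ.- ℚ.- (value x i ℚ.- value lo i)  ≃⟨ eq′ (value x i) (value lo i) ⟩
      value x i                                   ∎
      where
      open ℚ.≤-Reasoning
      e = w ℚ.* lipschitz (P i) R
      open +-*-Solver using (_:=_; _:-_; _:+_; :-_) renaming (solve to ring)
      eq : ∀ x y → x ℚ.≃ (x ℚ.+ y) ℚ.- y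
      eq = ring 2 (λ x y → x := (x :+ y) :- y) ℚ.≃-refl
      eq′ : ∀ x y → y ℚ.- ℚ.- (x ℚ.- y) ℚ.≃ x
      eq′ = ring 2 (λ x y → y :- (:- (x :- y)) := x) ℚ.≃-refl

    value≤b : ∀ {x} → lo ℚ.≤ x → x ℚ.≤ hi → ∀ i → value x i ℚ.≤ b
    value≤b {x} lo≤x x≤hi i = begin
      value x i                                   ≃⟨ eq (value x i) (value lo i) ⟩
      value lo i ℚ.+ (value x i ℚ.- value lo i)   ≤⟨ ℚ.+-monoʳ-≤ (value lo i) (ℚ.≤-trans (p≤∣p∣ _) (value-near lo≤x x≤hi i)) ⟩
      value lo i ℚ.+ w ℚ.* lipschitz (P i) R      ≤⟨ proj₂ (values i) ⟩
      b                                           ∎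
      where
      open ℚ.≤-Reasoning
      open +-*-Solver using (_:=_; _:-_; _:+_) renaming (solve to ring)
      eq : ∀ x y → x ℚ.≃ y ℚ.+ (x ℚ.- y)
      eq = ring 2 (λ x y → x := y :+ (x :- y)) ℚ.≃-refl

    W : ℕ → ℚᵘ
    W m = natℚ (walkCount E m zero)

    walks≤ : ∀ {x} m → lo ℚ.≤ x → x ℚ.≤ hi → 0ℚᵘ ℚ.≤ evalℚ Q x → (a ℚ.* pow x m) ℚ.* W m ℚ.≤ b
    walks≤ m lo≤x x≤hi 0≤Q = ℚ.≤-trans
      (walks-upper (ℚ.≤-trans 0≤lo lo≤x) 0≤Q (value≥a lo≤x x≤hi) m zero) (value≤b lo≤x x≤hi zero)

    walks≥ : ∀ {x} m → lo ℚ.≤ x → x ℚ.≤ hi → evalℚ Q x ℚ.≤ 0ℚᵘ → a ℚ.≤ (b ℚ.* pow x m) ℚ.* W m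
    walks≥ m lo≤x x≤hi Q≤0 = ℚ.≤-trans (value≥a lo≤x x≤hi zero)
      (walks-lower (ℚ.≤-trans 0≤lo lo≤x) Q≤0 (value≤b lo≤x x≤hi) m zero)

    term : ∀ m j → seq (fromℤ (sequence F (2 ℕ.+ m))) j ℚ.≃ 2ℚ ℚ.* W m
    term m j = ℚ.≃-trans (ℚ.≃-reflexive (cong (λ x → (+ 2 ℤ.* x) ℚ./ 1) (coefficient≡walks m)))
      (/1-* (+ 2) (+ walkCount E m zero))

    B : ℕ → ℕ → ℚᵘ
    B j m = pow (β j) m

    0≤B : ∀ j m → 0ℚᵘ ℚ.≤ B j m
    0≤B j m = 0≤power m (0≤β j)

    B*power : ∀ j m → B j m ℚ.* pow (lower j) m ℚ.≃ pow (1ℚᵘ ℚ.- q j) m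
    B*power j m = ℚ.≃-trans (ℚ.≃-sym (power-* (β j) (lower j) m)) (power-cong m (β*lower j))

    0≤1-q : ∀ j → 0ℚᵘ ℚ.≤ 1ℚᵘ ℚ.- q j
    0≤1-q j = ℚ.≤-respʳ-≃ (β*lower j) (0≤* (0≤β j) (0≤lower j))

    1-q≤1 : ∀ j → 1ℚᵘ ℚ.- q j ℚ.≤ 1ℚᵘ
    1-q≤1 j = ℚ.≤-respˡ-≃ (β*lower j) (β*lower≤1 j)

    -- The product of the two powers is (1 - q)ᵐ, which falls short of 1 by at most m q.
    B*lower≥ : ∀ j m → 1ℚᵘ ℚ.≤ B j m ℚ.* pow (lower j) m ℚ.+ natℚ m ℚ.* q j
    B*lower≥ j m = begin
      1ℚᵘ                                                                ≤⟨ 1≤power1 m ⟩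
      pow 1ℚᵘ m                                                       ≤⟨ power-gap m (0≤1-q j) (1-q≤1 j) ℚ.≤-refl ⟩
      pow (1ℚᵘ ℚ.- q j) m ℚ.+ natℚ m ℚ.* (1ℚᵘ ℚ.- (1ℚᵘ ℚ.- q j))    ≃⟨ ℚ.+-cong (ℚ.≃-sym (B*power j m)) (ℚ.*-congˡ {natℚ m} (eq (q j))) ⟩
      B j m ℚ.* pow (lower j) m ℚ.+ natℚ m ℚ.* q j                  ∎
      where
      open ℚ.≤-Reasoning
      open +-*-Solver using (_:=_; _:-_; con) renaming (solve to ring)
      eq : ∀ q → 1ℚᵘ ℚ.- (1ℚᵘ ℚ.- q) ℚ.≃ q
      eq = ring 1 (λ q → con 1ℚᵘ :- (con 1ℚᵘ :- q) := q) ℚ.≃-refl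

    β≤2 : ∀ j → β j ℚ.≤ 2ℚ
    β≤2 j = ℚ.≤-trans (β≤β⁺ j) β⁺≤2

    -- At the upper end the product may exceed 1. The excess is bounded by 2ᵐ m d: large in m, but
    -- vanishing with the width d as j grows.
    B*upper≤ : ∀ j m → B j m ℚ.* pow (upper j) m ℚ.≤ 1ℚᵘ ℚ.+ pow 2ℚ m ℚ.* (natℚ m ℚ.* d j)
    B*upper≤ j m = begin
      B j m ℚ.* pow (upper j) m                                    ≤⟨ *-monoˡ (B j m) (0≤B j m)
                                                                           (power-gap m (0≤lower j) (lower≤upper j) (ℚ.≤-trans (upper≤hi j) (ℚ.≤-trans hi≤R R≤1))) ⟩
      B j m ℚ.* (pow (lower j) m ℚ.+ natℚ m ℚ.* d j)             ≃⟨ ℚ.*-distribˡ-+ (B j m) (pow (lower j) m) (natℚ m ℚ.* d j) ⟩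
      B j m ℚ.* pow (lower j) m ℚ.+ B j m ℚ.* (natℚ m ℚ.* d j)   ≤⟨ ℚ.+-mono-≤
        (ℚ.≤-respˡ-≃ (ℚ.≃-sym (B*power j m)) (power-≤1 m (0≤1-q j) (1-q≤1 j)))
        (*-monoʳ (natℚ m ℚ.* d j) (0≤* (0≤natℚ m) (0≤width j)) (power-mono m (0≤β j) (β≤2 j))) ⟩
      1ℚᵘ ℚ.+ pow 2ℚ m ℚ.* (natℚ m ℚ.* d j)                      ∎
      where open ℚ.≤-Reasoning

    B-growing : ∀ j m → B j m ℚ.≤ B j (2 ℕ.+ m)
    B-growing j m = ℚ.≤-trans (step (0≤B j m)) (step (0≤B j (suc m)))
      where
      step : ∀ {p} → 0ℚᵘ ℚ.≤ p → p ℚ.≤ β j ℚ.* p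
      step {p} 0≤p = ℚ.≤-respˡ-≃ (ℚ.*-identityˡ p) (*-monoʳ p 0≤p (ℚ.≤-trans 1≤β⁻ (β⁻≤β j)))

    0≤W : ∀ m → 0ℚᵘ ℚ.≤ W m
    0≤W m = 0≤natℚ (walkCount E m zero)

    -- Here m is fixed before j, so the factor in front of q j may depend on m, while C does not.
    upperBound : ∀ m → fromℤ (sequence F (2 ℕ.+ m)) ≤ᵣ ι C *ᵣ (1/r ^ᵣ (2 ℕ.+ m))
    upperBound m ε 0<ε = proj₁ v , λ j N≤j →
      ℚ.≤-respˡ-≃ (ℚ.≃-sym (term m j)) (subst (λ p → 2ℚ ℚ.* W m ℚ.≤ C ℚ.* p ℚ.+ ε) (sym (^ᵣ-seq 1/r (2 ℕ.+ m) j))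
        (bounded-by-power {a} {b} {C} {W m} {natℚ m} {q j} {pow (lower j) m} {B j m} {B j (2 ℕ.+ m)}
          0<a (ℚ.<⇒≤ 0<C) (0≤W m) (0≤B j m) 2b≤aC (walks≤ m (lo≤lower j) (lower≤hi j) (0≤q j))
          (B*lower≥ j m) (proj₂ v j N≤j) (B-growing j m)))
      where
      v : Eventually (λ j → ((2ℚ ℚ.* W m) ℚ.* natℚ m) ℚ.* q j ℚ.≤ ε)
      v = q-vanishes (0≤* (0≤* (0≤natℚ 2) (0≤W m)) (0≤natℚ m)) 0<ε

    lowerBound : ∀ m → ι c *ᵣ (1/r ^ᵣ (2 ℕ.+ m)) ≤ᵣ fromℤ (sequence F (2 ℕ.+ m))
    lowerBound m ε 0<ε = proj₁ v , λ j N≤j →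
      ℚ.≤-respʳ-≃ (ℚ.+-congˡ ε (ℚ.≃-sym (term m j))) (subst (λ p → c ℚ.* p ℚ.≤ 2ℚ ℚ.* W m ℚ.+ ε) (sym (^ᵣ-seq 1/r (2 ℕ.+ m) j))
        (bounds-power {a} {b} {c} {W m} {pow 2ℚ m ℚ.* (natℚ m ℚ.* d j)} {pow (upper j) m} {B j m} {β j}
          0<b (ℚ.<⇒≤ 0<c) (0≤W m) (0≤B j m) (0≤β j) (β≤2 j) 2bc≤a
          (walks≥ m (lo≤upper j) (upper≤hi j) (Brackets.g-upper (bracketed j))) (B*upper≤ j m)
          (ℚ.≤-respˡ-≃ (eq (2ℚ ℚ.* W m) (pow 2ℚ m) (natℚ m) (d j)) (proj₂ v j N≤j))))
      where
      v : Eventually (λ j → (((2ℚ ℚ.* W m) ℚ.* pow 2ℚ m) ℚ.* natℚ m) ℚ.* d j ℚ.≤ ε)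
      v = width-vanishes (0≤* (0≤* (0≤* (0≤natℚ 2) (0≤W m)) (0≤power m (0≤natℚ 2))) (0≤natℚ m)) 0<ε
      open +-*-Solver using (_:=_; _:*_) renaming (solve to ring)
      eq : ∀ w t n d → ((w ℚ.* t) ℚ.* n) ℚ.* d ℚ.≃ w ℚ.* (t ℚ.* (n ℚ.* d))
      eq = ring 4 (λ w t n d → ((w :* t) :* n) :* d := w :* (t :* (n :* d))) ℚ.≃-refl

    theta : (λ n → fromℤ (sequence F n)) ∈Θ (λ n → 1/r ^ᵣ n)
    -- The estimate starts at 2, since `sequence` is set to 0 at 0 and 1, where a positive lower
    -- bound fails.
    theta = ι c , ι C , positive 0<c , positive 0<C , 2 ,
        λ { (suc (suc m)) _ → lowerBound m , upperBound m ; 1 (ℕ.s≤s ()) }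
      where
      positive : ∀ {x} → 0ℚᵘ ℚ.< x → 0ᵣ <ᵣ ι x
      positive {x} 0<x = x , 0<x , 0 , λ _ _ → ℚ.≤-reflexive (ℚ.+-identityˡ x)

    hasGrowth : HasGrowth F root base places
    hasGrowth = r , 1/r , (isRoot , minimal) , root-digits , inverse , base-digits , theta

    overtaken : ∀ {x z H} (f : ℕ → ℕ) → Slower x z H → (∀ m → natℚ (f m) ℚ.* pow x m ℚ.≤ H) →
      Eventually (λ m → f m ℕ.< walkCount E m zero)
    overtaken f (0≤x , 0≤z , z<1 , hi≤zx , 0≤H) bounded =
      overtake f (λ m → walkCount E m zero) 0≤x 0≤hi 0≤z z<1 hi≤zx 0<a (ℚ.<⇒≤ 0<b) 0≤H bounded
        (λ m → walks≥ m lo≤hi ℚ.≤-refl Q-hi)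

-- The infinite digraph is a ladder 12, 123, 1234, … of identity permutations: from the rung d one
-- climbs to d + 1, or leaves to the right and comes back after d ∸ (k + 1) forced steps.

ladder : ℕ → ℕ → ℕ → ℕ
ladder k g d = count k g ((0 , 1) , (0 , d))

-- While the right end has positive slack only the left insertion is possible; it reproduces the
-- front (0 , 1) and raises the right letter. If fewer than t generations remain, a single
-- descendant survives, as `ladder k 0` records.
chain : ∀ k g t e → count k g ((0 , 1) , (t , e)) ≡ ladder k (g ∸ t) (t ℕ.+ e)
chain k g       zero    e = refl
chain k zero    (suc t) e = refl
chain k (suc g) (suc t) e = begin
  count k g ((0 ∸ k , 1) , (t , suc e)) ℕ.+ 0   ≡⟨ ℕ.+-identityʳ _ ⟩
  count k g ((0 ∸ k , 1) , (t , suc e))         ≡⟨ cong (λ s → count k g ((s , 1) , (t , suc e))) (ℕ.0∸n≡0 k) ⟩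
  count k g ((0 , 1) , (t , suc e))             ≡⟨ chain k g t (suc e) ⟩
  ladder k (g ∸ t) (t ℕ.+ suc e)                ≡⟨ cong (ladder k (g ∸ t)) (ℕ.+-suc t e) ⟩
  ladder k (g ∸ t) (suc (t ℕ.+ e))              ∎
  where open ≡-Reasoning

-- For j = 0 the right turn already is rung 2 up to reversal. For j > 0 the j forced steps raise the
-- right letter from 1 to j + 1.
landing : ℕ → ℕ
landing j = suc (1 ⊔ j)

-- The bound is `suc k` because a 1 put next to the letter 2 leaves slack 2 ∸ (k + 2) = 0. With
-- convexity bound 0 that slack would be 1 and the front would be blocked.
turned : ∀ k g j → count (suc k) g ((0 , 2) , (j , 1)) ≡ ladder (suc k) (g ∸ j) (landing j)
turned k g       zero    = count-swap (suc k) g ((0 , 1) , (0 , 2))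
turned k zero    (suc j) = refl
turned k (suc g) (suc j) = begin
  count (suc k) g ((0 ∸ k , 1) , (j , 2)) ℕ.+ 0  ≡⟨ ℕ.+-identityʳ _ ⟩
  count (suc k) g ((0 ∸ k , 1) , (j , 2))        ≡⟨ cong (λ s → count (suc k) g ((s , 1) , (j , 2))) (ℕ.0∸n≡0 k) ⟩
  count (suc k) g ((0 , 1) , (j , 2))            ≡⟨ chain (suc k) g j 2 ⟩
  ladder (suc k) (g ∸ j) (j ℕ.+ 2)               ≡⟨ cong (ladder (suc k) (g ∸ j)) (ℕ.+-comm j 2) ⟩
  ladder (suc k) (g ∸ j) (suc (suc j))           ∎
  where open ≡-Reasoning

ladder-suc : ∀ k g d → let j = d ∸ suc (suc k) in
  ladder (suc k) (suc g) d ≡ ladder (suc k) g (suc d) ℕ.+ ladder (suc k) (g ∸ j) (landing j)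
ladder-suc k g d = cong (ladder (suc k) g (suc d) ℕ.+_) (turned k g (d ∸ suc (suc k)))

power-antitone : ∀ {x m n} → 0ℚᵘ ℚ.≤ x → x ℚ.≤ 1ℚᵘ → m ℕ.≤ n → pow x n ℚ.≤ pow x m
power-antitone {x} {m} {n} 0≤x x≤1 m≤n = begin
  pow x n                           ≡⟨ cong (pow x) (sym (ℕ.m+[n∸m]≡n m≤n)) ⟩
  pow x (m ℕ.+ (n ∸ m))             ≃⟨ power-+ x m (n ∸ m) ⟩
  pow x m ℚ.* pow x (n ∸ m)      ≤⟨ *-monoˡ (pow x m) (0≤power m 0≤x) (power-≤1 (n ∸ m) 0≤x x≤1) ⟩
  pow x m ℚ.* 1ℚᵘ                   ≃⟨ ℚ.*-identityʳ (pow x m) ⟩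
  pow x m                           ∎
  where open ℚ.≤-Reasoning

-- Multiplying each step of ladder-suc by x does not raise h, so the count grows at most like x⁻ᵐ.
record Supersolution (k : ℕ) (x : ℚᵘ) (h : ℕ → ℚᵘ) (d : ℕ) : Set where
  constructor supersolution
  field
    one≤   : 1ℚᵘ ℚ.≤ h d
    return : let j = d ∸ suc (suc k) in x ℚ.* h (suc d) ℚ.+ pow x (suc j) ℚ.* h (landing j) ℚ.≤ h d
    stuck  : x ℚ.* h (suc d) ℚ.+ x ℚ.≤ h d

-- A return uses j + 1 generations at once, hence the induction on a bound `N` for g. If j ≤ g the
-- return is completed and `return` applies. If g ≤ j the right branch has exactly one descendant,
-- weighted by at most x, and `stuck` applies.
ladder-bound : ∀ k {x h} → 0ℚᵘ ℚ.≤ x → x ℚ.≤ 1ℚᵘ → (∀ d → Supersolution k x h d) →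
  ∀ N g d → g ℕ.≤ N → natℚ (ladder (suc k) g d) ℚ.* pow x g ℚ.≤ h d
ladder-bound k {x} {h} 0≤x x≤1 super N zero d _ =
  ℚ.≤-respˡ-≃ (ℚ.≃-sym (ℚ.*-identityʳ 1ℚᵘ)) (Supersolution.one≤ (super d))
ladder-bound k {x} {h} 0≤x x≤1 super (suc N) (suc g) d (ℕ.s≤s g≤N) = begin
  natℚ (ladder (suc k) (suc g) d) ℚ.* (x ℚ.* pow x g)
    ≃⟨ ℚ.*-congʳ {x ℚ.* pow x g} (ℚ.≃-trans (ℚ.≃-reflexive (cong natℚ (ladder-suc k g d))) (natℚ-+ (ladder (suc k) g (suc d)) (ladder (suc k) (g ∸ j) (landing j)))) ⟩
  (U ℚ.+ V) ℚ.* (x ℚ.* pow x g)                 ≃⟨ eq U V x (pow x g) ⟩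
  x ℚ.* (U ℚ.* pow x g) ℚ.+ V ℚ.* (x ℚ.* pow x g)
    ≤⟨ ℚ.+-monoˡ-≤ (V ℚ.* (x ℚ.* pow x g)) (*-monoˡ x 0≤x (ladder-bound k 0≤x x≤1 super N g (suc d) g≤N)) ⟩
  x ℚ.* h (suc d) ℚ.+ V ℚ.* (x ℚ.* pow x g)     ≤⟨ side (ℕ.≤-total j g) ⟩
  h d                                              ∎
  where
  open ℚ.≤-Reasoning
  j = d ∸ suc (suc k)
  U V : ℚᵘ
  U = natℚ (ladder (suc k) g (suc d))
  V = natℚ (ladder (suc k) (g ∸ j) (landing j))
  open +-*-Solver using (solve; _:=_; _:+_; _:*_)
  eq : ∀ u v x p → (u ℚ.+ v) ℚ.* (x ℚ.* p) ℚ.≃ x ℚ.* (u ℚ.* p) ℚ.+ v ℚ.* (x ℚ.* p)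
  eq = solve 4 (λ u v x p → (u :+ v) :* (x :* p) := x :* (u :* p) :+ v :* (x :* p)) ℚ.≃-refl
  eq′ : ∀ v x p q → v ℚ.* (x ℚ.* (p ℚ.* q)) ℚ.≃ (x ℚ.* p) ℚ.* (v ℚ.* q)
  eq′ = solve 4 (λ v x p q → v :* (x :* (p :* q)) := (x :* p) :* (v :* q)) ℚ.≃-refl
  side : j ℕ.≤ g ⊎ g ℕ.≤ j → x ℚ.* h (suc d) ℚ.+ V ℚ.* (x ℚ.* pow x g) ℚ.≤ h d
  side (inj₁ j≤g) = begin
    x ℚ.* h (suc d) ℚ.+ V ℚ.* (x ℚ.* pow x g)
      ≃⟨ ℚ.+-congʳ (x ℚ.* h (suc d)) (ℚ.*-congˡ {V} (ℚ.*-congˡ {x} (ℚ.≃-trans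
           (ℚ.≃-reflexive (cong (pow x) (sym (ℕ.m+[n∸m]≡n j≤g)))) (power-+ x j (g ∸ j))))) ⟩
    x ℚ.* h (suc d) ℚ.+ V ℚ.* (x ℚ.* (pow x j ℚ.* pow x (g ∸ j)))
      ≃⟨ ℚ.+-congʳ (x ℚ.* h (suc d)) (eq′ V x (pow x j) (pow x (g ∸ j))) ⟩
    x ℚ.* h (suc d) ℚ.+ pow x (suc j) ℚ.* (V ℚ.* pow x (g ∸ j))
      ≤⟨ ℚ.+-monoʳ-≤ (x ℚ.* h (suc d)) (*-monoˡ (pow x (suc j)) (0≤power (suc j) 0≤x)
           (ladder-bound k 0≤x x≤1 super N (g ∸ j) (landing j) (ℕ.≤-trans (ℕ.m∸n≤m g j) g≤N))) ⟩
    x ℚ.* h (suc d) ℚ.+ pow x (suc j) ℚ.* h (landing j)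
      ≤⟨ Supersolution.return (super d) ⟩
    h d ∎
  side (inj₂ g≤j) = begin
    x ℚ.* h (suc d) ℚ.+ V ℚ.* (x ℚ.* pow x g)
      ≃⟨ ℚ.+-congʳ (x ℚ.* h (suc d)) (ℚ.*-congʳ {x ℚ.* pow x g} {V} {1ℚᵘ}
           (ℚ.≃-reflexive (cong (λ z → natℚ (ladder (suc k) z (landing j))) (ℕ.m≤n⇒m∸n≡0 g≤j)))) ⟩
    x ℚ.* h (suc d) ℚ.+ 1ℚᵘ ℚ.* (x ℚ.* pow x g)
      ≃⟨ ℚ.+-congʳ (x ℚ.* h (suc d)) (ℚ.*-identityˡ (x ℚ.* pow x g)) ⟩
    x ℚ.* h (suc d) ℚ.+ x ℚ.* pow x g
      ≤⟨ ℚ.+-monoʳ-≤ (x ℚ.* h (suc d)) (*-monoˡ x 0≤x (power-≤1 g 0≤x x≤1)) ⟩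
    x ℚ.* h (suc d) ℚ.+ x ℚ.* 1ℚᵘ
      ≃⟨ ℚ.+-congʳ (x ℚ.* h (suc d)) (ℚ.*-identityʳ x) ⟩
    x ℚ.* h (suc d) ℚ.+ x
      ≤⟨ Supersolution.stuck (super d) ⟩
    h d ∎

-- The last entry of the list is repeated for ever.
heights : ℕ → List ℕ → ℕ → ℕ
heights a []       d       = a
heights a (b ∷ bs) zero    = a
heights a (b ∷ bs) (suc d) = heights b bs d

final : ℕ → List ℕ → ℕ
final a []       = a
final a (b ∷ bs) = final b bs

heights-final : ∀ a bs {d} → length bs ℕ.≤ d → heights a bs d ≡ final a bs
heights-final a []       _            = refl
heights-final a (b ∷ bs) (ℕ.s≤s len≤) = heights-final b bs len≤

module Heights (k : ℕ) (x : ℚᵘ) (a : ℕ) (bs : List ℕ) where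

  D = length bs

  h : ℕ → ℚᵘ
  h d = natℚ (heights a bs d)

  supersolution? : ∀ d → Dec (Supersolution k x h d)
  supersolution? d = map′ (λ (p , q , r) → supersolution p q r) (λ (supersolution p q r) → p , q , r)
    ((_ ℚ.≤? _) ×-dec (_ ℚ.≤? _) ×-dec (_ ℚ.≤? _))

  H : ℚᵘ
  H = natℚ (final a bs)

  Sufficient : Set
  Sufficient = (0ℚᵘ ℚ.≤ x × x ℚ.≤ 1ℚᵘ) × (∀ {d} → d ℕ.< D ℕ.+ suc k → Supersolution k x h d) ×
    (1ℚᵘ ℚ.≤ H) × (x ℚ.* H ℚ.+ pow x D ℚ.* H ℚ.≤ H) × (x ℚ.* H ℚ.+ x ℚ.≤ H)

  sufficient? : Dec Sufficient
  sufficient? = ((_ ℚ.≤? _) ×-dec (_ ℚ.≤? _)) ×-dec ℕ.allUpTo? supersolution? (D ℕ.+ suc k) ×-dec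
    (_ ℚ.≤? _) ×-dec (_ ℚ.≤? _) ×-dec (_ ℚ.≤? _)

  -- From d = D + k + 1 on, all three heights involved equal H and the return takes at least D
  -- generations, so x to the power j + 1 is at most xᴰ. One inequality for H therefore covers all
  -- large d, and finitely many d remain to be checked.
  supersolves : Sufficient → ∀ d → Supersolution k x h d
  supersolves ((0≤x , x≤1) , small , one , ret , st) d = [ beyond , small ]′ (ℕ.≤-<-connex (D ℕ.+ suc k) d)
    where
    h≡H : ∀ {e} → D ℕ.≤ e → h e ≡ H
    h≡H D≤e = cong natℚ (heights-final a bs D≤e)
    beyond : D ℕ.+ suc k ℕ.≤ d → Supersolution k x h d
    beyond D+k≤d = supersolution
      (subst (1ℚᵘ ℚ.≤_) (sym (h≡H D≤d)) one)
      (subst₂ ℚ._≤_ (cong₂ (λ u v → x ℚ.* u ℚ.+ pow x (suc j) ℚ.* v) (sym (h≡H (ℕ.m≤n⇒m≤1+n D≤d))) (sym (h≡H D≤landing)))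
        (sym (h≡H D≤d))
        (ℚ.≤-trans (ℚ.+-monoʳ-≤ (x ℚ.* H) (*-monoʳ H (ℚ.≤-trans 0≤1 one) (power-antitone 0≤x x≤1 D≤1+j))) ret))
      (subst₂ ℚ._≤_ (cong (λ u → x ℚ.* u ℚ.+ x) (sym (h≡H (ℕ.m≤n⇒m≤1+n D≤d)))) (sym (h≡H D≤d)) st)
      where
      j = d ∸ suc (suc k)
      D≤d : D ℕ.≤ d
      D≤d = ℕ.≤-trans (ℕ.m≤m+n D (suc k)) D+k≤d
      D≤1+j : D ℕ.≤ suc j
      D≤1+j = ℕ.≤-trans (subst (ℕ._≤ d ∸ suc k) (ℕ.m+n∸n≡m D (suc k)) (ℕ.∸-monoˡ-≤ (suc k) D+k≤d)) (∸-suc d (suc k))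
        where
        ∸-suc : ∀ m n → m ∸ n ℕ.≤ suc (m ∸ suc n)
        ∸-suc zero    n       = subst (ℕ._≤ 1) (sym (ℕ.0∸n≡0 n)) ℕ.z≤n
        ∸-suc (suc m) zero    = ℕ.≤-refl
        ∸-suc (suc m) (suc n) = ∸-suc m n
      D≤landing : D ℕ.≤ landing j
      D≤landing = ℕ.≤-trans D≤1+j (ℕ.s≤s (ℕ.m≤n⊔m 1 j))

  ladder≤ : True sufficient? → ∀ m d → natℚ (ladder (suc k) m d) ℚ.* pow x m ℚ.≤ h d
  ladder≤ ok m d = ladder-bound k (proj₁ (proj₁ suff)) (proj₂ (proj₁ suff)) (supersolves suff) m m d ℕ.≤-refl
    where suff = toWitness {a? = sufficient?} ok

-- The four instances and the comparison with f

module _ {F n} {E : Digraph (suc n)} (S : TransferSystem F E) {k} (k≤2 : k ℕ.≤ 2) where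

  sequence≡ : ∀ m → sequence F (2 ℕ.+ m) ≡ + (2 ℕ.* walkCount E m zero)
  sequence≡ m = trans (cong (+ 2 ℤ.*_) (TransferSystem.coefficient≡walks S m)) (sym (ℤ.pos-* 2 (walkCount E m zero)))

  below-f : Eventually (λ m → walkCount E m zero ℕ.< convexDescendants k m (1 ∷ 2 ∷ [])) →
    Eventually (λ n → sequence F n < + f k n)
  below-f (N , h) = 2 ℕ.+ N , λ { (suc (suc m)) (ℕ.s≤s (ℕ.s≤s N≤m)) →
    subst₂ _<_ (sym (sequence≡ m)) (cong +_ (sym (f≡2*convexDescendants k≤2 m))) (ℤ.+<+ (ℕ.*-monoʳ-< 2 (h m N≤m))) }

  above-f : Eventually (λ m → convexDescendants k m (1 ∷ 2 ∷ []) ℕ.< walkCount E m zero) →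
    Eventually (λ n → + f k n < sequence F n)
  above-f (N , h) = 2 ℕ.+ N , λ { (suc (suc m)) (ℕ.s≤s (ℕ.s≤s N≤m)) →
    subst₂ _<_ (cong +_ (sym (f≡2*convexDescendants k≤2 m))) (sym (sequence≡ m)) (ℤ.+<+ (ℕ.*-monoʳ-< 2 (h m N≤m))) }

-- Rounded Taylor polynomials of multiples of (x / r - 1) / den, so that the product with den is
-- nearly linear on a disc that contains r.
multiplier₁₋ multiplier₁₊ multiplier₂₋ multiplier₂₊ : Polynomial
multiplier₁₋ = + 6 ∷ - + 3 ∷ - + 3 ∷ + 3 ∷ + 6 ∷ - + 1 ∷ - + 1 ∷ + 7 ∷ []
multiplier₁₊ = + 30 ∷ + 14 ∷ - + 2 ∷ + 12 ∷ + 40 ∷ + 36 ∷ + 29 ∷ + 65 ∷ + 94 ∷ + 99 ∷ + 105 ∷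
  + 180 ∷ + 236 ∷ + 268 ∷ + 342 ∷ + 501 ∷ + 647 ∷ []
multiplier₂₋ = - + 2 ∷ + 2 ∷ + 0 ∷ + 1 ∷ - + 1 ∷ - + 1 ∷ - + 1 ∷ - + 1 ∷ []
multiplier₂₊ = - + 4 ∷ - + 1 ∷ - + 2 ∷ + 1 ∷ - + 2 ∷ - + 3 ∷ - + 5 ∷ - + 6 ∷ []

-- With a = 1/1000 and b = 4 the constants 1/8000 and 8000 solve 2bc = a and 2b = aC exactly. The
-- radii 33/50 and 57/100 leave more than 3/1000 between the squares of the root and of the radius.
module G₁₋ = Growth S₁₋ 65149869151455837735 15349224995 10 multiplier₁₋
  (+ 33 ℚ./ 50) (+ 1 ℚ./ 1000) (+ 4 ℚ./ 1) (+ 1 ℚ./ 8000) (+ 8000 ℚ./ 1)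
module G₁₊ = Growth S₁₊ 65145978572056851317 1535014167 9 multiplier₁₊
  (+ 33 ℚ./ 50) (+ 1 ℚ./ 1000) (+ 4 ℚ./ 1) (+ 1 ℚ./ 8000) (+ 8000 ℚ./ 1)
module G₂₋ = Growth S₂₋ 55979335021175578170 1786373489 9 multiplier₂₋
  (+ 57 ℚ./ 100) (+ 1 ℚ./ 1000) (+ 4 ℚ./ 1) (+ 1 ℚ./ 8000) (+ 8000 ℚ./ 1)
module G₂₊ = Growth S₂₊ 55977426822528580510 1786434384 9 multiplier₂₊
  (+ 57 ℚ./ 100) (+ 1 ℚ./ 1000) (+ 4 ℚ./ 1) (+ 1 ℚ./ 8000) (+ 8000 ℚ./ 1)

certified₁₋ : G₁₋.Certificate
certified₁₋ = toWitness {a? = G₁₋.certificate?} _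

certified₁₊ : G₁₊.Certificate
certified₁₊ = toWitness {a? = G₁₊.certificate?} _

certified₂₋ : G₂₋.Certificate
certified₂₋ = toWitness {a? = G₂₋.certificate?} _

certified₂₊ : G₂₊.Certificate
certified₂₊ = toWitness {a? = G₂₊.certificate?} _

-- The rates 1 / x are chosen between those of the infinite digraph and of F₁₊, F₂₊; the heights solve
-- the supersolution inequalities for x numerically.
module H₁ = Heights 0 (+ 65148 ℚ./ 100000)
  124105 (107779 ∷ 82717 ∷ 44249 ∷ 14031 ∷ 2754 ∷ 346 ∷ 33 ∷ 9 ∷ [])
module H₂ = Heights 1 (+ 55978 ℚ./ 100000)
  94552 (89218 ∷ 79689 ∷ 62667 ∷ 32258 ∷ 13015 ∷ 3611 ∷ 790 ∷ 132 ∷ 34 ∷ [])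

convexDescendants≡ladder₁ : ∀ m → convexDescendants 1 m (1 ∷ 2 ∷ []) ≡ ladder 1 m 2
convexDescendants≡ladder₁ m = convexDescendants≡count 1 m (1 ∷ 2 ∷ []) (ℕ.s≤s (ℕ.s≤s ℕ.z≤n)) _

convexDescendants≡ladder₂ : ∀ m → convexDescendants 2 m (1 ∷ 2 ∷ []) ≡ ladder 2 m 2
convexDescendants≡ladder₂ m = convexDescendants≡count 2 m (1 ∷ 2 ∷ []) (ℕ.s≤s (ℕ.s≤s ℕ.z≤n)) _

descendants-below₁ : Eventually (λ m → convexDescendants 1 m (1 ∷ 2 ∷ []) ℕ.< walkCount (successors⁺ T₁) m zero)
descendants-below₁ = G₁₊.overtaken certified₁₊
  (λ m → convexDescendants 1 m (1 ∷ 2 ∷ []))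
  -- 99997/100000 lies just above the ratio of the root of the denominator to x, and 82717 is the
  -- height of rung 2, the state of 12.
  (toWitness {a? = G₁₊.slower? (+ 65148 ℚ./ 100000) (+ 99997 ℚ./ 100000) (+ 82717 ℚ./ 1)} _)
  λ m → subst (λ c → natℚ c ℚ.* pow (+ 65148 ℚ./ 100000) m ℚ.≤ + 82717 ℚ./ 1)
    (sym (convexDescendants≡ladder₁ m)) (H₁.ladder≤ _ m 2)

descendants-below₂ : Eventually (λ m → convexDescendants 2 m (1 ∷ 2 ∷ []) ℕ.< walkCount (successors⁺ T₂) m zero)
descendants-below₂ = G₂₊.overtaken certified₂₊
  (λ m → convexDescendants 2 m (1 ∷ 2 ∷ []))
  (toWitness {a? = G₂₊.slower? (+ 55978 ℚ./ 100000) (+ 99999 ℚ./ 100000) (+ 79689 ℚ./ 1)} _)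
  λ m → subst (λ c → natℚ c ℚ.* pow (+ 55978 ℚ./ 100000) m ℚ.≤ + 79689 ℚ./ 1)
    (sym (convexDescendants≡ladder₂ m)) (H₂.ladder≤ _ m 2)

descendants-above₁ : Eventually (λ m → walkCount (successors T₁) m zero ℕ.< convexDescendants 1 m (1 ∷ 2 ∷ []))
-- Vertex 9 is the identity of length 7, whose left edge is the deleted one. The identity of length
-- 8 has convex descendants in every generation.
descendants-above₁ = walkCount<convexDescendants T₁ (# 9) left refl λ m → subst (0 ℕ.<_)
  (sym (convexDescendants≡count 1 m _ (toWitness {a? = 2 ℕ.≤? _} _) (toWitness {a? = kConvex? 1 (identity 8)} _)))
  (count-left 1 m (0 , 8))

descendants-above₂ : Eventually (λ m → walkCount (successors T₂) m zero ℕ.< convexDescendants 2 m (1 ∷ 2 ∷ []))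
descendants-above₂ = walkCount<convexDescendants T₂ (# 10) left refl λ m → subst (0 ℕ.<_)
  (sym (convexDescendants≡count 2 m _ (toWitness {a? = 2 ℕ.≤? _} _) (toWitness {a? = kConvex? 2 (identity 9)} _)))
  (count-left 2 m (0 , 9))

1≤2 : 1 ℕ.≤ 2
1≤2 = ℕ.s≤s ℕ.z≤n

mainTheorem5 : (Σ[ T ∈ Truncation 1 (identity 7) (identity 8) ]
    ((∀ m → + walks (adjacency T) m ≡ coefficient m F₁₋) ×
    (∀ m → + walks (withLoopAtLast (adjacency T)) m ≡ coefficient m F₁₊)))
    ×
    (Σ[ T ∈ Truncation 2 (identity 8) (identity 9) ]
    ((∀ m → + walks (adjacency T) m ≡ coefficient m F₂₋) ×
    (∀ m → + walks (withLoopAtLast (adjacency T)) m ≡ coefficient m F₂₊)))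
    ×
    HasGrowth F₁₋ 65149869151455837735 15349224995 10 ×
    HasGrowth F₁₊ 65145978572056851317 1535014167 9 ×
    HasGrowth F₂₋ 55979335021175578170 1786373489 9 ×
    HasGrowth F₂₊ 55977426822528580510 1786434384 9 ×
    Eventually (λ n → sequence F₁₋ n < + f 1 n) ×
    Eventually (λ n → sequence F₂₋ n < + f 2 n) ×
    Eventually (λ n → + f 1 n < sequence F₁₊ n) ×
    Eventually (λ n → + f 2 n < sequence F₂₊ n)
mainTheorem5 =
  proj₁ truncated ,
  proj₂ truncated ,
  G₁₋.hasGrowth certified₁₋ ,
  G₁₊.hasGrowth certified₁₊ ,
  G₂₋.hasGrowth certified₂₋ ,
  G₂₊.hasGrowth certified₂₊ ,
  below-f S₁₋ 1≤2 descendants-above₁ ,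
  below-f S₂₋ ℕ.≤-refl descendants-above₂ ,
  above-f S₁₊ 1≤2 descendants-below₁ ,
  above-f S₂₊ ℕ.≤-refl descendants-below₂
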